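{- Let $n,\alpha\ge 1$ be integers such that $8n\equiv 1\pmod{3^{\alpha}}$. Then $d_2(n)\equiv 0\pmod{3^{2\lfloor \alpha/2\rfloor+1}}$.
   Context: Notation: $(a;q)_\infty=\prod_{j\ge 0}(1-aq^j)$. The 2-elongated plane partition function $d_2(n)$ is defined by the generating function $\sum_{n=0}^{\infty} d_2(n)q^n=\dfrac{(q^2;q^2)_\infty^{2}}{(q;q)_\infty^{7}}$. -}

module Defs where

open import Data.Fin.Base using (zero; suc; toℕ)
open import Data.Integer.Base using (ℤ; +_; 0ℤ; 1ℤ; _+_; _*_; _-_; -_)
open import Data.Integer.Divisibility.Signed using (_∣_)
open import Data.Integer.Properties
open import Data.Nat.Base as ℕ using (ℕ; zero; suc; _∸_; z≤n; s≤s)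
import Data.Nat.Properties as ℕ
open import Data.Vec.Functional using (Vector; []; _∷_; head)
open import Function.Base using (_∘_)
open import Relation.Binary.PropositionalEquality
open ≡-Reasoning

open import Algebra.Properties.Monoid.Sum +-0-monoid
  using (sum; sum⁺-syntax; sum-cong-≗; sum-replicate-zero)

infix 4 _≡_[mod_]

_≡_[mod_] : ℤ → ℤ → ℤ → Set
a ≡ b [mod m ] = m ∣ a - b

-- Formal power series over ℤ, given by their coefficients.

Series : Set
Series = ℕ → ℤ

infixl 6 _⊖_
infixl 7 _⊛_ _⊘_
infixr 8 _↑_

𝟙 : Series
𝟙 zero    = 1ℤ
𝟙 (suc _) = 0ℤ

X : Series
X 1 = 1ℤ
X _ = 0ℤ

_⊖_ : Series → Series → Series
(f ⊖ g) n = f n - g n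

_⊛_ : Series → Series → Series
(f ⊛ g) n = ∑[ i ≤ n ] (f (toℕ i) * g (n ∸ toℕ i))

_↑_ : Series → ℕ → Series
f ↑ zero  = 𝟙
f ↑ suc k = f ⊛ f ↑ k

-- `inverseCoeffs f n` lists the coefficients n, n - 1, …, 0 of 1 / f, for f
-- with constant term 1 (see `⊛-inverse`).

inverseCoeffs : Series → ∀ n → Vector ℤ (suc n)
inverseCoeffs f zero    = 1ℤ ∷ []
inverseCoeffs f (suc n) =
  - (∑[ i ≤ n ] (f (suc (toℕ i)) * inverseCoeffs f n i)) ∷ inverseCoeffs f n

inverse : Series → Series
inverse f n = head (inverseCoeffs f n)

_⊘_ : Series → Series → Series
f ⊘ g = f ⊛ inverse g

∏< : ℕ → (ℕ → Series) → Series
∏< zero    F = 𝟙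
∏< (suc N) F = F N ⊛ ∏< N F

-- (a ; q)_∞ = ∏_{j ≥ 0} (1 - a q^j), for q with zero constant term. The limit
-- is coefficientwise: the factors with j > n do not affect the coefficient of
-- degree n (see `⟨⟩∞-limit`).

factor : Series → Series → ℕ → Series
factor a q j = 𝟙 ⊖ a ⊛ q ↑ j

⟨_⨾_⟩∞ : Series → Series → Series
⟨ a ⨾ q ⟩∞ n = ∏< (suc n) (factor a q) n

d₂ : Series
d₂ = ⟨ X ↑ 2 ⨾ X ↑ 2 ⟩∞ ↑ 2 ⊘ ⟨ X ⨾ X ⟩∞ ↑ 7

d₂-denominator₀ : (⟨ X ⨾ X ⟩∞ ↑ 7) 0 ≡ 1ℤ
d₂-denominator₀ = refl

private
  inverseCoeffs-lookup : ∀ f n i → inverseCoeffs f n i ≡ inverse f (n ∸ toℕ i)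
  inverseCoeffs-lookup f zero    zero    = refl
  inverseCoeffs-lookup f (suc n) zero    = refl
  inverseCoeffs-lookup f (suc n) (suc i) = inverseCoeffs-lookup f n i

  sum-zero : ∀ n (t : Vector ℤ n) → (∀ i → t i ≡ 0ℤ) → sum t ≡ 0ℤ
  sum-zero n t t≡0 = trans (sum-cong-≗ t≡0) (sum-replicate-zero n)

⊛-inverse : ∀ f → f 0 ≡ 1ℤ → f ⊛ inverse f ≗ 𝟙
⊛-inverse f f₀≡1 zero    rewrite f₀≡1 = refl
⊛-inverse f f₀≡1 (suc n) = begin
  f 0 * - s + s′ ≡⟨ cong₂ (λ x y → x * - s + y) f₀≡1 (sym s≡s′) ⟩
  1ℤ * - s + s   ≡⟨ cong (_+ s) (*-identityˡ (- s)) ⟩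
  - s + s        ≡⟨ +-inverseˡ s ⟩
  0ℤ             ∎
  where
  s  = ∑[ i ≤ n ] (f (suc (toℕ i)) * inverseCoeffs f n i)
  s′ = ∑[ i ≤ n ] (f (suc (toℕ i)) * inverse f (n ∸ toℕ i))
  s≡s′ : s ≡ s′
  s≡s′ = sum-cong-≗ (λ i → cong (f (suc (toℕ i)) *_) (inverseCoeffs-lookup f n i))

private
  VanishesBelow : ℕ → Series → Set
  VanishesBelow k f = ∀ i → i ℕ.< k → f i ≡ 0ℤ

  ⊛-vanishes : ∀ f {g k} → VanishesBelow k g → VanishesBelow k (f ⊛ g)
  ⊛-vanishes f {g} g<k≡0 n n<k = sum-zero (suc n) _ λ i → trans
    (cong (f (toℕ i) *_) (g<k≡0 _ (ℕ.≤-<-trans (ℕ.m∸n≤m n (toℕ i)) n<k)))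
    (*-zeroʳ (f (toℕ i)))

  ↑-vanishes : ∀ q → q 0 ≡ 0ℤ → ∀ j → VanishesBelow j (q ↑ j)
  ↑-vanishes q q₀≡0 (suc j) n (s≤s n≤j) = cong₂ _+_
    (cong (_* (q ↑ j) n) q₀≡0) (rest n n≤j)
    where
    rest : ∀ n → n ℕ.≤ j → sum {n} (λ i → q (suc (toℕ i)) * (q ↑ j) (n ∸ suc (toℕ i))) ≡ 0ℤ
    rest zero    _   = refl
    rest (suc n) n<j = ⊛-vanishes (q ∘ suc) (↑-vanishes q q₀≡0 j) n n<j

  𝟙⊖-⊛ : ∀ {h} g n → VanishesBelow (suc n) h → ((𝟙 ⊖ h) ⊛ g) n ≡ g n
  𝟙⊖-⊛ {h} g n h≤n≡0 = begin
    (1ℤ - h 0) * g n + sum rest ≡⟨ cong₂ _+_ (cong (λ x → (1ℤ - x) * g n) (h≤n≡0 0 (s≤s z≤n))) (sum-zero n rest rest≡0) ⟩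
    1ℤ * g n + 0ℤ               ≡⟨ +-identityʳ _ ⟩
    1ℤ * g n                    ≡⟨ *-identityˡ (g n) ⟩
    g n                         ∎
    where
    rest : Vector ℤ n
    rest i = (0ℤ - h (suc (toℕ i))) * g (n ∸ suc (toℕ i))
    rest≡0 : ∀ i → rest i ≡ 0ℤ
    rest≡0 i = cong (λ x → (0ℤ - x) * g (n ∸ suc (toℕ i))) (h≤n≡0 _ (s≤s (toℕ<n i)))
      where open import Data.Fin.Properties using (toℕ<n)

⟨⟩∞-limit : ∀ a q → q 0 ≡ 0ℤ → ∀ n k →
            ∏< (k ℕ.+ suc n) (factor a q) n ≡ ⟨ a ⨾ q ⟩∞ n
⟨⟩∞-limit a q q₀≡0 n zero    = refl
⟨⟩∞-limit a q q₀≡0 n (suc k) = trans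
  (𝟙⊖-⊛ (∏< (k ℕ.+ suc n) (factor a q)) n λ i i≤n →
    ⊛-vanishes a (↑-vanishes q q₀≡0 _) i (ℕ.<-≤-trans i≤n (ℕ.m≤n+m (suc n) k)))
  (⟨⟩∞-limit a q q₀≡0 n k)

{-# OPTIONS --safe #-}
module Submission where

-- Write φ = φ(-q) = f₁²/f₂ and ψ = ψ(q) = f₂²/f₁, so that Σ d₂(n) qⁿ = 1/(φ⁴ψ). The
-- 3-dissections of the theta series φ and ψ (from the Jacobi triple product) are
-- both expressed by the cubic continued fraction x ∈ q ℤ[[q³]]:
--   φ(q) = φ(q⁹) (1 - 2x),   x ψ(q) = q ψ(q⁹) (1 + x),
-- and x³ = y(q³) for a series y with y (1 + 2x + 4x²) = x (1 - x + x²). In terms of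
-- t = x/(1 - 2x), Z = y/(1 - 8y) and ζ = Z(q³) this reads
--   Z = t + 3t² + 3t³,   t³ = ζ (1 + 6t + 12t²),
-- so extracting the exponents divisible by 3 becomes a ℤ[Z]-linear algebra problem:
-- up to the factors d₂(q) and d₂(q³) the generating functions of d₂ on the residue
-- classes inverse to 8 modulo 3^α are obtained from one another by
--   F ↦ (1 + 8Z)/(1 + 9Z) U(t (1 + 2t) (1 + 3t + 3t²) F)   and   F ↦ U(F).
-- The lattices spanned by 3^(w n) Z^(n+1) for suitable weights w are stable under
-- these maps, and two consecutive steps gain a factor 9. As Z^n satisfies a cubic
-- recurrence over ℤ[ζ], this has to be verified for finitely many n only.

-- The equation between x and y comes from evaluating the cubic norm of φ, the product of φ(ω^k q)
-- over the cube roots of unity, in two ways: from the 3-dissection and from the infinite products.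
-- The norm is encoded as a cubic form in the three components of a dissection, which keeps all
-- coefficients in ℤ. Multiplication by 1 + 8Z does not preserve the lattice used after an odd step.
-- This factor is therefore held back and applied just before the next extraction: F ↦ U(t (1 + 2t)
-- (1 + 3t + 3t²) F) changes the lattice without gain, and F ↦ U((1 + 8Z) F) changes it back and
-- gains the whole factor 9. One more factor 3 is present from the start, in U(t (1 + 2t) (1 + 3t +
-- 3t²)). The factor 1/(1 + 9Z) is an infinite series in Z, whereas lattice elements are finite
-- combinations. Membership is therefore stated modulo q^M for every M, and each extraction divides
-- the available precision by 3. For odd α > 1 the claimed exponent is that of α - 1, so the odd
-- step alone matters only for α = 1.

open import Defs
open import Algebra.Bundles using (CommutativeRing)
import Algebra.Solver.Ring as RingSolver
open import Algebra.Solver.Ring.AlmostCommutativeRing using (fromCommutativeRing; _-Raw-AlmostCommutative⟶_)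
open import Algebra.Structures using (IsCommutativeRing)
open import Data.Integer.Base as ℤ using (ℤ; +_; 0ℤ; 1ℤ; -_; _*_; _^_)
open import Data.Integer.Divisibility.Signed
  using (_∣_; divides; _∣?_; ∣-refl; ∣-trans; ∣⇒∣ᵤ; ∣m∣n⇒∣m+n; ∣m∣n⇒∣m-n; ∣n⇒∣m*n; ∣m⇒∣m*n; *-monoʳ-∣)
import Data.Integer.Properties as ℤ
open import Data.Integer.Solver using (module +-*-Solver)
open import Data.List.Base using (List; []; _∷_; map)
open import Data.Maybe.Base using (Maybe; just; nothing)
open import Data.Nat.Base as ℕ using (ℕ; zero; suc; _≤_; _<_; z≤n; s≤s; ⌊_/2⌋)
import Data.Nat.Divisibility as ℕ
import Data.Nat.Properties as ℕ
open import Data.Product.Base using (∃; _×_; _,_; proj₁; proj₂)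
open import Data.Sum.Base using (_⊎_; inj₁; inj₂)
open import Data.Unit.Base using (⊤; tt)
open import Function.Base using (_∘_; case_of_)
open import Level using (0ℓ)
open import Relation.Binary.Bundles using (Setoid)
open import Relation.Binary.PropositionalEquality
import Relation.Binary.Reasoning.Setoid as SetoidReasoning
open import Relation.Nullary.Decidable using (Dec; yes; no; _×-dec_; True; toWitness)

-- The ring of formal power series

infix  4 _≈_ _≈[_]_
infixl 6 _⊕_ _⊟_
infixl 7 _⊗_

-- A record rather than a function type, so that both series can be inferred from the type of a
-- proof.
record _≈_ (f g : Series) : Set where
  constructor mk
  field at : ∀ n → f n ≡ g n
open _≈_ public

record _≈[_]_ (f : Series) (M : ℕ) (g : Series) : Set where
  constructor mk
  field below : ∀ n → n < M → f n ≡ g n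
open _≈[_]_ public

tail : Series → Series
tail f n = f (suc n)

private
  _⊹_ : Series → Series → Series
  (f ⊹ g) n = f n ℤ.+ g n

  _⊙_ : ℤ → Series → Series
  (c ⊙ f) n = c ℤ.* f n

  ⊛-local : ∀ {f f′ g g′} n → (∀ i → i ≤ n → f i ≡ f′ i) → (∀ i → i ≤ n → g i ≡ g′ i) →
            (f ⊛ g) n ≡ (f′ ⊛ g′) n
  ⊛-local zero p q = cong₂ (λ a b → a ℤ.* b ℤ.+ 0ℤ) (p 0 z≤n) (q 0 z≤n)
  ⊛-local {f} {f′} (suc n) p q = cong₂ ℤ._+_
    (cong₂ ℤ._*_ (p 0 z≤n) (q (suc n) ℕ.≤-refl))
    (⊛-local {tail f} {tail f′} n (λ i i≤n → p (suc i) (s≤s i≤n)) (λ i i≤n → q i (ℕ.m≤n⇒m≤1+n i≤n)))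

  ⊛-distribʳ : ∀ h f g n → ((f ⊹ g) ⊛ h) n ≡ (f ⊛ h) n ℤ.+ (g ⊛ h) n
  ⊛-distribʳ h f g zero = solve 3 (λ a b c →
    (a :+ b) :* c :+ con 0ℤ := a :* c :+ con 0ℤ :+ (b :* c :+ con 0ℤ)) refl (f 0) (g 0) (h 0)
    where open +-*-Solver
  ⊛-distribʳ h f g (suc n) rewrite ⊛-distribʳ h (tail f) (tail g) n = solve 5 (λ a b c d e →
    (a :+ b) :* c :+ (d :+ e) := a :* c :+ d :+ (b :* c :+ e)) refl
    (f 0) (g 0) (h (suc n)) ((tail f ⊛ h) n) ((tail g ⊛ h) n)
    where open +-*-Solver

  ⊙-⊛ : ∀ c f g n → ((c ⊙ f) ⊛ g) n ≡ c ℤ.* (f ⊛ g) n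
  ⊙-⊛ c f g zero = solve 3 (λ c a b → c :* a :* b :+ con 0ℤ := c :* (a :* b :+ con 0ℤ)) refl c (f 0) (g 0)
    where open +-*-Solver
  ⊙-⊛ c f g (suc n) rewrite ⊙-⊛ c (tail f) g n = solve 4 (λ c a b d →
    c :* a :* b :+ c :* d := c :* (a :* b :+ d)) refl c (f 0) (g (suc n)) ((tail f ⊛ g) n)
    where open +-*-Solver

  ⊛-zeroˡ : ∀ f n → ((λ _ → 0ℤ) ⊛ f) n ≡ 0ℤ
  ⊛-zeroˡ f n = ⊙-⊛ 0ℤ (λ _ → 0ℤ) f n

  constant : ℤ → Series
  constant c zero    = c
  constant c (suc n) = 0ℤ

  constant-⊛ : ∀ c f n → (constant c ⊛ f) n ≡ c ℤ.* f n
  constant-⊛ c f zero    = ℤ.+-identityʳ _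
  constant-⊛ c f (suc n) = trans (cong (λ z → c ℤ.* f (suc n) ℤ.+ z) (⊛-zeroˡ f n)) (ℤ.+-identityʳ _)

  ⊛-sucʳ : ∀ f g n → (f ⊛ g) (suc n) ≡ (f ⊛ tail g) n ℤ.+ f (suc n) ℤ.* g 0
  ⊛-sucʳ f g zero = solve 4 (λ a b c d → a :* d :+ (b :* c :+ con 0ℤ) := a :* d :+ con 0ℤ :+ b :* c)
    refl (f 0) (f 1) (g 0) (g 1)
    where open +-*-Solver
  ⊛-sucʳ f g (suc n) rewrite ⊛-sucʳ (tail f) g n = sym (ℤ.+-assoc (f 0 ℤ.* g (suc (suc n))) _ _)

  ⊛-comm : ∀ f g n → (f ⊛ g) n ≡ (g ⊛ f) n
  ⊛-comm f g zero    = cong (ℤ._+ 0ℤ) (ℤ.*-comm (f 0) (g 0))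
  ⊛-comm f g (suc n) = begin
    f 0 ℤ.* g (suc n) ℤ.+ (tail f ⊛ g) n ≡⟨ ℤ.+-comm (f 0 ℤ.* g (suc n)) _ ⟩
    (tail f ⊛ g) n ℤ.+ f 0 ℤ.* g (suc n) ≡⟨ cong₂ ℤ._+_ (⊛-comm (tail f) g n) (ℤ.*-comm (f 0) _) ⟩
    (g ⊛ tail f) n ℤ.+ g (suc n) ℤ.* f 0 ≡⟨ ⊛-sucʳ g f n ⟨
    (g ⊛ f) (suc n)                      ∎
    where open ≡-Reasoning

  ⊛-assoc : ∀ f g h n → ((f ⊛ g) ⊛ h) n ≡ (f ⊛ (g ⊛ h)) n
  ⊛-assoc f g h zero = solve 3 (λ a b c →
    (a :* b :+ con 0ℤ) :* c :+ con 0ℤ := a :* (b :* c :+ con 0ℤ) :+ con 0ℤ) refl (f 0) (g 0) (h 0)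
    where open +-*-Solver
  ⊛-assoc f g h (suc n) = begin
    (f ⊛ g) 0 ℤ.* h (suc n) ℤ.+ (((f 0 ⊙ tail g) ⊹ (tail f ⊛ g)) ⊛ h) n
      ≡⟨ cong (ℤ._+_ ((f ⊛ g) 0 ℤ.* h (suc n))) (⊛-distribʳ h (f 0 ⊙ tail g) (tail f ⊛ g) n) ⟩
    (f ⊛ g) 0 ℤ.* h (suc n) ℤ.+ (((f 0 ⊙ tail g) ⊛ h) n ℤ.+ ((tail f ⊛ g) ⊛ h) n)
      ≡⟨ cong₂ (λ a b → (f ⊛ g) 0 ℤ.* h (suc n) ℤ.+ (a ℤ.+ b)) (⊙-⊛ (f 0) (tail g) h n) (⊛-assoc (tail f) g h n) ⟩
    (f 0 ℤ.* g 0 ℤ.+ 0ℤ) ℤ.* h (suc n) ℤ.+ (f 0 ℤ.* (tail g ⊛ h) n ℤ.+ (tail f ⊛ (g ⊛ h)) n)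
      ≡⟨ solve 5 (λ a b c d e → (a :* b :+ con 0ℤ) :* c :+ (a :* d :+ e) := a :* (b :* c :+ d) :+ e) refl
           (f 0) (g 0) (h (suc n)) ((tail g ⊛ h) n) ((tail f ⊛ (g ⊛ h)) n) ⟩
    f 0 ℤ.* (g ⊛ h) (suc n) ℤ.+ (tail f ⊛ (g ⊛ h)) n ∎
    where
    open ≡-Reasoning
    open +-*-Solver

-- The ring operations are opaque so that conversion checking compares series
-- syntactically instead of unfolding convolutions.
opaque
  _⊗_ : Series → Series → Series
  _⊗_ = _⊛_

  _⊕_ : Series → Series → Series
  _⊕_ = _⊹_

  neg : Series → Series
  neg f n = - f n

  ι : ℤ → Series
  ι = constant

  𝟘 : Series
  𝟘 _ = 0ℤ

_⊟_ : Series → Series → Series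
f ⊟ g = f ⊕ neg g

≈-refl : ∀ {f} → f ≈ f
≈-refl = mk λ _ → refl

≈-sym : ∀ {f g} → f ≈ g → g ≈ f
≈-sym p = mk λ n → sym (at p n)

≈-trans : ∀ {f g h} → f ≈ g → g ≈ h → f ≈ h
≈-trans p q = mk λ n → trans (at p n) (at q n)

≈-reflexive : ∀ {f g} → f ≡ g → f ≈ g
≈-reflexive refl = ≈-refl

≈⇒≈[] : ∀ {M f g} → f ≈ g → f ≈[ M ] g
≈⇒≈[] p = mk λ n _ → at p n

≈[]⇒≈ : ∀ {f g} → (∀ M → f ≈[ M ] g) → f ≈ g
≈[]⇒≈ p = mk λ n → below (p (suc n)) n ℕ.≤-refl

≈[]-weaken : ∀ {M M′ f g} → M ≤ M′ → f ≈[ M′ ] g → f ≈[ M ] g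
≈[]-weaken M≤M′ p = mk λ n n<M → below p n (ℕ.<-≤-trans n<M M≤M′)

≈[]-refl : ∀ {M f} → f ≈[ M ] f
≈[]-refl = mk λ _ _ → refl

≈[]-sym : ∀ {M f g} → f ≈[ M ] g → g ≈[ M ] f
≈[]-sym p = mk λ n n<M → sym (below p n n<M)

≈[]-trans : ∀ {M f g h} → f ≈[ M ] g → g ≈[ M ] h → f ≈[ M ] h
≈[]-trans p q = mk λ n n<M → trans (below p n n<M) (below q n n<M)

≈[]-setoid : ℕ → Setoid 0ℓ 0ℓ
≈[]-setoid M = record
  { Carrier = Series
  ; _≈_ = _≈[ M ]_
  ; isEquivalence = record { refl = ≈[]-refl ; sym = ≈[]-sym ; trans = ≈[]-trans }
  }

opaque
  unfolding _⊗_ 𝟘 neg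

  ⊗-def : ∀ f g → f ⊛ g ≈ f ⊗ g
  ⊗-def f g = ≈-refl

  ⊖-def : ∀ f g → f ⊖ g ≈ f ⊟ g
  ⊖-def f g = ≈-refl

  ⊕-at : ∀ f g n → (f ⊕ g) n ≡ f n ℤ.+ g n
  ⊕-at f g n = refl

  ⊟-at : ∀ f g n → (f ⊟ g) n ≡ f n ℤ.- g n
  ⊟-at f g n = refl

  ι⊗-at : ∀ c f n → (ι c ⊗ f) n ≡ c ℤ.* f n
  ι⊗-at = constant-⊛

  ι-at-suc : ∀ c n → ι c (suc n) ≡ 0ℤ
  ι-at-suc c n = refl

  𝟘-at : ∀ n → 𝟘 n ≡ 0ℤ
  𝟘-at n = refl

  ⊗-at-0 : ∀ f g → (f ⊗ g) 0 ≡ f 0 ℤ.* g 0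
  ⊗-at-0 f g = ℤ.+-identityʳ _

  ⊗-at-suc : ∀ f g n → (f ⊗ g) (suc n) ≡ f 0 ℤ.* g (suc n) ℤ.+ (tail f ⊗ g) n
  ⊗-at-suc f g n = refl

  ⊕-cong : ∀ {f f′ g g′} → f ≈ f′ → g ≈ g′ → f ⊕ g ≈ f′ ⊕ g′
  ⊕-cong p q = mk λ n → cong₂ ℤ._+_ (at p n) (at q n)

  ⊗-cong : ∀ {f f′ g g′} → f ≈ f′ → g ≈ g′ → f ⊗ g ≈ f′ ⊗ g′
  ⊗-cong p q = mk λ n → ⊛-local n (λ i _ → at p i) (λ i _ → at q i)

  neg-cong : ∀ {f f′} → f ≈ f′ → neg f ≈ neg f′
  neg-cong p = mk λ n → cong -_ (at p n)

  ⊕-cong[] : ∀ {M f f′ g g′} → f ≈[ M ] f′ → g ≈[ M ] g′ → f ⊕ g ≈[ M ] f′ ⊕ g′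
  ⊕-cong[] p q = mk λ n n<M → cong₂ ℤ._+_ (below p n n<M) (below q n n<M)

  ⊗-cong[] : ∀ {M f f′ g g′} → f ≈[ M ] f′ → g ≈[ M ] g′ → f ⊗ g ≈[ M ] f′ ⊗ g′
  ⊗-cong[] p q = mk λ n n<M → ⊛-local n
    (λ i i≤n → below p i (ℕ.≤-<-trans i≤n n<M)) (λ i i≤n → below q i (ℕ.≤-<-trans i≤n n<M))

  neg-cong[] : ∀ {M f f′} → f ≈[ M ] f′ → neg f ≈[ M ] neg f′
  neg-cong[] p = mk λ n n<M → cong -_ (below p n n<M)

  ⊕-comm′ : ∀ f g → f ⊕ g ≈ g ⊕ f
  ⊕-comm′ f g = mk λ n → ℤ.+-comm (f n) (g n)

  ⊗-comm′ : ∀ f g → f ⊗ g ≈ g ⊗ f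
  ⊗-comm′ f g = mk (⊛-comm f g)

  ⊗-distribʳ′ : ∀ h f g → (f ⊕ g) ⊗ h ≈ f ⊗ h ⊕ g ⊗ h
  ⊗-distribʳ′ h f g = mk (⊛-distribʳ h f g)

  ⊗-identityˡ′ : ∀ f → 𝟙 ⊗ f ≈ f
  ⊗-identityˡ′ f = mk λ
    { zero    → trans (ℤ.+-identityʳ _) (ℤ.*-identityˡ (f 0))
    ; (suc n) → trans (cong₂ ℤ._+_ (ℤ.*-identityˡ (f (suc n))) (⊛-zeroˡ f n)) (ℤ.+-identityʳ _) }

  ⊕-⊗-isCommutativeRing : IsCommutativeRing _≈_ _⊕_ _⊗_ neg 𝟘 𝟙
  ⊕-⊗-isCommutativeRing = record
    { isRing = record
      { +-isAbelianGroup = record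
        { isGroup = record
          { isMonoid = record
            { isSemigroup = record
              { isMagma = record
                { isEquivalence = record { refl = ≈-refl ; sym = ≈-sym ; trans = ≈-trans }
                ; ∙-cong = ⊕-cong }
              ; assoc = λ f g h → mk λ n → ℤ.+-assoc (f n) (g n) (h n) }
            ; identity = (λ f → mk λ n → ℤ.+-identityˡ (f n)) , (λ f → mk λ n → ℤ.+-identityʳ (f n)) }
          ; inverse = (λ f → mk λ n → ℤ.+-inverseˡ (f n)) , (λ f → mk λ n → ℤ.+-inverseʳ (f n))
          ; ⁻¹-cong = neg-cong }
        ; comm = ⊕-comm′ }
      ; *-cong = ⊗-cong
      ; *-assoc = λ f g h → mk (⊛-assoc f g h)
      ; *-identity = ⊗-identityˡ′ , λ f → ≈-trans (⊗-comm′ f 𝟙) (⊗-identityˡ′ f)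
      ; distrib = (λ f g h → ≈-trans (⊗-comm′ f (g ⊕ h))
                     (≈-trans (⊗-distribʳ′ f g h) (⊕-cong (⊗-comm′ g f) (⊗-comm′ h f))))
                , ⊗-distribʳ′ }
    ; *-comm = ⊗-comm′ }

  ι-+ : ∀ a b → ι (a ℤ.+ b) ≈ ι a ⊕ ι b
  ι-+ a b = mk λ { zero → refl ; (suc n) → refl }

  ι-* : ∀ a b → ι (a ℤ.* b) ≈ ι a ⊗ ι b
  ι-* a b = mk λ
    { zero    → sym (ℤ.+-identityʳ _)
    ; (suc n) → sym (trans (constant-⊛ a (constant b) (suc n)) (ℤ.*-zeroʳ a)) }

  ι-neg : ∀ a → ι (- a) ≈ neg (ι a)
  ι-neg a = mk λ { zero → refl ; (suc n) → refl }

  ι-0 : ι 0ℤ ≈ 𝟘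
  ι-0 = mk λ { zero → refl ; (suc n) → refl }

  ι-1 : ι 1ℤ ≈ 𝟙
  ι-1 = mk λ { zero → refl ; (suc n) → refl }

series : CommutativeRing 0ℓ 0ℓ
series = record { isCommutativeRing = ⊕-⊗-isCommutativeRing }

private
  ι-morphism : ℤ.+-*-rawRing -Raw-AlmostCommutative⟶ fromCommutativeRing series
  ι-morphism = record
    { ⟦_⟧ = ι ; +-homo = ι-+ ; *-homo = ι-* ; -‿homo = ι-neg ; 0-homo = ι-0 ; 1-homo = ι-1 }

  ι-≟ : ∀ a b → Maybe (ι a ≈ ι b)
  ι-≟ a b with a ℤ.≟ b
  ... | yes refl = just ≈-refl
  ... | no _     = nothing

module Solve = RingSolver ℤ.+-*-rawRing (fromCommutativeRing series) ι-morphism ι-≟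

-- The residue inverse to 8

∣8n-1⇒∣n+c : ∀ n c → + (8 ℕ.* c ℕ.+ 1) ∣ + 8 ℤ.* + n ℤ.- 1ℤ → + (8 ℕ.* c ℕ.+ 1) ∣ + (n ℕ.+ c)
∣8n-1⇒∣n+c n c d = subst (p ∣_) (sym eq) (∣m∣n⇒∣m-n (∣m⇒∣m*n _ ∣-refl) (∣n⇒∣m*n (+ c) (∣m∣n⇒∣m+n d ∣-refl)))
  where
  open +-*-Solver
  p = + (8 ℕ.* c ℕ.+ 1)
  -- Modulo p = 8c + 1 the inverse of 8 is - c, since 8 (- c) = 1 - p.
  eq : + (n ℕ.+ c) ≡ p ℤ.* (+ n ℤ.+ + c) ℤ.- + c ℤ.* (+ 8 ℤ.* + n ℤ.- 1ℤ ℤ.+ p)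
  eq = trans (ℤ.pos-+ n c) (trans
    (solve 2 (λ n c → let p = con (+ 8) :* c :+ con 1ℤ in
      n :+ c := p :* (n :+ c) :- c :* (con (+ 8) :* n :- con 1ℤ :+ p)) refl (+ n) (+ c))
    (cong (λ p → p ℤ.* (+ n ℤ.+ + c) ℤ.- + c ℤ.* (+ 8 ℤ.* + n ℤ.- 1ℤ ℤ.+ p)) (sym (trans (ℤ.pos-+ (8 ℕ.* c) 1) (cong (ℤ._+ 1ℤ) (ℤ.pos-* 8 c))))))

-- The modulus 3 is not of the form 8c + 1 and is treated directly: n + 1 = 9n - (8n - 1).
3∣8n-1⇒3∣n+1 : ∀ n → + 3 ∣ + 8 ℤ.* + n ℤ.- 1ℤ → + 3 ∣ + (n ℕ.+ 1)
3∣8n-1⇒3∣n+1 n d = subst (+ 3 ∣_)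
  (trans (solve 1 (λ n → con (+ 9) :* n :- (con (+ 8) :* n :- con 1ℤ) := n :+ con 1ℤ) refl (+ n)) (sym (ℤ.pos-+ n 1)))
  (∣m∣n⇒∣m-n (∣m⇒∣m*n (+ n) (divides (+ 3) refl)) d)
  where open +-*-Solver

-- Ring identities modulo known relations

open Solve using (solve; _:=_; _:+_; _:*_; _:-_; :-_; con; _:^_; Polynomial)

-- Unlike con 1ℤ, this denotes 𝟙 itself.
one : ∀ {n} → Polynomial n
one = con 0ℤ :^ 0

#_ : ∀ {n} → ℕ → Polynomial n
# n = con (+ n)
infix 9 #_

infixl 6 _∔_
infixl 7 _∙_

vanish : ∀ {f g} → f ≈ g → f ⊟ g ≈ 𝟘
vanish {f} {g} p = ≈-trans (⊕-cong p ≈-refl) (CommutativeRing.-‿inverseʳ series g)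

_∙_ : ∀ c {f} → f ≈ 𝟘 → c ⊗ f ≈ 𝟘
c ∙ p = ≈-trans (⊗-cong ≈-refl p) (CommutativeRing.zeroʳ series c)

_∔_ : ∀ {f g} → f ≈ 𝟘 → g ≈ 𝟘 → f ⊕ g ≈ 𝟘
p ∔ q = ≈-trans (⊕-cong p q) (CommutativeRing.+-identityʳ series 𝟘)

-- The scheme for identities that follow from relations l ≈ r: the solver checks f = g + Σ c (l - r)
-- as a polynomial identity, and every summand vanishes by its relation. The cofactors c stand in
-- the solver goal, so the proof of vanishing mostly leaves them as `_`.
modulo : ∀ {f g e} → f ≈ g ⊕ e → e ≈ 𝟘 → f ≈ g
modulo {g = g} p q = ≈-trans p (≈-trans (⊕-cong ≈-refl q) (CommutativeRing.+-identityʳ series g))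

1/_ : Series → Series
1/_ = inverse
infix 8 1/_

⊗-inverseʳ : ∀ {u} → u 0 ≡ 1ℤ → u ⊗ 1/ u ≈ 𝟙
⊗-inverseʳ {u} u₀≡1 = ≈-trans (≈-sym (⊗-def u (1/ u))) (mk (⊛-inverse u u₀≡1))

⊗-cancelˡ : ∀ u {f g} → u 0 ≡ 1ℤ → u ⊗ f ≈ u ⊗ g → f ≈ g
⊗-cancelˡ u {f} {g} u₀≡1 p = modulo
  (solve 4 (λ u v f g → f := g :+ (v :* (u :* f :- u :* g) :+ (g :- f) :* (u :* v :- one))) ≈-refl u (1/ u) f g)
  (1/ u ∙ vanish p ∔ (g ⊟ f) ∙ vanish (⊗-inverseʳ u₀≡1))

ι-cancel : ∀ c .{{_ : ℕ.NonZero c}} {f g} → ι (+ c) ⊗ f ≈ ι (+ c) ⊗ g → f ≈ g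
ι-cancel (suc c) {f} {g} p = mk λ n → ℤ.*-cancelˡ-≡ (+ suc c) (f n) (g n)
  (trans (sym (ι⊗-at (+ suc c) f n)) (trans (at p n) (ι⊗-at (+ suc c) g n)))

X⊗-at-0 : ∀ f → (X ⊗ f) 0 ≡ 0ℤ
X⊗-at-0 f = ⊗-at-0 X f

X⊗-at-suc : ∀ f n → (X ⊗ f) (suc n) ≡ f n
X⊗-at-suc f n = begin
  (X ⊗ f) (suc n)              ≡⟨ ⊗-at-suc X f n ⟩
  0ℤ ℤ.+ (tail X ⊗ f) n       ≡⟨ ℤ.+-identityˡ _ ⟩
  (tail X ⊗ f) n              ≡⟨ at (⊗-cong tail-X ≈-refl) n ⟩
  (𝟙 ⊗ f) n                   ≡⟨ at (CommutativeRing.*-identityˡ series f) n ⟩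
  f n                         ∎
  where
  open ≡-Reasoning
  tail-X : tail X ≈ 𝟙
  tail-X = mk λ { zero → refl ; (suc n) → refl }

-- Substitution of q³ and extraction of residue classes

opaque
  -- The substitution f(q³). Recursion in steps of three avoids division of the index.
  V : Series → Series
  V f zero                = f 0
  V f 1                   = 0ℤ
  V f 2                   = 0ℤ
  V f (suc (suc (suc n))) = V (tail f) n

U₀ U₁ U₂ : Series → Series
U₀ f n = f (n ℕ.* 3)
U₁ f n = f (1 ℕ.+ n ℕ.* 3)
U₂ f n = f (2 ℕ.+ n ℕ.* 3)

opaque
  unfolding V

  V-at₀ : ∀ f n → V f (n ℕ.* 3) ≡ f n
  V-at₀ f zero    = refl
  V-at₀ f (suc n) = V-at₀ (tail f) n

  V-at₁ : ∀ f n → V f (1 ℕ.+ n ℕ.* 3) ≡ 0ℤ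
  V-at₁ f zero    = refl
  V-at₁ f (suc n) = V-at₁ (tail f) n

  V-at₂ : ∀ f n → V f (2 ℕ.+ n ℕ.* 3) ≡ 0ℤ
  V-at₂ f zero    = refl
  V-at₂ f (suc n) = V-at₂ (tail f) n

  private
    V-local : ∀ {f g} n → (∀ i → i ≤ n → f i ≡ g i) → V f n ≡ V g n
    V-local zero p = p 0 z≤n
    V-local 1 p = refl
    V-local 2 p = refl
    V-local (suc (suc (suc n))) p =
      V-local n λ i i≤n → p (suc i) (s≤s (ℕ.m≤n⇒m≤1+n (ℕ.m≤n⇒m≤1+n i≤n)))

    V⊗-at-3+ : ∀ f g n → (V f ⊗ g) (3 ℕ.+ n) ≡ f 0 ℤ.* g (3 ℕ.+ n) ℤ.+ (V (tail f) ⊗ g) n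
    V⊗-at-3+ f g n = begin
      (V f ⊗ g) (3 ℕ.+ n)
        ≡⟨ ⊗-at-suc (V f) g (2 ℕ.+ n) ⟩
      f 0 ℤ.* g (3 ℕ.+ n) ℤ.+ (tail (V f) ⊗ g) (2 ℕ.+ n)
        ≡⟨ cong (ℤ._+_ (f 0 ℤ.* g (3 ℕ.+ n))) (trans (⊗-at-suc (tail (V f)) g (1 ℕ.+ n)) (ℤ.+-identityˡ _)) ⟩
      f 0 ℤ.* g (3 ℕ.+ n) ℤ.+ (tail (tail (V f)) ⊗ g) (1 ℕ.+ n)
        ≡⟨ cong (ℤ._+_ (f 0 ℤ.* g (3 ℕ.+ n))) (trans (⊗-at-suc (tail (tail (V f))) g n) (ℤ.+-identityˡ _)) ⟩
      f 0 ℤ.* g (3 ℕ.+ n) ℤ.+ (V (tail f) ⊗ g) n ∎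
      where open ≡-Reasoning

  V-cong : ∀ {f g} → f ≈ g → V f ≈ V g
  V-cong p = mk λ n → V-local n λ i _ → at p i

  V-cong[] : ∀ {M f g} → f ≈[ M ] g → V f ≈[ M ] V g
  V-cong[] p = mk λ n n<M → V-local n λ i i≤n → below p i (ℕ.≤-<-trans i≤n n<M)

  V-⊕ : ∀ f g → V (f ⊕ g) ≈ V f ⊕ V g
  V-⊕ f g = mk (go f g)
    where
    go : ∀ f g n → V (f ⊕ g) n ≡ (V f ⊕ V g) n
    go f g zero = trans (⊕-at f g 0) (sym (⊕-at (V f) (V g) 0))
    go f g 1 = sym (⊕-at (V f) (V g) 1)
    go f g 2 = sym (⊕-at (V f) (V g) 2)
    go f g (suc (suc (suc n))) = begin
      V (tail (f ⊕ g)) n        ≡⟨ at (V-cong (mk λ i → trans (⊕-at f g (suc i)) (sym (⊕-at (tail f) (tail g) i)))) n ⟩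
      V (tail f ⊕ tail g) n     ≡⟨ go (tail f) (tail g) n ⟩
      (V (tail f) ⊕ V (tail g)) n ≡⟨ ⊕-at (V (tail f)) (V (tail g)) n ⟩
      V (tail f) n ℤ.+ V (tail g) n ≡⟨ ⊕-at (V f) (V g) (3 ℕ.+ n) ⟨
      (V f ⊕ V g) (3 ℕ.+ n)     ∎
      where open ≡-Reasoning

  V-⊗ : ∀ f g → V (f ⊗ g) ≈ V f ⊗ V g
  V-⊗ f g = mk (go f g)
    where
    go : ∀ f g n → V (f ⊗ g) n ≡ (V f ⊗ V g) n
    go f g zero = trans (⊗-at-0 f g) (sym (⊗-at-0 (V f) (V g)))
    go f g 1 = sym (begin
      (V f ⊗ V g) 1 ≡⟨ ⊗-at-suc (V f) (V g) 0 ⟩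
      f 0 ℤ.* 0ℤ ℤ.+ (tail (V f) ⊗ V g) 0 ≡⟨ cong₂ ℤ._+_ (ℤ.*-zeroʳ (f 0)) (⊗-at-0 (tail (V f)) (V g)) ⟩
      0ℤ ∎)
      where open ≡-Reasoning
    go f g 2 = sym (begin
      (V f ⊗ V g) 2 ≡⟨ ⊗-at-suc (V f) (V g) 1 ⟩
      f 0 ℤ.* 0ℤ ℤ.+ (tail (V f) ⊗ V g) 1 ≡⟨ cong₂ ℤ._+_ (ℤ.*-zeroʳ (f 0)) (⊗-at-suc (tail (V f)) (V g) 0) ⟩
      0ℤ ℤ.+ (0ℤ ℤ.+ (tail (tail (V f)) ⊗ V g) 0) ≡⟨ cong (λ z → 0ℤ ℤ.+ (0ℤ ℤ.+ z)) (⊗-at-0 (tail (tail (V f))) (V g)) ⟩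
      0ℤ ∎)
      where open ≡-Reasoning
    go f g (suc (suc (suc n))) = begin
      V (tail (f ⊗ g)) n ≡⟨ at (V-cong (mk λ i → trans (⊗-at-suc f g i)
        (sym (trans (⊕-at (ι (f 0) ⊗ tail g) (tail f ⊗ g) i) (cong (ℤ._+ (tail f ⊗ g) i) (ι⊗-at (f 0) (tail g) i)))))) n ⟩
      V (ι (f 0) ⊗ tail g ⊕ tail f ⊗ g) n ≡⟨ at (V-⊕ (ι (f 0) ⊗ tail g) (tail f ⊗ g)) n ⟩
      (V (ι (f 0) ⊗ tail g) ⊕ V (tail f ⊗ g)) n ≡⟨ ⊕-at _ _ n ⟩
      V (ι (f 0) ⊗ tail g) n ℤ.+ V (tail f ⊗ g) n ≡⟨ cong₂ ℤ._+_ (V-scale (f 0) (tail g) n) (go (tail f) g n) ⟩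
      f 0 ℤ.* V (tail g) n ℤ.+ (V (tail f) ⊗ V g) n ≡⟨ V⊗-at-3+ f (V g) n ⟨
      (V f ⊗ V g) (3 ℕ.+ n) ∎
      where
      open ≡-Reasoning
      V-scale : ∀ c f n → V (ι c ⊗ f) n ≡ c ℤ.* V f n
      V-scale c f zero = ι⊗-at c f 0
      V-scale c f 1 = sym (ℤ.*-zeroʳ c)
      V-scale c f 2 = sym (ℤ.*-zeroʳ c)
      V-scale c f (suc (suc (suc n))) = trans
        (at (V-cong (mk λ i → trans (ι⊗-at c f (suc i)) (sym (ι⊗-at c (tail f) i)))) n)
        (V-scale c (tail f) n)

  V-ι : ∀ c → V (ι c) ≈ ι c
  V-ι c = mk λ { 0 → refl ; 1 → sym (ι-at-suc c 0) ; 2 → sym (ι-at-suc c 1) ; (suc (suc (suc n))) →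
      trans (at (V-cong {g = 𝟘} (mk λ i → trans (ι-at-suc c i) (sym (𝟘-at i)))) n) (trans (V𝟘 n) (sym (ι-at-suc c (2 ℕ.+ n)))) }
    where
    V𝟘 : ∀ n → V 𝟘 n ≡ 0ℤ
    V𝟘 0 = 𝟘-at 0
    V𝟘 1 = refl
    V𝟘 2 = refl
    V𝟘 (suc (suc (suc n))) = trans (at (V-cong {tail 𝟘} {𝟘} (mk λ i → trans (𝟘-at (suc i)) (sym (𝟘-at i)))) n) (V𝟘 n)

  V-𝟘 : V 𝟘 ≈ 𝟘
  V-𝟘 = ≈-trans (V-cong (≈-sym ι-0)) (≈-trans (V-ι 0ℤ) ι-0)

  V-𝟙 : V 𝟙 ≈ 𝟙
  V-𝟙 = ≈-trans (V-cong (≈-sym ι-1)) (≈-trans (V-ι 1ℤ) ι-1)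

  V-X : V X ≈ X ⊗ X ⊗ X
  V-X = ≈-trans (mk λ
    { 0 → sym (X⊗-at-0 _)
    ; 1 → sym (trans (X⊗-at-suc (X ⊗ X) 0) (X⊗-at-0 X))
    ; 2 → sym (trans (X⊗-at-suc (X ⊗ X) 1) (X⊗-at-suc X 0))
    ; (suc (suc (suc n))) → trans (trans (at (V-cong {tail X} {𝟙} (mk λ { zero → refl ; (suc n) → refl })) n) (at V-𝟙 n))
        (sym (trans (X⊗-at-suc (X ⊗ X) (2 ℕ.+ n)) (trans (X⊗-at-suc X (1 ℕ.+ n)) (tail-X n)))) })
    (CommutativeRing.sym series (CommutativeRing.*-assoc series X X X))
    where
    tail-X : ∀ n → X (1 ℕ.+ n) ≡ 𝟙 n
    tail-X zero    = refl
    tail-X (suc n) = refl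

  -- The projection formula: factors in q³ pass through the extraction. It makes `U₀` linear over
  -- ℤ[Z], with Z acting on the argument as ζ = `V Z`.
  U₀-V⊗ : ∀ f g → U₀ (V f ⊗ g) ≈ f ⊗ U₀ g
  U₀-V⊗ f g = mk (go f g)
    where
    go : ∀ f g n → (V f ⊗ g) (n ℕ.* 3) ≡ (f ⊗ U₀ g) n
    go f g zero = trans (⊗-at-0 (V f) g) (sym (⊗-at-0 f (U₀ g)))
    go f g (suc n) = begin
      (V f ⊗ g) (3 ℕ.+ n ℕ.* 3)                               ≡⟨ V⊗-at-3+ f g (n ℕ.* 3) ⟩
      f 0 ℤ.* g (3 ℕ.+ n ℕ.* 3) ℤ.+ (V (tail f) ⊗ g) (n ℕ.* 3) ≡⟨ cong (ℤ._+_ (f 0 ℤ.* g (3 ℕ.+ n ℕ.* 3))) (go (tail f) g n) ⟩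
      f 0 ℤ.* g (3 ℕ.+ n ℕ.* 3) ℤ.+ (tail f ⊗ U₀ g) n         ≡⟨ ⊗-at-suc f (U₀ g) n ⟨
      (f ⊗ U₀ g) (suc n)                                      ∎
      where open ≡-Reasoning

V-neg : ∀ f → V (neg f) ≈ neg (V f)
V-neg f = modulo
  (solve 3 (λ v w z → w := (:- v) :+ ((w :+ v :- z) :+ z)) ≈-refl (V f) (V (neg f)) (V 𝟘))
  (vanish (≈-trans (≈-sym (V-⊕ (neg f) f)) (V-cong (CommutativeRing.-‿inverseˡ series f))) ∔ V-𝟘)

U₀-cong : ∀ {f g} → f ≈ g → U₀ f ≈ U₀ g
U₀-cong p = mk λ n → at p (n ℕ.* 3)

U₀-cong[] : ∀ {M f g} → f ≈[ M ℕ.* 3 ] g → U₀ f ≈[ M ] U₀ g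
U₀-cong[] p = mk λ n n<M → below p (n ℕ.* 3) (ℕ.*-monoˡ-< 3 n<M)

U₀-⊕ : ∀ f g → U₀ (f ⊕ g) ≈ U₀ f ⊕ U₀ g
U₀-⊕ f g = mk λ n → trans (⊕-at f g (n ℕ.* 3)) (sym (⊕-at (U₀ f) (U₀ g) n))

U₀-V : ∀ f → U₀ (V f) ≈ f
U₀-V f = mk (V-at₀ f)

module ≈-Reasoning = SetoidReasoning (CommutativeRing.setoid series)
module ≈[]-Reasoning M = SetoidReasoning (≈[]-setoid M)

⊟-cong : ∀ {f f′ g g′} → f ≈ f′ → g ≈ g′ → f ⊟ g ≈ f′ ⊟ g′
⊟-cong p q = ⊕-cong p (neg-cong q)

-- Powers and q-products

↑-suc : ∀ q n → q ↑ suc n ≈ q ⊗ q ↑ n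
↑-suc q n = ⊗-def q (q ↑ n)

↑-cong : ∀ {q q′} → q ≈ q′ → ∀ n → q ↑ n ≈ q′ ↑ n
↑-cong         p zero    = ≈-refl
↑-cong {q} {q′} p (suc n) = ≈-trans (↑-suc q n) (≈-trans (⊗-cong p (↑-cong p n)) (≈-sym (↑-suc q′ n)))

↑-⊗ : ∀ f g n → (f ⊗ g) ↑ n ≈ f ↑ n ⊗ g ↑ n
↑-⊗ f g zero    = solve 0 (one := one :* one) ≈-refl
↑-⊗ f g (suc n) = begin
  (f ⊗ g) ↑ suc n           ≈⟨ ↑-suc (f ⊗ g) n ⟩
  f ⊗ g ⊗ (f ⊗ g) ↑ n       ≈⟨ ⊗-cong ≈-refl (↑-⊗ f g n) ⟩
  f ⊗ g ⊗ (f ↑ n ⊗ g ↑ n)   ≈⟨ solve 4 (λ f g a b → f :* g :* (a :* b) := f :* a :* (g :* b)) ≈-refl f g (f ↑ n) (g ↑ n) ⟩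
  f ⊗ f ↑ n ⊗ (g ⊗ g ↑ n)   ≈⟨ ⊗-cong (↑-suc f n) (↑-suc g n) ⟨
  f ↑ suc n ⊗ g ↑ suc n     ∎
  where open ≈-Reasoning

↑-double : ∀ q n → q ↑ (n ℕ.* 2) ≈ (q ⊗ q) ↑ n
↑-double q zero    = ≈-refl
↑-double q (suc n) = begin
  q ↑ (2 ℕ.+ n ℕ.* 2)       ≈⟨ ↑-suc q (1 ℕ.+ n ℕ.* 2) ⟩
  q ⊗ q ↑ (1 ℕ.+ n ℕ.* 2)   ≈⟨ ⊗-cong ≈-refl (↑-suc q (n ℕ.* 2)) ⟩
  q ⊗ (q ⊗ q ↑ (n ℕ.* 2))   ≈⟨ ⊗-cong ≈-refl (⊗-cong ≈-refl (↑-double q n)) ⟩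
  q ⊗ (q ⊗ (q ⊗ q) ↑ n)     ≈⟨ solve 2 (λ q a → q :* (q :* a) := q :* q :* a) ≈-refl q ((q ⊗ q) ↑ n) ⟩
  q ⊗ q ⊗ (q ⊗ q) ↑ n       ≈⟨ ↑-suc (q ⊗ q) n ⟨
  (q ⊗ q) ↑ suc n           ∎
  where open ≈-Reasoning

↑-triple : ∀ q n → q ↑ (n ℕ.* 3) ≈ (q ⊗ q ⊗ q) ↑ n
↑-triple q zero    = ≈-refl
↑-triple q (suc n) = begin
  q ↑ (3 ℕ.+ n ℕ.* 3)           ≈⟨ ≈-trans (↑-suc q (2 ℕ.+ n ℕ.* 3)) (⊗-cong ≈-refl (≈-trans (↑-suc q (1 ℕ.+ n ℕ.* 3)) (⊗-cong ≈-refl (↑-suc q (n ℕ.* 3))))) ⟩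
  q ⊗ (q ⊗ (q ⊗ q ↑ (n ℕ.* 3))) ≈⟨ ⊗-cong ≈-refl (⊗-cong ≈-refl (⊗-cong ≈-refl (↑-triple q n))) ⟩
  q ⊗ (q ⊗ (q ⊗ (q ⊗ q ⊗ q) ↑ n)) ≈⟨ solve 2 (λ q a → q :* (q :* (q :* a)) := q :* q :* q :* a) ≈-refl q ((q ⊗ q ⊗ q) ↑ n) ⟩
  q ⊗ q ⊗ q ⊗ (q ⊗ q ⊗ q) ↑ n   ≈⟨ ↑-suc (q ⊗ q ⊗ q) n ⟨
  (q ⊗ q ⊗ q) ↑ suc n           ∎
  where open ≈-Reasoning

V-↑ : ∀ q n → V (q ↑ n) ≈ V q ↑ n
V-↑ q zero    = V-𝟙
V-↑ q (suc n) = ≈-trans (V-cong (↑-suc q n)) (≈-trans (V-⊗ q (q ↑ n)) (≈-trans (⊗-cong ≈-refl (V-↑ q n)) (≈-sym (↑-suc (V q) n))))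

fin : Series → Series → ℕ → Series
fin a q zero    = 𝟙
fin a q (suc N) = (𝟙 ⊟ a ⊗ q ↑ N) ⊗ fin a q N

fin-def : ∀ a q N → ∏< N (factor a q) ≈ fin a q N
fin-def a q zero    = ≈-refl
fin-def a q (suc N) = ≈-trans (⊗-def _ _) (⊗-cong
  (≈-trans (⊖-def 𝟙 (a ⊛ q ↑ N)) (⊟-cong ≈-refl (⊗-def a (q ↑ N)))) (fin-def a q N))

fin-cong : ∀ {a a′ q q′} → a ≈ a′ → q ≈ q′ → ∀ N → fin a q N ≈ fin a′ q′ N
fin-cong p r zero    = ≈-refl
fin-cong p r (suc N) = ⊗-cong (⊟-cong ≈-refl (⊗-cong p (↑-cong r N))) (fin-cong p r N)

-- The length L is free above M, so the two sides of an identity of infinite products can be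
-- truncated at different lengths, such as 2N and N, at which they agree exactly.
⟨⟩∞≈fin : ∀ {M L} a {q} → q 0 ≡ 0ℤ → M ≤ L → ⟨ a ⨾ q ⟩∞ ≈[ M ] fin a q L
⟨⟩∞≈fin {M} {L} a {q} q₀≡0 M≤L = mk λ n n<M → begin
  ⟨ a ⨾ q ⟩∞ n                             ≡⟨ ⟨⟩∞-limit a q q₀≡0 n (L ℕ.∸ suc n) ⟨
  ∏< (L ℕ.∸ suc n ℕ.+ suc n) (factor a q) n ≡⟨ cong (λ k → ∏< k (factor a q) n) (ℕ.m∸n+n≡m (ℕ.≤-trans n<M M≤L)) ⟩
  ∏< L (factor a q) n                      ≡⟨ at (fin-def a q L) n ⟩
  fin a q L n                              ∎
  where open ≡-Reasoning

⟨⟩∞-at-0 : ∀ a q → a 0 ≡ 0ℤ → ⟨ a ⨾ q ⟩∞ 0 ≡ 1ℤ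
⟨⟩∞-at-0 a q a₀≡0 rewrite a₀≡0 = refl

⟨⟩∞-cong : ∀ {a a′ q q′} → q 0 ≡ 0ℤ → a ≈ a′ → q ≈ q′ → ⟨ a ⨾ q ⟩∞ ≈ ⟨ a′ ⨾ q′ ⟩∞
⟨⟩∞-cong q₀≡0 p r = ≈[]⇒≈ λ M → ≈[]-trans (⟨⟩∞≈fin _ q₀≡0 ℕ.≤-refl)
  (≈[]-trans (≈⇒≈[] (fin-cong p r M)) (≈[]-sym (⟨⟩∞≈fin _ (trans (sym (at r 0)) q₀≡0) ℕ.≤-refl)))

⊗-at-0-zero : ∀ {f} g → f 0 ≡ 0ℤ → (f ⊗ g) 0 ≡ 0ℤ
⊗-at-0-zero {f} g f₀≡0 = trans (⊗-at-0 f g) (cong (ℤ._* g 0) f₀≡0)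

V-at-0 : ∀ f → V f 0 ≡ f 0
V-at-0 f = V-at₀ f 0

⟨⟩∞-split₂ : ∀ a q → q 0 ≡ 0ℤ → ⟨ a ⨾ q ⟩∞ ≈ ⟨ a ⨾ q ⊗ q ⟩∞ ⊗ ⟨ a ⊗ q ⨾ q ⊗ q ⟩∞
⟨⟩∞-split₂ a q q₀≡0 = ≈[]⇒≈ λ M → ≈[]-trans (⟨⟩∞≈fin a q₀≡0 (ℕ.m≤m*n M 2))
  (≈[]-trans (≈⇒≈[] (finite M)) (≈[]-sym (⊗-cong[]
    (⟨⟩∞≈fin a (⊗-at-0-zero q q₀≡0) ℕ.≤-refl) (⟨⟩∞≈fin (a ⊗ q) (⊗-at-0-zero q q₀≡0) ℕ.≤-refl))))
  where
  finite : ∀ N → fin a q (N ℕ.* 2) ≈ fin a (q ⊗ q) N ⊗ fin (a ⊗ q) (q ⊗ q) N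
  finite zero    = solve 0 (one := one :* one) ≈-refl
  finite (suc N) = begin
    (𝟙 ⊟ a ⊗ q ↑ (1 ℕ.+ N ℕ.* 2)) ⊗ ((𝟙 ⊟ a ⊗ q ↑ (N ℕ.* 2)) ⊗ fin a q (N ℕ.* 2))
      ≈⟨ ⊗-cong (⊟-cong ≈-refl (⊗-cong ≈-refl (≈-trans (↑-suc q (N ℕ.* 2)) (⊗-cong ≈-refl (↑-double q N)))))
          (⊗-cong (⊟-cong ≈-refl (⊗-cong ≈-refl (↑-double q N))) (finite N)) ⟩
    (𝟙 ⊟ a ⊗ (q ⊗ p)) ⊗ ((𝟙 ⊟ a ⊗ p) ⊗ (fin a (q ⊗ q) N ⊗ fin (a ⊗ q) (q ⊗ q) N))
      ≈⟨ solve 5 (λ a q p f g → (one :- a :* (q :* p)) :* ((one :- a :* p) :* (f :* g))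
           := (one :- a :* p) :* f :* ((one :- a :* q :* p) :* g)) ≈-refl
           a q p (fin a (q ⊗ q) N) (fin (a ⊗ q) (q ⊗ q) N) ⟩
    (𝟙 ⊟ a ⊗ p) ⊗ fin a (q ⊗ q) N ⊗ ((𝟙 ⊟ a ⊗ q ⊗ p) ⊗ fin (a ⊗ q) (q ⊗ q) N) ∎
    where
    open ≈-Reasoning
    p = (q ⊗ q) ↑ N

⟨⟩∞-split₃ : ∀ a q → q 0 ≡ 0ℤ →
  ⟨ a ⨾ q ⟩∞ ≈ ⟨ a ⨾ q ⊗ q ⊗ q ⟩∞ ⊗ ⟨ a ⊗ q ⨾ q ⊗ q ⊗ q ⟩∞ ⊗ ⟨ a ⊗ q ⊗ q ⨾ q ⊗ q ⊗ q ⟩∞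
⟨⟩∞-split₃ a q q₀≡0 = ≈[]⇒≈ λ M → ≈[]-trans (⟨⟩∞≈fin a q₀≡0 (ℕ.m≤m*n M 3))
  (≈[]-trans (≈⇒≈[] (finite M)) (≈[]-sym (⊗-cong[] (⊗-cong[]
    (⟨⟩∞≈fin a r₀≡0 ℕ.≤-refl) (⟨⟩∞≈fin (a ⊗ q) r₀≡0 ℕ.≤-refl)) (⟨⟩∞≈fin (a ⊗ q ⊗ q) r₀≡0 ℕ.≤-refl))))
  where
  r = q ⊗ q ⊗ q
  r₀≡0 : r 0 ≡ 0ℤ
  r₀≡0 = ⊗-at-0-zero q (⊗-at-0-zero q q₀≡0)
  finite : ∀ N → fin a q (N ℕ.* 3) ≈ fin a r N ⊗ fin (a ⊗ q) r N ⊗ fin (a ⊗ q ⊗ q) r N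
  finite zero    = solve 0 (one := one :* one :* one) ≈-refl
  finite (suc N) = begin
    (𝟙 ⊟ a ⊗ q ↑ (2 ℕ.+ N ℕ.* 3)) ⊗ ((𝟙 ⊟ a ⊗ q ↑ (1 ℕ.+ N ℕ.* 3)) ⊗ ((𝟙 ⊟ a ⊗ q ↑ (N ℕ.* 3)) ⊗ fin a q (N ℕ.* 3)))
      ≈⟨ ⊗-cong (factor-cong (≈-trans (↑-suc q (1 ℕ.+ N ℕ.* 3)) (⊗-cong ≈-refl q^1+3N)))
          (⊗-cong (factor-cong q^1+3N) (⊗-cong (factor-cong (↑-triple q N)) (finite N))) ⟩
    (𝟙 ⊟ a ⊗ (q ⊗ (q ⊗ p))) ⊗ ((𝟙 ⊟ a ⊗ (q ⊗ p)) ⊗ ((𝟙 ⊟ a ⊗ p) ⊗ (fin a r N ⊗ fin (a ⊗ q) r N ⊗ fin (a ⊗ q ⊗ q) r N)))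
      ≈⟨ solve 6 (λ a q p f g h → (one :- a :* (q :* (q :* p))) :* ((one :- a :* (q :* p)) :* ((one :- a :* p) :* (f :* g :* h)))
           := (one :- a :* p) :* f :* ((one :- a :* q :* p) :* g) :* ((one :- a :* q :* q :* p) :* h)) ≈-refl
           a q p (fin a r N) (fin (a ⊗ q) r N) (fin (a ⊗ q ⊗ q) r N) ⟩
    (𝟙 ⊟ a ⊗ p) ⊗ fin a r N ⊗ ((𝟙 ⊟ a ⊗ q ⊗ p) ⊗ fin (a ⊗ q) r N) ⊗ ((𝟙 ⊟ a ⊗ q ⊗ q ⊗ p) ⊗ fin (a ⊗ q ⊗ q) r N) ∎
    where
    open ≈-Reasoning
    p = r ↑ N
    q^1+3N : q ↑ (1 ℕ.+ N ℕ.* 3) ≈ q ⊗ p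
    q^1+3N = ≈-trans (↑-suc q (N ℕ.* 3)) (⊗-cong ≈-refl (↑-triple q N))
    factor-cong : ∀ {f g} → f ≈ g → 𝟙 ⊟ a ⊗ f ≈ 𝟙 ⊟ a ⊗ g
    factor-cong e = ⊟-cong ≈-refl (⊗-cong ≈-refl e)

⟨⟩∞-shift : ∀ a q → q 0 ≡ 0ℤ → ⟨ a ⨾ q ⟩∞ ≈ (𝟙 ⊟ a) ⊗ ⟨ a ⊗ q ⨾ q ⟩∞
⟨⟩∞-shift a q q₀≡0 = ≈[]⇒≈ λ M → ≈[]-trans (⟨⟩∞≈fin a q₀≡0 (ℕ.n≤1+n M))
  (≈[]-trans (≈⇒≈[] (finite M)) (≈[]-sym (⊗-cong[] ≈[]-refl (⟨⟩∞≈fin (a ⊗ q) q₀≡0 ℕ.≤-refl))))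
  where
  finite : ∀ N → fin a q (suc N) ≈ (𝟙 ⊟ a) ⊗ fin (a ⊗ q) q N
  finite zero    = solve 1 (λ a → (one :- a :* one) :* one := (one :- a) :* one) ≈-refl a
  finite (suc N) = begin
    (𝟙 ⊟ a ⊗ q ↑ suc N) ⊗ fin a q (suc N)
      ≈⟨ ⊗-cong (⊟-cong ≈-refl (⊗-cong ≈-refl (↑-suc q N))) (finite N) ⟩
    (𝟙 ⊟ a ⊗ (q ⊗ q ↑ N)) ⊗ ((𝟙 ⊟ a) ⊗ fin (a ⊗ q) q N)
      ≈⟨ solve 4 (λ a q p f → (one :- a :* (q :* p)) :* ((one :- a) :* f) := (one :- a) :* ((one :- a :* q :* p) :* f))
           ≈-refl a q (q ↑ N) (fin (a ⊗ q) q N) ⟩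
    (𝟙 ⊟ a) ⊗ ((𝟙 ⊟ a ⊗ q ⊗ q ↑ N) ⊗ fin (a ⊗ q) q N) ∎
    where open ≈-Reasoning

⟨⟩∞-square : ∀ a q → q 0 ≡ 0ℤ → ⟨ a ⨾ q ⟩∞ ⊗ ⟨ neg a ⨾ q ⟩∞ ≈ ⟨ a ⊗ a ⨾ q ⊗ q ⟩∞
⟨⟩∞-square a q q₀≡0 = ≈[]⇒≈ λ M → ≈[]-trans
  (⊗-cong[] (⟨⟩∞≈fin a q₀≡0 ℕ.≤-refl) (⟨⟩∞≈fin (neg a) q₀≡0 ℕ.≤-refl))
  (≈[]-trans (≈⇒≈[] (finite M)) (≈[]-sym (⟨⟩∞≈fin (a ⊗ a) (⊗-at-0-zero q q₀≡0) ℕ.≤-refl)))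
  where
  finite : ∀ N → fin a q N ⊗ fin (neg a) q N ≈ fin (a ⊗ a) (q ⊗ q) N
  finite zero    = solve 0 (one :* one := one) ≈-refl
  finite (suc N) = begin
    (𝟙 ⊟ a ⊗ q ↑ N) ⊗ fin a q N ⊗ ((𝟙 ⊟ neg a ⊗ q ↑ N) ⊗ fin (neg a) q N)
      ≈⟨ solve 4 (λ a p f g → (one :- a :* p) :* f :* ((one :- (:- a) :* p) :* g) := (one :- a :* a :* (p :* p)) :* (f :* g))
           ≈-refl a (q ↑ N) (fin a q N) (fin (neg a) q N) ⟩
    (𝟙 ⊟ a ⊗ a ⊗ (q ↑ N ⊗ q ↑ N)) ⊗ (fin a q N ⊗ fin (neg a) q N)
      ≈⟨ ⊗-cong (⊟-cong ≈-refl (⊗-cong ≈-refl (≈-sym (↑-⊗ q q N)))) (finite N) ⟩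
    (𝟙 ⊟ a ⊗ a ⊗ (q ⊗ q) ↑ N) ⊗ fin (a ⊗ a) (q ⊗ q) N ∎
    where open ≈-Reasoning

V-⟨⟩∞ : ∀ a q → q 0 ≡ 0ℤ → V ⟨ a ⨾ q ⟩∞ ≈ ⟨ V a ⨾ V q ⟩∞
V-⟨⟩∞ a q q₀≡0 = ≈[]⇒≈ λ M → ≈[]-trans (V-cong[] (⟨⟩∞≈fin a q₀≡0 ℕ.≤-refl))
  (≈[]-trans (≈⇒≈[] (finite M)) (≈[]-sym (⟨⟩∞≈fin (V a) (trans (V-at-0 q) q₀≡0) ℕ.≤-refl)))
  where
  finite : ∀ N → V (fin a q N) ≈ fin (V a) (V q) N
  finite zero    = V-𝟙
  finite (suc N) = ≈-trans (V-⊗ _ _) (⊗-cong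
    (≈-trans (V-⊕ _ _) (⊕-cong V-𝟙 (≈-trans (V-neg _) (neg-cong (≈-trans (V-⊗ _ _) (⊗-cong ≈-refl (V-↑ q N)))))))
    (finite N))

-- The cubic norm

cube : Series → Series
cube f = f ⊗ f ⊗ f

-- V (norm a b c) is the product of f = V a ⊕ q V b ⊕ q² V c with its conjugates
-- under q ↦ ωq, ω³ = 1.
norm : Series → Series → Series → Series
norm a b c = a ⊗ a ⊗ a ⊕ X ⊗ (b ⊗ b ⊗ b) ⊕ X ⊗ X ⊗ (c ⊗ c ⊗ c) ⊟ ι (+ 3) ⊗ X ⊗ a ⊗ b ⊗ c

norm-cong : ∀ {a a′ b b′ c c′} → a ≈ a′ → b ≈ b′ → c ≈ c′ → norm a b c ≈ norm a′ b′ c′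
norm-cong p q r = ⊕-cong (⊕-cong (⊕-cong (⊗-cong (⊗-cong p p) p) (⊗-cong ≈-refl (⊗-cong (⊗-cong q q) q)))
  (⊗-cong ≈-refl (⊗-cong (⊗-cong r r) r))) (neg-cong (⊗-cong (⊗-cong (⊗-cong ≈-refl p) q) r))

norm-cong[] : ∀ {M a a′ b b′ c c′} → a ≈[ M ] a′ → b ≈[ M ] b′ → c ≈[ M ] c′ → norm a b c ≈[ M ] norm a′ b′ c′
norm-cong[] p q r = ⊕-cong[] (⊕-cong[] (⊕-cong[] (⊗-cong[] (⊗-cong[] p p) p) (⊗-cong[] ≈[]-refl (⊗-cong[] (⊗-cong[] q q) q)))
  (⊗-cong[] ≈[]-refl (⊗-cong[] (⊗-cong[] r r) r))) (neg-cong[] (⊗-cong[] (⊗-cong[] (⊗-cong[] ≈[]-refl p) q) r))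

N : Series → Series
N f = norm (U₀ f) (U₁ f) (U₂ f)

assemble : Series → Series → Series → Series
assemble a b c = V a ⊕ X ⊗ V b ⊕ X ⊗ X ⊗ V c

private
  assemble-at : ∀ a b c n → assemble a b c n ≡ V a n ℤ.+ (X ⊗ V b) n ℤ.+ (X ⊗ (X ⊗ V c)) n
  assemble-at a b c n = trans (⊕-at _ _ n) (cong₂ ℤ._+_ (⊕-at _ _ n) (at (CommutativeRing.*-assoc series X X (V c)) n))

assemble-at₀ : ∀ a b c → U₀ (assemble a b c) ≈ a
assemble-at₀ a b c = mk λ n → trans (assemble-at a b c (n ℕ.* 3)) (trans
  (cong₂ ℤ._+_ (cong₂ ℤ._+_ (V-at₀ a n) (one-off n)) (two-off n))
  (trans (ℤ.+-identityʳ _) (ℤ.+-identityʳ _)))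
  where
  one-off : ∀ n → (X ⊗ V b) (n ℕ.* 3) ≡ 0ℤ
  one-off zero    = X⊗-at-0 _
  one-off (suc n) = trans (X⊗-at-suc _ _) (V-at₂ b n)
  two-off : ∀ n → (X ⊗ (X ⊗ V c)) (n ℕ.* 3) ≡ 0ℤ
  two-off zero    = X⊗-at-0 _
  two-off (suc n) = trans (X⊗-at-suc _ _) (trans (X⊗-at-suc _ _) (V-at₁ c n))

assemble-at₁ : ∀ a b c → U₁ (assemble a b c) ≈ b
assemble-at₁ a b c = mk λ n → trans (assemble-at a b c (1 ℕ.+ n ℕ.* 3)) (trans
  (cong₂ ℤ._+_ (cong₂ ℤ._+_ (V-at₁ a n) (trans (X⊗-at-suc _ _) (V-at₀ b n))) (trans (X⊗-at-suc _ _) (off n)))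
  (trans (ℤ.+-identityʳ _) (ℤ.+-identityˡ _)))
  where
  off : ∀ n → (X ⊗ V c) (n ℕ.* 3) ≡ 0ℤ
  off zero    = X⊗-at-0 _
  off (suc n) = trans (X⊗-at-suc _ _) (V-at₂ c n)

assemble-at₂ : ∀ a b c → U₂ (assemble a b c) ≈ c
assemble-at₂ a b c = mk λ n → trans (assemble-at a b c (2 ℕ.+ n ℕ.* 3)) (trans
  (cong₂ ℤ._+_ (cong₂ ℤ._+_ (V-at₂ a n) (trans (X⊗-at-suc _ _) (V-at₁ b n)))
    (trans (X⊗-at-suc _ _) (trans (X⊗-at-suc _ _) (V-at₀ c n))))
  (ℤ.+-identityˡ _))

private
  residues : ∀ {ℓ} {P : ℕ → Set ℓ} → (∀ n → P (n ℕ.* 3)) → (∀ n → P (1 ℕ.+ n ℕ.* 3)) → (∀ n → P (2 ℕ.+ n ℕ.* 3)) → ∀ n → P n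
  residues p q r 0 = p 0
  residues p q r 1 = q 0
  residues p q r 2 = r 0
  residues {P = P} p q r (suc (suc (suc n))) = residues {P = P ∘ (3 ℕ.+_)} (p ∘ suc) (q ∘ suc) (r ∘ suc) n

assemble-U : ∀ f → assemble (U₀ f) (U₁ f) (U₂ f) ≈ f
assemble-U f = mk (residues (at (assemble-at₀ (U₀ f) (U₁ f) (U₂ f))) (at (assemble-at₁ (U₀ f) (U₁ f) (U₂ f))) (at (assemble-at₂ (U₀ f) (U₁ f) (U₂ f))))

N-cong : ∀ {f g} → f ≈ g → N f ≈ N g
N-cong p = norm-cong (mk λ n → at p _) (mk λ n → at p _) (mk λ n → at p _)

N-cong[] : ∀ {M f g} → f ≈[ M ℕ.* 3 ] g → N f ≈[ M ] N g
N-cong[] {M} p = norm-cong[]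
  (mk λ n n<M → below p _ (ℕ.m+n≤o⇒n≤o 2 (ℕ.*-monoˡ-≤ 3 n<M)))
  (mk λ n n<M → below p _ (ℕ.m+n≤o⇒n≤o 1 (ℕ.*-monoˡ-≤ 3 n<M)))
  (mk λ n n<M → below p _ (ℕ.*-monoˡ-≤ 3 n<M))

N-assemble : ∀ {f} a b c → f ≈ assemble a b c → N f ≈ norm a b c
N-assemble a b c p = ≈-trans (N-cong p) (norm-cong (assemble-at₀ a b c) (assemble-at₁ a b c) (assemble-at₂ a b c))

-- ℤ[[q]] is free over ℤ[[q³]] with basis 1, q, q², and `N` is the norm of this extension. The
-- components of the product are read off with q³ = `V X`; once `V` is removed, a polynomial
-- identity in seven variables remains.
N-⊗ : ∀ f g → N (f ⊗ g) ≈ N f ⊗ N g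
N-⊗ f g = ≈-trans
  (N-assemble (a ⊗ d ⊕ X ⊗ (b ⊗ k ⊕ c ⊗ e)) (a ⊗ e ⊕ b ⊗ d ⊕ X ⊗ (c ⊗ k)) (a ⊗ k ⊕ b ⊗ e ⊕ c ⊗ d) (begin
    f ⊗ g ≈⟨ ⊗-cong (assemble-U f) (assemble-U g) ⟨
    assemble a b c ⊗ assemble d e k
      ≈⟨ solve 7 (λ x a b c d e k → (a :+ x :* b :+ x :* x :* c) :* (d :+ x :* e :+ x :* x :* k)
           := (a :* d :+ x :* x :* x :* (b :* k :+ c :* e)) :+ x :* (a :* e :+ b :* d :+ x :* x :* x :* (c :* k))
              :+ x :* x :* (a :* k :+ b :* e :+ c :* d)) ≈-refl X (V a) (V b) (V c) (V d) (V e) (V k) ⟩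
    (V a ⊗ V d ⊕ X ⊗ X ⊗ X ⊗ (V b ⊗ V k ⊕ V c ⊗ V e)) ⊕ X ⊗ (V a ⊗ V e ⊕ V b ⊗ V d ⊕ X ⊗ X ⊗ X ⊗ (V c ⊗ V k))
              ⊕ X ⊗ X ⊗ (V a ⊗ V k ⊕ V b ⊗ V e ⊕ V c ⊗ V d)
      ≈⟨ ⊕-cong (⊕-cong
           (plus (V-⊗ a d) (times V-X (plus (V-⊗ b k) (V-⊗ c e))))
           (⊗-cong ≈-refl (plus (plus (V-⊗ a e) (V-⊗ b d)) (times V-X (V-⊗ c k)))))
           (⊗-cong ≈-refl (plus (plus (V-⊗ a k) (V-⊗ b e)) (V-⊗ c d))) ⟨
    assemble (a ⊗ d ⊕ X ⊗ (b ⊗ k ⊕ c ⊗ e)) (a ⊗ e ⊕ b ⊗ d ⊕ X ⊗ (c ⊗ k)) (a ⊗ k ⊕ b ⊗ e ⊕ c ⊗ d) ∎))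
  (solve 7 (λ q a b c d e f →
     let nrm = λ a b c → a :* a :* a :+ q :* (b :* b :* b) :+ q :* q :* (c :* c :* c) :- # 3 :* q :* a :* b :* c in
     nrm (a :* d :+ q :* (b :* f :+ c :* e)) (a :* e :+ b :* d :+ q :* (c :* f)) (a :* f :+ b :* e :+ c :* d)
     := nrm a b c :* nrm d e f) ≈-refl X a b c d e k)
  where
  open ≈-Reasoning
  a = U₀ f
  b = U₁ f
  c = U₂ f
  d = U₀ g
  e = U₁ g
  k = U₂ g
  plus : ∀ {f g f′ g′} → V f ≈ f′ → V g ≈ g′ → V (f ⊕ g) ≈ f′ ⊕ g′
  plus p q = ≈-trans (V-⊕ _ _) (⊕-cong p q)
  times : ∀ {f g f′ g′} → V f ≈ f′ → V g ≈ g′ → V (f ⊗ g) ≈ f′ ⊗ g′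
  times p q = ≈-trans (V-⊗ _ _) (⊗-cong p q)

N-V : ∀ f → N (V f) ≈ cube f
N-V f = ≈-trans (N-assemble f 𝟘 𝟘 (≈-sym (≈-trans (⊕-cong (⊕-cong ≈-refl (X ∙ V-𝟘)) (X ⊗ X ∙ V-𝟘))
    (modulo (solve 2 (λ f z → f :+ z :+ z := f :+ (z :+ z)) ≈-refl (V f) 𝟘) (≈-refl ∔ ≈-refl)))))
  (modulo (solve 3 (λ x a z → a :* a :* a :+ x :* (z :* z :* z) :+ x :* x :* (z :* z :* z) :- # 3 :* x :* a :* z :* z
      := a :* a :* a :+ (x :* (z :* z) :+ x :* x :* (z :* z) :- # 3 :* x :* a :* z) :* z) ≈-refl X f 𝟘)
    (_ ∙ ≈-refl))

N-𝟙 : N 𝟙 ≈ 𝟙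
N-𝟙 = ≈-trans (N-cong (≈-sym V-𝟙)) (≈-trans (N-V 𝟙) (solve 0 (one :* one :* one := one) ≈-refl))

N-factor₁ : ∀ g → N (𝟙 ⊟ X ⊗ V g) ≈ 𝟙 ⊟ X ⊗ cube g
N-factor₁ g = ≈-trans
  (N-assemble 𝟙 (neg g) 𝟘 (≈-sym (≈-trans (⊕-cong (⊕-cong V-𝟙 (⊗-cong ≈-refl (V-neg g))) (X ⊗ X ∙ V-𝟘))
    (modulo (solve 3 (λ x g z → one :+ x :* (:- g) :+ z := (one :- x :* g) :+ z) ≈-refl X (V g) 𝟘) ≈-refl))))
  (modulo (solve 3 (λ x g z → one :* one :* one :+ x :* ((:- g) :* (:- g) :* (:- g)) :+ x :* x :* (z :* z :* z) :- # 3 :* x :* one :* (:- g) :* z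
      := (one :- x :* (g :* g :* g)) :+ (x :* x :* (z :* z) :+ # 3 :* x :* g) :* z) ≈-refl X g 𝟘)
    (_ ∙ ≈-refl))

N-factor₂ : ∀ g → N (𝟙 ⊟ X ⊗ X ⊗ V g) ≈ 𝟙 ⊟ X ⊗ X ⊗ cube g
N-factor₂ g = ≈-trans
  (N-assemble 𝟙 𝟘 (neg g) (≈-sym (≈-trans (⊕-cong (⊕-cong V-𝟙 (X ∙ V-𝟘)) (⊗-cong ≈-refl (V-neg g)))
    (modulo (solve 3 (λ x g z → one :+ z :+ x :* x :* (:- g) := (one :- x :* x :* g) :+ z) ≈-refl X (V g) 𝟘) ≈-refl))))
  (modulo (solve 3 (λ x g z → one :* one :* one :+ x :* (z :* z :* z) :+ x :* x :* ((:- g) :* (:- g) :* (:- g)) :- # 3 :* x :* one :* z :* (:- g)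
      := (one :- x :* x :* (g :* g :* g)) :+ (x :* (z :* z) :+ # 3 :* x :* g) :* z) ≈-refl X g 𝟘)
    (_ ∙ ≈-refl))

module _ (r : Series) (N-factor : ∀ g → N (𝟙 ⊟ r ⊗ V g) ≈ 𝟙 ⊟ r ⊗ cube g) where

  -- Every factor of the product has the form `𝟙 ⊟ r ⊗ V h`, so the norm acts factor by factor. The
  -- instances are r = q and r = q².
  N-⟨⟩∞ : ∀ g q → q 0 ≡ 0ℤ → N ⟨ r ⊗ V g ⨾ V q ⟩∞ ≈ ⟨ r ⊗ cube g ⨾ cube q ⟩∞
  N-⟨⟩∞ g q q₀≡0 = ≈[]⇒≈ λ M → ≈[]-trans
    (N-cong[] (⟨⟩∞≈fin (r ⊗ V g) (trans (V-at-0 q) q₀≡0) ℕ.≤-refl))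
    (≈[]-trans (≈⇒≈[] (finite (M ℕ.* 3)))
      (≈[]-sym (⟨⟩∞≈fin (r ⊗ cube g) (⊗-at-0-zero q (⊗-at-0-zero q q₀≡0)) (ℕ.m≤m*n M 3))))
    where
    finite : ∀ n → N (fin (r ⊗ V g) (V q) n) ≈ fin (r ⊗ cube g) (cube q) n
    finite zero    = N-𝟙
    finite (suc n) = ≈-trans (N-⊗ _ _) (⊗-cong (begin
      N (𝟙 ⊟ r ⊗ V g ⊗ V q ↑ n)
        ≈⟨ N-cong (⊟-cong ≈-refl (≈-trans (CommutativeRing.*-assoc series r (V g) (V q ↑ n))
             (⊗-cong ≈-refl (≈-trans (⊗-cong ≈-refl (≈-sym (V-↑ q n))) (≈-sym (V-⊗ g (q ↑ n))))))) ⟩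
      N (𝟙 ⊟ r ⊗ V (g ⊗ q ↑ n))
        ≈⟨ N-factor (g ⊗ q ↑ n) ⟩
      𝟙 ⊟ r ⊗ cube (g ⊗ q ↑ n)
        ≈⟨ ⊟-cong ≈-refl (solve 3 (λ r g p → r :* (g :* p :* (g :* p) :* (g :* p)) := r :* (g :* g :* g) :* (p :* p :* p))
             ≈-refl r g (q ↑ n)) ⟩
      𝟙 ⊟ r ⊗ cube g ⊗ cube (q ↑ n)
        ≈⟨ ⊟-cong ≈-refl (⊗-cong ≈-refl (≈-sym (≈-trans (↑-⊗ (q ⊗ q) q n) (⊗-cong (↑-⊗ q q n) ≈-refl)))) ⟩
      𝟙 ⊟ r ⊗ cube g ⊗ cube q ↑ n ∎) (finite n))
      where open ≈-Reasoning

-- Norms of the products f₁ and f₂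

X₀≡0 : X 0 ≡ 0ℤ
X₀≡0 = refl

f₁ f₂ : Series
f₁ = ⟨ X ⨾ X ⟩∞
f₂ = ⟨ X ⊗ X ⨾ X ⊗ X ⟩∞

f₁-at-0 : f₁ 0 ≡ 1ℤ
f₁-at-0 = ⟨⟩∞-at-0 X X refl

f₂-at-0 : f₂ 0 ≡ 1ℤ
f₂-at-0 = ⟨⟩∞-at-0 (X ⊗ X) (X ⊗ X) (X⊗-at-0 X)

V-cube : ∀ f → V (cube f) ≈ cube (V f)
V-cube f = ≈-trans (V-⊗ _ _) (⊗-cong (V-⊗ _ _) ≈-refl)

private
  V-⟨q⨾q⟩∞ : ∀ q → q 0 ≡ 0ℤ → V q ≈ cube q → V ⟨ q ⨾ q ⟩∞ ≈ ⟨ cube q ⨾ cube q ⟩∞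
  V-⟨q⨾q⟩∞ q q₀≡0 Vq≈q³ = ≈-trans (V-⟨⟩∞ q q q₀≡0) (⟨⟩∞-cong (trans (V-at-0 q) q₀≡0) Vq≈q³ Vq≈q³)

  -- Sorting the factors of f = (q; q)_∞ by the exponent modulo 3 gives f = a b f(q³), where the
  -- norm fixes a and b and sends f(q³) to f³. This is the classical f(q) f(ωq) f(ω²q) = f(q³)⁴ /
  -- f(q⁹), written in q instead of q³.
  eta-norm : ∀ q → q 0 ≡ 0ℤ → V q ≈ cube q →
    N ⟨ q ⨾ cube q ⟩∞ ≈ ⟨ q ⨾ cube q ⟩∞ → N ⟨ q ⊗ q ⨾ cube q ⟩∞ ≈ ⟨ q ⊗ q ⨾ cube q ⟩∞ →
    N ⟨ q ⨾ q ⟩∞ ⊗ V ⟨ q ⨾ q ⟩∞ ≈ ⟨ q ⨾ q ⟩∞ ⊗ cube ⟨ q ⨾ q ⟩∞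
  eta-norm q q₀≡0 Vq≈q³ Na≈a Nb≈b = begin
    N f ⊗ V f                    ≈⟨ ⊗-cong (≈-trans (N-cong split) (≈-trans (N-⊗ _ _) (⊗-cong (≈-trans (N-⊗ _ _) (⊗-cong Na≈a Nb≈b)) (N-V f)))) ≈-refl ⟩
    a ⊗ b ⊗ cube f ⊗ V f         ≈⟨ solve 4 (λ a b c d → a :* b :* c :* d := a :* b :* d :* c) ≈-refl a b (cube f) (V f) ⟩
    a ⊗ b ⊗ V f ⊗ cube f         ≈⟨ ⊗-cong split ≈-refl ⟨
    f ⊗ cube f                   ∎
    where
    open ≈-Reasoning
    f = ⟨ q ⨾ q ⟩∞
    a = ⟨ q ⨾ cube q ⟩∞
    b = ⟨ q ⊗ q ⨾ cube q ⟩∞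
    split : f ≈ a ⊗ b ⊗ V f
    split = ≈-trans (⟨⟩∞-split₃ q q q₀≡0) (⊗-cong ≈-refl (≈-sym (V-⟨q⨾q⟩∞ q q₀≡0 Vq≈q³)))

  N-⟨⟩∞-fixed : ∀ r → (∀ g → N (𝟙 ⊟ r ⊗ V g) ≈ 𝟙 ⊟ r ⊗ cube g) → ∀ g q {a} → q 0 ≡ 0ℤ → V q ≈ cube q → V g ≈ cube g → r ⊗ V g ≈ a →
    N ⟨ a ⨾ cube q ⟩∞ ≈ ⟨ a ⨾ cube q ⟩∞
  N-⟨⟩∞-fixed r N-factor g q q₀≡0 Vq≈q³ Vg≈g³ rVg≈a = ≈-trans
    (N-cong (⟨⟩∞-cong (⊗-at-0-zero q (⊗-at-0-zero q q₀≡0)) (≈-sym rVg≈a) (≈-sym Vq≈q³)))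
    (≈-trans (N-⟨⟩∞ r N-factor g q q₀≡0)
      (⟨⟩∞-cong (⊗-at-0-zero q (⊗-at-0-zero q q₀≡0)) (≈-trans (⊗-cong ≈-refl (≈-sym Vg≈g³)) rVg≈a) ≈-refl))

  V𝟙≈𝟙³ : V 𝟙 ≈ cube 𝟙
  V𝟙≈𝟙³ = ≈-trans V-𝟙 (solve 0 (one := one :* one :* one) ≈-refl)

  VX²≈X⁶ : V (X ⊗ X) ≈ cube (X ⊗ X)
  VX²≈X⁶ = ≈-trans (V-⊗ X X) (≈-trans (⊗-cong V-X V-X)
    (solve 1 (λ x → x :* x :* x :* (x :* x :* x) := x :* x :* (x :* x) :* (x :* x)) ≈-refl X))

  ⊗V𝟙 : ∀ r → r ⊗ V 𝟙 ≈ r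
  ⊗V𝟙 r = ≈-trans (⊗-cong ≈-refl V-𝟙) (CommutativeRing.*-identityʳ series r)

N-f₁ : N f₁ ⊗ V f₁ ≈ f₁ ⊗ cube f₁
N-f₁ = eta-norm X refl V-X
  (N-⟨⟩∞-fixed X N-factor₁ 𝟙 X refl V-X V𝟙≈𝟙³ (⊗V𝟙 X))
  (N-⟨⟩∞-fixed (X ⊗ X) N-factor₂ 𝟙 X refl V-X V𝟙≈𝟙³ (⊗V𝟙 (X ⊗ X)))

N-f₂ : N f₂ ⊗ V f₂ ≈ f₂ ⊗ cube f₂
N-f₂ = eta-norm (X ⊗ X) (X⊗-at-0 X) VX²≈X⁶
  (N-⟨⟩∞-fixed (X ⊗ X) N-factor₂ 𝟙 (X ⊗ X) (X⊗-at-0 X) VX²≈X⁶ V𝟙≈𝟙³ (⊗V𝟙 (X ⊗ X)))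
  -- The exponent of q⁴ is 1 modulo 3, so q⁴ has to be written as `X ⊗ V X`; compared with `N-f₁`
  -- the two residues change roles.
  (N-⟨⟩∞-fixed X N-factor₁ X (X ⊗ X) (X⊗-at-0 X) VX²≈X⁶ V-X
    (≈-trans (⊗-cong ≈-refl V-X) (solve 1 (λ x → x :* (x :* x :* x) := x :* x :* (x :* x)) ≈-refl X)))

-- The Jacobi triple product

↑-+ : ∀ q m n → q ↑ (m ℕ.+ n) ≈ q ↑ m ⊗ q ↑ n
↑-+ q zero    n = ≈-sym (CommutativeRing.*-identityˡ series (q ↑ n))
↑-+ q (suc m) n = ≈-trans (↑-suc q (m ℕ.+ n)) (≈-trans (⊗-cong ≈-refl (↑-+ q m n))
  (≈-trans (≈-sym (CommutativeRing.*-assoc series q (q ↑ m) (q ↑ n))) (⊗-cong (≈-sym (↑-suc q m)) ≈-refl)))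

⊗-zeroʳ[] : ∀ {M} f {g} → g ≈[ M ] 𝟘 → f ⊗ g ≈[ M ] 𝟘
⊗-zeroʳ[] f p = ≈[]-trans (⊗-cong[] ≈[]-refl p) (≈⇒≈[] (CommutativeRing.zeroʳ series f))

⊗-vanish-suc : ∀ {f g n} → f 0 ≡ 0ℤ → g ≈[ n ] 𝟘 → f ⊗ g ≈[ suc n ] 𝟘
⊗-vanish-suc {f} {g} f₀≡0 g≈𝟘 = mk λ
  { zero    _           → trans (⊗-at-0-zero g f₀≡0) (sym (𝟘-at 0))
  ; (suc i) (s≤s i<n) → begin
      (f ⊗ g) (suc i)                         ≡⟨ ⊗-at-suc f g i ⟩
      f 0 ℤ.* g (suc i) ℤ.+ (tail f ⊗ g) i    ≡⟨ cong₂ ℤ._+_ (cong (ℤ._* g (suc i)) f₀≡0) (below (⊗-zeroʳ[] (tail f) g≈𝟘) i i<n) ⟩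
      0ℤ ℤ.+ 𝟘 i                              ≡⟨ ℤ.+-identityˡ _ ⟩
      𝟘 i                                     ≡⟨ trans (𝟘-at i) (sym (𝟘-at (suc i))) ⟩
      𝟘 (suc i)                               ∎ }
  where open ≡-Reasoning

↑-vanish : ∀ {q} → q 0 ≡ 0ℤ → ∀ n → q ↑ n ≈[ n ] 𝟘
↑-vanish     q₀≡0 zero    = mk λ _ ()
↑-vanish {q} q₀≡0 (suc n) = ≈[]-trans (≈⇒≈[] (↑-suc q n)) (⊗-vanish-suc q₀≡0 (↑-vanish q₀≡0 n))

fin-at-0 : ∀ a q N → a 0 ≡ 0ℤ → fin a q N 0 ≡ 1ℤ
fin-at-0 a q zero    a₀≡0 = refl
fin-at-0 a q (suc N) a₀≡0 = trans (⊗-at-0 (𝟙 ⊟ a ⊗ q ↑ N) (fin a q N)) (cong₂ ℤ._*_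
  (trans (⊟-at 𝟙 (a ⊗ q ↑ N) 0) (cong (ℤ._-_ 1ℤ) (⊗-at-0-zero (q ↑ N) a₀≡0)))
  (fin-at-0 a q N a₀≡0))

-- term Q c j = c^j Q^(j(j-1)/2)
term : Series → Series → ℕ → Series
term Q c zero    = 𝟙
term Q c (suc j) = term Q c j ⊗ c ⊗ Q ↑ j

-- For A B = Q this is the part with indices from - n to n of Ramanujan's two-sided series f(A, B);
-- the negative indices contribute the powers of B.
thetaSum : Series → Series → Series → ℕ → Series
thetaSum Q A B zero    = 𝟙
thetaSum Q A B (suc n) = thetaSum Q A B n ⊕ (term Q A (suc n) ⊕ term Q B (suc n))

module GaussianBinomial (Q : Series) (Q₀≡0 : Q 0 ≡ 0ℤ) where

  -- G a b is the Gaussian binomial coefficient (a + b choose a).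
  G : ℕ → ℕ → Series
  G zero    b       = 𝟙
  G (suc a) zero    = 𝟙
  G (suc a) (suc b) = G a (suc b) ⊕ Q ↑ suc a ⊗ G (suc a) b

  E : ℕ → Series
  E = fin Q Q

  -- The quotient formula with cleared denominators. It yields the symmetry and the limit of `G`,
  -- both of which the recursion hides.
  G-factorial : ∀ a b → E a ⊗ E b ⊗ G a b ≈ E (a ℕ.+ b)
  G-factorial zero    b    = solve 1 (λ e → one :* e :* one := e) ≈-refl (E b)
  G-factorial (suc a) zero = ≈-trans (solve 1 (λ e → e :* one :* one := e) ≈-refl (E (suc a)))
    (≈-reflexive (cong E (sym (ℕ.+-identityʳ (suc a)))))
  G-factorial (suc a) (suc b) = modulo
    (solve 10 (λ q p q⁺ q⁺⁺ eₐ e_b e g₁ g₂ r →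
      (one :- q :* p) :* eₐ :* ((one :- q :* r) :* e_b) :* (g₁ :+ q⁺ :* g₂) :=
      (one :- q :* q⁺⁺) :* e :+
      ((one :- q :* p) :* (eₐ :* ((one :- q :* r) :* e_b) :* g₁ :- e)
       :+ q⁺ :* (one :- q :* r) :* ((one :- q :* p) :* eₐ :* e_b :* g₂ :- e)
       :+ q :* r :* e :* (q :* p :- q⁺) :+ q :* e :* (q⁺⁺ :- p :* (q :* r)) :+ e :* (q⁺ :- q :* p)))
      ≈-refl Q (Q ↑ a) (Q ↑ suc a) (Q ↑ (a ℕ.+ suc b)) (E a) (E b) (E (a ℕ.+ suc b)) (G a (suc b)) (G (suc a) b) (Q ↑ b))
    ((_ ∙ vanish (G-factorial a (suc b)))
     ∔ (_ ∙ vanish (≈-trans (G-factorial (suc a) b) (≈-reflexive (cong E (sym (ℕ.+-suc a b))))))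
     ∔ (_ ∙ vanish (≈-sym (↑-suc Q a)))
     ∔ (_ ∙ vanish (≈-trans (↑-+ Q a (suc b)) (⊗-cong ≈-refl (↑-suc Q b))))
     ∔ (_ ∙ vanish (↑-suc Q a)))

  E-at-0 : ∀ n → E n 0 ≡ 1ℤ
  E-at-0 n = fin-at-0 Q Q n Q₀≡0

  G-comm : ∀ a b → G a b ≈ G b a
  G-comm a b = ⊗-cancelˡ (E a) (E-at-0 a) (⊗-cancelˡ (E b) (E-at-0 b) (begin
    E b ⊗ (E a ⊗ G a b) ≈⟨ solve 3 (λ a b g → b :* (a :* g) := a :* b :* g) ≈-refl (E a) (E b) (G a b) ⟩
    E a ⊗ E b ⊗ G a b   ≈⟨ G-factorial a b ⟩
    E (a ℕ.+ b)         ≡⟨ cong E (ℕ.+-comm a b) ⟩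
    E (b ℕ.+ a)         ≈⟨ G-factorial b a ⟨
    E b ⊗ E a ⊗ G b a   ≈⟨ CommutativeRing.*-assoc series (E b) (E a) (G b a) ⟩
    E b ⊗ (E a ⊗ G b a) ∎))
    where open ≈-Reasoning

  G-pascal : ∀ a b → G (suc a) (suc b) ≈ Q ↑ suc b ⊗ G a (suc b) ⊕ G (suc a) b
  G-pascal a b = begin
    G (suc a) (suc b)                     ≈⟨ G-comm (suc a) (suc b) ⟩
    G b (suc a) ⊕ Q ↑ suc b ⊗ G (suc b) a ≈⟨ ⊕-cong (G-comm b (suc a)) (⊗-cong ≈-refl (G-comm (suc b) a)) ⟩
    G (suc a) b ⊕ Q ↑ suc b ⊗ G a (suc b) ≈⟨ ⊕-comm′ _ _ ⟩
    Q ↑ suc b ⊗ G a (suc b) ⊕ G (suc a) b ∎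
    where open ≈-Reasoning

  τ : Series → ℕ → Series
  τ = term Q

  -- K c m n i = Σ_{l ≤ m} G (m - l) (n + l) (τ c (i + l)) and T is its limit.
  K : Series → ℕ → ℕ → ℕ → Series
  K c zero    n i = τ c i
  K c (suc m) n i = G (suc m) n ⊗ τ c i ⊕ K c m (suc n) (suc i)

  T : Series → ℕ → ℕ → Series
  T c zero    i = τ c i
  T c (suc m) i = τ c i ⊕ T c m (suc i)

  H : Series → ℕ → ℕ → Series
  H c zero    n = 𝟘
  H c (suc m) n = K c m (suc n) 1

  K-G-H : ∀ c m n → K c m n 0 ≈ G m n ⊕ H c m n
  K-G-H c zero    n = ≈-sym (CommutativeRing.+-identityʳ series 𝟙)
  K-G-H c (suc m) n = ⊕-cong (CommutativeRing.*-identityʳ series (G (suc m) n)) ≈-refl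

  -- Pascal's rule in every summand. In the l-th one Q^(m+1-l) meets the factor Q^(i+l) of
  -- `τ c (i + l + 1)`, and their product Q^(m+1+i) does not depend on l.
  K-step-A : ∀ c m n i → K c (suc m) (suc n) (suc i) ≈ K c m (suc n) (suc i) ⊕ c ⊗ Q ↑ (suc m ℕ.+ i) ⊗ K c (suc m) n i
  K-step-A c zero n i = modulo
    (solve 8 (λ t c p q p⁺ p⁺′ q¹ g → (one :+ q¹ :* g) :* (t :* c :* p) :+ t :* c :* p :* c :* p⁺ :=
       t :* c :* p :+ c :* p⁺ :* (g :* t :+ t :* c :* p) :+ (g :* t :* c :* p :* (q¹ :- q :* one) :+ g :* t :* c :* (q :* p :- p⁺)))
      ≈-refl (τ c i) c (Q ↑ i) Q (Q ↑ suc i) 𝟙 (Q ↑ 1) (G 1 n))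
    ((_ ∙ vanish (↑-suc Q 0)) ∔ (_ ∙ vanish (≈-sym (↑-suc Q i))))
  K-step-A c (suc m) n i = modulo
    (solve 11 (λ t c p r s g₁ g₂ k₁ k₂ k₃ k₄ →
       (g₁ :+ r :* g₂) :* (t :* c :* p) :+ k₁ :=
       g₁ :* (t :* c :* p) :+ k₂ :+ c :* s :* (g₂ :* t :+ k₃) :+
       (g₂ :* t :* c :* (r :* p :- s) :+ (k₁ :- (k₂ :+ c :* k₄ :* k₃)) :+ c :* k₃ :* (k₄ :- s)))
      ≈-refl (τ c i) c (Q ↑ i) (Q ↑ suc (suc m)) (Q ↑ (suc (suc m) ℕ.+ i)) (G (suc m) (suc n)) (G (suc (suc m)) n)
      (K c (suc m) (suc (suc n)) (suc (suc i))) (K c m (suc (suc n)) (suc (suc i))) (K c (suc m) (suc n) (suc i)) (Q ↑ (suc m ℕ.+ suc i)))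
    ((_ ∙ vanish (≈-sym (↑-+ Q (suc (suc m)) i)))
     ∔ vanish (K-step-A c m (suc n) (suc i))
     ∔ (_ ∙ vanish (≈-reflexive (cong (λ k → Q ↑ suc k) (ℕ.+-suc m i)))))

  module _ (A B : Series) (AB≈Q : A ⊗ B ≈ Q) where

    -- The other Pascal rule in every summand: by A B = Q, its factor Q^(k+1+l) turns `τ B (i + l)`
    -- into A Q^m times `τ B (i + l + 1)`. The variable m stands for k - i.
    K-step-B : ∀ n k i m → Q ↑ k ≈ Q ↑ m ⊗ Q ↑ i →
      K B (suc n) (suc k) i ≈ K B (suc n) k i ⊕ A ⊗ Q ↑ m ⊗ K B n (suc k) (suc i)
    K-step-B n k i m e with n
    ... | zero = modulo
      (solve 9 (λ t b p r s a q g₁ g₀ → g₀ :* t :+ t :* b :* p :=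
         g₁ :* t :+ t :* b :* p :+ a :* r :* (t :* b :* p) :+
         (t :* (g₀ :- (s :* one :+ g₁)) :+ t :* (s :- q :* (r :* p)) :+ t :* r :* p :* (q :- a :* b)))
        ≈-refl (τ B i) B (Q ↑ i) (Q ↑ m) (Q ↑ suc k) A Q (G 1 k) (G 1 (suc k)))
      (_ ∙ vanish (G-pascal 0 k) ∔ _ ∙ vanish (≈-trans (↑-suc Q k) (⊗-cong ≈-refl e)) ∔ _ ∙ vanish (≈-sym AB≈Q))
    ... | suc n = modulo
      (solve 13 (λ t b p r s a q g₁ g₂ g₀ k₁ k₂ k₃ → g₀ :* t :+ k₁ :=
         g₁ :* t :+ k₂ :+ a :* r :* (g₂ :* (t :* b :* p) :+ k₃) :+
         (t :* (g₀ :- (s :* g₂ :+ g₁)) :+ g₂ :* t :* (s :- q :* (r :* p)) :+ g₂ :* t :* r :* p :* (q :- a :* b)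
          :+ (k₁ :- (k₂ :+ a :* r :* k₃))))
        ≈-refl (τ B i) B (Q ↑ i) (Q ↑ m) (Q ↑ suc k) A Q (G (suc (suc n)) k) (G (suc n) (suc k)) (G (suc (suc n)) (suc k))
        (K B (suc n) (suc (suc k)) (suc i)) (K B (suc n) (suc k) (suc i)) (K B n (suc (suc k)) (suc (suc i))))
      (_ ∙ vanish (G-pascal (suc n) k) ∔ _ ∙ vanish (≈-trans (↑-suc Q k) (⊗-cong ≈-refl e)) ∔ _ ∙ vanish (≈-sym AB≈Q)
       ∔ vanish (K-step-B n (suc k) (suc i) m e⁺))
      where
      e⁺ : Q ↑ suc k ≈ Q ↑ m ⊗ Q ↑ suc i
      e⁺ = begin
        Q ↑ suc k            ≈⟨ ↑-suc Q k ⟩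
        Q ⊗ Q ↑ k            ≈⟨ ⊗-cong ≈-refl e ⟩
        Q ⊗ (Q ↑ m ⊗ Q ↑ i)  ≈⟨ solve 3 (λ a b c → a :* (b :* c) := b :* (a :* c)) ≈-refl Q (Q ↑ m) (Q ↑ i) ⟩
        Q ↑ m ⊗ (Q ⊗ Q ↑ i)  ≈⟨ ⊗-cong ≈-refl (↑-suc Q i) ⟨
        Q ↑ m ⊗ Q ↑ suc i    ∎
        where open ≈-Reasoning

    -- The finite form of the theta series, with Gaussian binomials as weights and the index 0
    -- counted in the part of B. It belongs to m factors in A and n factors in B.
    F : ℕ → ℕ → Series
    F m n = H A m n ⊕ K B n m 0

    F-step : ∀ m n → F (suc m) n ≈ (𝟙 ⊟ neg A ⊗ Q ↑ m) ⊗ F m n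
    F-step m n = ≈-trans (⊕-cong (A-part m) (B-part n)) (modulo
      (solve 6 (λ h g k a r hb → h :+ a :* r :* (g :+ h) :+ (k :+ a :* r :* hb) :=
        (one :- (:- a) :* r) :* (h :+ k) :+ a :* r :* (g :+ hb :- k)) ≈-refl (H A m n) (G m n) (K B n m 0) A (Q ↑ m) (H B n m))
      (_ ∙ vanish (≈-trans (⊕-cong (G-comm m n) ≈-refl) (≈-sym (K-G-H B n m)))))
      where
      A-part : ∀ m → H A (suc m) n ≈ H A m n ⊕ A ⊗ Q ↑ m ⊗ (G m n ⊕ H A m n)
      A-part zero = modulo (solve 2 (λ a z → one :* a :* one := z :+ a :* one :* (one :+ z) :+ (:- one :- a) :* z) ≈-refl A 𝟘) (_ ∙ ≈-refl)
      A-part (suc m) = ≈-trans (K-step-A A m n 0) (⊕-cong ≈-refl (⊗-cong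
        (⊗-cong ≈-refl (≈-reflexive (cong (λ k → Q ↑ suc k) (ℕ.+-identityʳ m)))) (K-G-H A (suc m) n)))
      B-part : ∀ n → K B n (suc m) 0 ≈ K B n m 0 ⊕ A ⊗ Q ↑ m ⊗ H B n m
      B-part zero    = ≈-sym (modulo ≈-refl (_ ∙ ≈-refl))
      B-part (suc n) = K-step-B n m 0 m (≈-sym (CommutativeRing.*-identityʳ series (Q ↑ m)))

    F-product : ∀ m n → F m n ≈ fin (neg A) Q m ⊗ F 0 n
    F-product zero    n = ≈-sym (CommutativeRing.*-identityˡ series (F 0 n))
    F-product (suc m) n = ≈-trans (F-step m n) (≈-trans (⊗-cong ≈-refl (F-product m n))
      (≈-sym (CommutativeRing.*-assoc series (𝟙 ⊟ neg A ⊗ Q ↑ m) (fin (neg A) Q m) (F 0 n))))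

  -- `F-product` splits off the factors in A. The remaining sum at (0, n) is the sum at (n, 0) with
  -- A and B exchanged, from which it splits off the factors in B.
  F-finite : ∀ A B (AB≈Q : A ⊗ B ≈ Q) m n → F A B AB≈Q m n ≈ fin (neg A) Q m ⊗ fin (neg B) Q n
  F-finite A B AB≈Q m n = ≈-trans (F-product A B AB≈Q m n) (⊗-cong ≈-refl (begin
    𝟘 ⊕ K B n 0 0                   ≈⟨ ⊕-comm′ 𝟘 (K B n 0 0) ⟩
    K B n 0 0 ⊕ 𝟘                   ≈⟨ ⊕-cong (≈-trans (K-G-H B n 0) (⊕-cong (G-comm n 0) ≈-refl)) ≈-refl ⟩
    𝟙 ⊕ H B n 0 ⊕ 𝟘                 ≈⟨ modulo (solve 2 (λ h z → one :+ h :+ z := h :+ one :+ z) ≈-refl (H B n 0) 𝟘) ≈-refl ⟩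
    H B n 0 ⊕ K A 0 n 0             ≈⟨ F-product B A BA≈Q n 0 ⟩
    fin (neg B) Q n ⊗ (𝟘 ⊕ 𝟙)       ≈⟨ ⊗-cong ≈-refl (CommutativeRing.+-identityˡ series 𝟙) ⟩
    fin (neg B) Q n ⊗ 𝟙             ≈⟨ CommutativeRing.*-identityʳ series (fin (neg B) Q n) ⟩
    fin (neg B) Q n                 ∎))
    where
    open ≈-Reasoning
    BA≈Q : B ⊗ A ≈ Q
    BA≈Q = ≈-trans (⊗-comm′ B A) AB≈Q

  e : Series
  e = ⟨ Q ⨾ Q ⟩∞

  module _ {M : ℕ} where

    G-limit : ∀ {a b} → M ≤ a → M ≤ b → e ⊗ G a b ≈[ M ] 𝟙
    G-limit {a} {b} M≤a M≤b = begin
      e ⊗ G a b                   ≈⟨ ≈⇒≈[] (modulo (solve 3 (λ e e⁻ g → e :* g := e⁻ :* (e :* e :* g) :+ e :* g :* (one :- e :* e⁻)) ≈-refl e (1/ e) (G a b))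
                                        (_ ∙ vanish (≈-sym e-inverse))) ⟩
      1/ e ⊗ (e ⊗ e ⊗ G a b)      ≈⟨ ⊗-cong[] ≈[]-refl (⊗-cong[] (⊗-cong[] (e≈E M≤a) (e≈E M≤b)) ≈[]-refl) ⟩
      1/ e ⊗ (E a ⊗ E b ⊗ G a b)  ≈⟨ ≈⇒≈[] (⊗-cong ≈-refl (G-factorial a b)) ⟩
      1/ e ⊗ E (a ℕ.+ b)          ≈⟨ ⊗-cong[] ≈[]-refl (e≈E (ℕ.≤-trans M≤a (ℕ.m≤m+n a b))) ⟨
      1/ e ⊗ e                    ≈⟨ ≈⇒≈[] (≈-trans (⊗-comm′ (1/ e) e) e-inverse) ⟩
      𝟙                           ∎
      where
      open ≈[]-Reasoning M
      e-inverse : e ⊗ 1/ e ≈ 𝟙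
      e-inverse = ⊗-inverseʳ (⟨⟩∞-at-0 Q Q Q₀≡0)
      e≈E : ∀ {L} → M ≤ L → e ≈[ M ] E L
      e≈E = ⟨⟩∞≈fin Q Q₀≡0

    τ-vanish : ∀ c {i} → M < i → τ c i ≈[ M ] 𝟘
    τ-vanish c {suc i} (s≤s M≤i) = ⊗-zeroʳ[] (τ c i ⊗ c) (≈[]-weaken M≤i (↑-vanish Q₀≡0 i))

    -- In each summand (m - l) + (i + l) exceeds 2M. Either m - l ≥ M, and the Gaussian binomial
    -- times e is 1 to this precision, or i + l > M, and `τ c (i + l)` vanishes.
    K-limit : ∀ c m {n i} → M ≤ n → M ℕ.+ M < m ℕ.+ i → e ⊗ K c m n i ≈[ M ] T c m i
    K-limit c zero {n} {i} M≤n h = ≈[]-trans (⊗-zeroʳ[] e τ≈𝟘) (≈[]-sym τ≈𝟘)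
      where
      τ≈𝟘 : τ c i ≈[ M ] 𝟘
      τ≈𝟘 = τ-vanish c (ℕ.≤-<-trans (ℕ.m≤m+n M M) h)
    K-limit c (suc m) {n} {i} M≤n h = ≈[]-trans
      (≈⇒≈[] (solve 4 (λ e g t k → e :* (g :* t :+ k) := e :* g :* t :+ e :* k) ≈-refl e (G (suc m) n) (τ c i) (K c m (suc n) (suc i))))
      (⊕-cong[] (first (ℕ.≤-<-connex M (suc m)))
        (K-limit c m (ℕ.m≤n⇒m≤1+n M≤n) (subst (M ℕ.+ M <_) (sym (ℕ.+-suc m i)) h)))
      where
      first : (M ≤ suc m) ⊎ (suc m < M) → e ⊗ G (suc m) n ⊗ τ c i ≈[ M ] τ c i
      first (inj₁ M≤m) = ≈[]-trans (⊗-cong[] (G-limit M≤m M≤n) ≈[]-refl) (≈⇒≈[] (CommutativeRing.*-identityˡ series (τ c i)))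
      first (inj₂ m<M) = ≈[]-trans (⊗-zeroʳ[] _ τ≈𝟘) (≈[]-sym τ≈𝟘)
        where
        τ≈𝟘 : τ c i ≈[ M ] 𝟘
        τ≈𝟘 = τ-vanish c (ℕ.+-cancelˡ-< M M i (ℕ.<-≤-trans h (ℕ.+-monoˡ-≤ i (ℕ.<⇒≤ m<M))))

  T-snoc : ∀ c m i → T c (suc m) i ≈ T c m i ⊕ τ c (suc m ℕ.+ i)
  T-snoc c zero    i = ≈-refl
  T-snoc c (suc m) i = ≈-trans (⊕-cong ≈-refl (≈-trans (T-snoc c m (suc i)) (⊕-cong ≈-refl (≈-reflexive (cong (τ c ∘ suc) (ℕ.+-suc m i))))))
    (≈-sym (CommutativeRing.+-assoc series (τ c i) (T c m (suc i)) (τ c (suc (suc m) ℕ.+ i))))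

  T-thetaSum : ∀ A B n → T A n 1 ⊕ T B (suc n) 0 ≈ thetaSum Q A B (suc n)
  T-thetaSum A B zero    = solve 2 (λ a b → a :+ (one :+ b) := one :+ (a :+ b)) ≈-refl (τ A 1) (τ B 1)
  T-thetaSum A B (suc n) = begin
    T A (suc n) 1 ⊕ T B (suc (suc n)) 0
      ≈⟨ ⊕-cong (T-snoc A n 1) (T-snoc B (suc n) 0) ⟩
    T A n 1 ⊕ τ A (suc n ℕ.+ 1) ⊕ (T B (suc n) 0 ⊕ τ B (suc (suc n) ℕ.+ 0))
      ≡⟨ cong₂ (λ i j → T A n 1 ⊕ τ A i ⊕ (T B (suc n) 0 ⊕ τ B j)) (ℕ.+-comm (suc n) 1) (ℕ.+-identityʳ (suc (suc n))) ⟩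
    T A n 1 ⊕ τ A (suc (suc n)) ⊕ (T B (suc n) 0 ⊕ τ B (suc (suc n)))
      ≈⟨ solve 4 (λ s a t b → s :+ a :+ (t :+ b) := s :+ t :+ (a :+ b)) ≈-refl (T A n 1) (τ A (suc (suc n))) (T B (suc n) 0) (τ B (suc (suc n))) ⟩
    T A n 1 ⊕ T B (suc n) 0 ⊕ (τ A (suc (suc n)) ⊕ τ B (suc (suc n)))
      ≈⟨ ⊕-cong (T-thetaSum A B n) ≈-refl ⟩
    thetaSum Q A B (suc (suc n)) ∎
    where open ≈-Reasoning

θ : Series → Series → Series → Series
θ Q A B = ⟨ Q ⨾ Q ⟩∞ ⊗ (⟨ neg A ⨾ Q ⟩∞ ⊗ ⟨ neg B ⨾ Q ⟩∞)

jacobiTripleProduct : ∀ {Q A B} → Q 0 ≡ 0ℤ → A ⊗ B ≈ Q → ∀ {M n} → M ℕ.+ M < n → θ Q A B ≈[ M ] thetaSum Q A B n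
jacobiTripleProduct {Q} {A} {B} Q₀≡0 AB≈Q {M} {suc n} h = begin
  ⟨ Q ⨾ Q ⟩∞ ⊗ (⟨ neg A ⨾ Q ⟩∞ ⊗ ⟨ neg B ⨾ Q ⟩∞)
    ≈⟨ ⊗-cong[] ≈[]-refl (⊗-cong[] (⟨⟩∞≈fin (neg A) Q₀≡0 M≤1+n) (⟨⟩∞≈fin (neg B) Q₀≡0 M≤1+n)) ⟩
  e ⊗ (fin (neg A) Q (suc n) ⊗ fin (neg B) Q (suc n))
    ≈⟨ ≈⇒≈[] (⊗-cong ≈-refl (≈-sym (F-finite A B AB≈Q (suc n) (suc n)))) ⟩
  e ⊗ (K A n (suc (suc n)) 1 ⊕ K B (suc n) (suc n) 0)
    ≈⟨ ≈⇒≈[] (CommutativeRing.distribˡ series e _ _) ⟩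
  e ⊗ K A n (suc (suc n)) 1 ⊕ e ⊗ K B (suc n) (suc n) 0
    ≈⟨ ⊕-cong[] (K-limit A n (ℕ.m≤n⇒m≤1+n M≤1+n) (subst (M ℕ.+ M <_) (ℕ.+-comm 1 n) h))
                (K-limit B (suc n) M≤1+n (subst (M ℕ.+ M <_) (sym (ℕ.+-identityʳ (suc n))) h)) ⟩
  T A n 1 ⊕ T B (suc n) 0
    ≈⟨ ≈⇒≈[] (T-thetaSum A B n) ⟩
  thetaSum Q A B (suc n) ∎
  where
  open ≈[]-Reasoning M
  open GaussianBinomial Q Q₀≡0
  M≤1+n : M ≤ suc n
  M≤1+n = ℕ.<⇒≤ (ℕ.≤-<-trans (ℕ.m≤m+n M M) h)

-- The 3-dissection of theta series

module _ {Q c d : Series} (cd≈Q : c ⊗ d ≈ Q) where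

  private
    Q⁹ = cube (cube Q)

    Q^3n : ∀ n → Q ↑ (n ℕ.* 3) ≈ cube Q ↑ n
    Q^3n = ↑-triple Q

    Q⁹^n : ∀ n → Q⁹ ↑ n ≈ cube (cube Q ↑ n)
    Q⁹^n n = ≈-trans (↑-⊗ (cube Q ⊗ cube Q) (cube Q) n) (⊗-cong (↑-⊗ (cube Q) (cube Q) n) ≈-refl)

    term-3+ : ∀ k {p} → Q ↑ k ≈ p → term Q c (3 ℕ.+ k) ≈ term Q c k ⊗ (cube c ⊗ cube Q ⊗ cube p)
    term-3+ k {p} e = ≈-trans
      (⊗-cong (⊗-cong (⊗-cong (⊗-cong (⊗-cong ≈-refl e) ≈-refl) e⁺) ≈-refl) (≈-trans (↑-suc Q (suc k)) (⊗-cong ≈-refl e⁺)))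
      (solve 4 (λ t c p q → t :* c :* p :* c :* (q :* p) :* c :* (q :* (q :* p)) := t :* (c :* c :* c :* (q :* q :* q) :* (p :* p :* p))) ≈-refl (term Q c k) c p Q)
      where
      e⁺ : Q ↑ suc k ≈ Q ⊗ p
      e⁺ = ≈-trans (↑-suc Q k) (⊗-cong ≈-refl e)

  term-3n : ∀ n → term Q c (n ℕ.* 3) ≈ term Q⁹ (cube c ⊗ cube Q) n
  term-3n zero    = ≈-refl
  term-3n (suc n) = begin
    term Q c (3 ℕ.+ n ℕ.* 3)                                          ≈⟨ term-3+ (n ℕ.* 3) (Q^3n n) ⟩
    term Q c (n ℕ.* 3) ⊗ (cube c ⊗ cube Q ⊗ cube (cube Q ↑ n))       ≈⟨ ⊗-cong (term-3n n) (⊗-cong ≈-refl (≈-sym (Q⁹^n n))) ⟩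
    term Q⁹ (cube c ⊗ cube Q) n ⊗ (cube c ⊗ cube Q ⊗ Q⁹ ↑ n)         ≈⟨ CommutativeRing.*-assoc series _ _ _ ⟨
    term Q⁹ (cube c ⊗ cube Q) (suc n)                                 ∎
    where open ≈-Reasoning

  term-1+3n : ∀ n → term Q c (1 ℕ.+ n ℕ.* 3) ≈ c ⊗ term Q⁹ (cube c ⊗ cube Q ⊗ cube Q) n
  term-1+3n zero    = solve 1 (λ c → one :* c :* one := c :* one) ≈-refl c
  term-1+3n (suc n) = begin
    term Q c (4 ℕ.+ n ℕ.* 3)
      ≈⟨ term-3+ (1 ℕ.+ n ℕ.* 3) (≈-trans (↑-suc Q (n ℕ.* 3)) (⊗-cong ≈-refl (Q^3n n))) ⟩
    term Q c (1 ℕ.+ n ℕ.* 3) ⊗ (cube c ⊗ cube Q ⊗ cube (Q ⊗ cube Q ↑ n))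
      ≈⟨ ⊗-cong (term-1+3n n) ≈-refl ⟩
    c ⊗ t ⊗ (cube c ⊗ cube Q ⊗ cube (Q ⊗ cube Q ↑ n))
      ≈⟨ solve 4 (λ c t q p → c :* t :* (c :* c :* c :* (q :* q :* q) :* (q :* p :* (q :* p) :* (q :* p)))
           := c :* (t :* (c :* c :* c :* (q :* q :* q) :* (q :* q :* q)) :* (p :* p :* p))) ≈-refl c t Q (cube Q ↑ n) ⟩
    c ⊗ (t ⊗ (cube c ⊗ cube Q ⊗ cube Q) ⊗ cube (cube Q ↑ n))
      ≈⟨ ⊗-cong ≈-refl (⊗-cong ≈-refl (≈-sym (Q⁹^n n))) ⟩
    c ⊗ term Q⁹ (cube c ⊗ cube Q ⊗ cube Q) (suc n) ∎
    where
    open ≈-Reasoning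
    t = term Q⁹ (cube c ⊗ cube Q ⊗ cube Q) n

  -- The index is 3(n+1) - 1, and d takes the place of Q/c. In this form the term joins the negative
  -- indices of its residue class modulo 3.
  term-2+3n : ∀ n → term Q c (2 ℕ.+ n ℕ.* 3) ≈ d ⊗ term Q⁹ (cube c) (suc n)
  term-2+3n zero    = modulo (solve 4 (λ c d q z → one :* c :* one :* c :* z := d :* (one :* (c :* c :* c) :* one) :+ (c :* c :* (z :- q :* one) :+ c :* c :* (q :- c :* d)))
                        ≈-refl c d Q (Q ↑ 1)) (_ ∙ vanish (↑-suc Q 0) ∔ _ ∙ vanish (≈-sym cd≈Q))
  term-2+3n (suc n) = begin
    term Q c (5 ℕ.+ n ℕ.* 3)
      ≈⟨ term-3+ (2 ℕ.+ n ℕ.* 3) (≈-trans (↑-suc Q (1 ℕ.+ n ℕ.* 3)) (⊗-cong ≈-refl (≈-trans (↑-suc Q (n ℕ.* 3)) (⊗-cong ≈-refl (Q^3n n))))) ⟩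
    term Q c (2 ℕ.+ n ℕ.* 3) ⊗ (cube c ⊗ cube Q ⊗ cube (Q ⊗ (Q ⊗ cube Q ↑ n)))
      ≈⟨ ⊗-cong (term-2+3n n) ≈-refl ⟩
    d ⊗ t ⊗ (cube c ⊗ cube Q ⊗ cube (Q ⊗ (Q ⊗ cube Q ↑ n)))
      ≈⟨ solve 5 (λ c d t q p → d :* t :* (c :* c :* c :* (q :* q :* q) :* (q :* (q :* p) :* (q :* (q :* p)) :* (q :* (q :* p))))
           := d :* (t :* (c :* c :* c) :* (q :* q :* q :* (q :* q :* q) :* (q :* q :* q) :* (p :* p :* p)))) ≈-refl c d t Q (cube Q ↑ n) ⟩
    d ⊗ (t ⊗ cube c ⊗ (Q⁹ ⊗ cube (cube Q ↑ n)))
      ≈⟨ ⊗-cong ≈-refl (⊗-cong ≈-refl (≈-trans (⊗-cong ≈-refl (≈-sym (Q⁹^n n))) (≈-sym (↑-suc Q⁹ n)))) ⟩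
    d ⊗ term Q⁹ (cube c) (suc (suc n)) ∎
    where
    open ≈-Reasoning
    t = term Q⁹ (cube c) (suc n)

-- From - (3n+1) to 3n+1 each residue class modulo 3 contains 2n+1 indices, so with this length the
-- three pieces are all truncated at the same n.
thetaSum-dissect : ∀ {Q A B} → A ⊗ B ≈ Q → ∀ n → thetaSum Q A B (1 ℕ.+ n ℕ.* 3) ≈
  thetaSum (cube (cube Q)) (cube A ⊗ cube Q) (cube B ⊗ cube Q) n
    ⊕ A ⊗ thetaSum (cube (cube Q)) (cube A ⊗ cube Q ⊗ cube Q) (cube B) n
    ⊕ B ⊗ thetaSum (cube (cube Q)) (cube B ⊗ cube Q ⊗ cube Q) (cube A) n
thetaSum-dissect {Q} {A} {B} AB≈Q zero =
  solve 2 (λ a b → one :+ (one :* a :* one :+ one :* b :* one) := one :+ a :* one :+ b :* one) ≈-refl A B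
thetaSum-dissect {Q} {A} {B} AB≈Q (suc n) = ≈-trans
  (⊕-cong (⊕-cong (⊕-cong (thetaSum-dissect AB≈Q n)
    (⊕-cong (term-2+3n AB≈Q n) (term-2+3n BA≈Q n)))
    (⊕-cong (term-3n AB≈Q (suc n)) (term-3n BA≈Q (suc n))))
    (⊕-cong (term-1+3n AB≈Q (suc n)) (term-1+3n BA≈Q (suc n))))
  (solve 11 (λ a b s₀ s₁ s₂ p₀ p₁ p₂ m₀ m₁ m₂ →
    s₀ :+ a :* s₁ :+ b :* s₂ :+ (b :* m₂ :+ a :* m₁) :+ (p₀ :+ m₀) :+ (a :* p₁ :+ b :* p₂)
    := s₀ :+ (p₀ :+ m₀) :+ a :* (s₁ :+ (p₁ :+ m₁)) :+ b :* (s₂ :+ (p₂ :+ m₂))) ≈-refl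
    A B _ _ _ _ _ _ _ _ _)
  where
  BA≈Q : B ⊗ A ≈ Q
  BA≈Q = ≈-trans (⊗-comm′ B A) AB≈Q

θ-dissect : ∀ {Q A B} → Q 0 ≡ 0ℤ → A ⊗ B ≈ Q → θ Q A B ≈
  θ (cube (cube Q)) (cube A ⊗ cube Q) (cube B ⊗ cube Q)
    ⊕ A ⊗ θ (cube (cube Q)) (cube A ⊗ cube Q ⊗ cube Q) (cube B)
    ⊕ B ⊗ θ (cube (cube Q)) (cube B ⊗ cube Q ⊗ cube Q) (cube A)
θ-dissect {Q} {A} {B} Q₀≡0 AB≈Q = ≈[]⇒≈ λ M → let n = suc (M ℕ.+ M) in ≈[]-trans
  (jacobiTripleProduct Q₀≡0 AB≈Q (ℕ.≤-trans (ℕ.m≤m*n n 3) (ℕ.n≤1+n (n ℕ.* 3))))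
  (≈[]-trans (≈⇒≈[] (thetaSum-dissect AB≈Q n)) (≈[]-sym (⊕-cong[] (⊕-cong[]
    (jtp e₀) (⊗-cong[] ≈[]-refl (jtp e₁))) (⊗-cong[] ≈[]-refl (jtp e₂)))))
  where
  jtp : ∀ {A B M} → A ⊗ B ≈ cube (cube Q) → θ (cube (cube Q)) A B ≈[ M ] thetaSum (cube (cube Q)) A B (suc (M ℕ.+ M))
  jtp e = jacobiTripleProduct (cube-at-0 (cube-at-0 Q₀≡0)) e ℕ.≤-refl
    where
    cube-at-0 : ∀ {f} → f 0 ≡ 0ℤ → cube f 0 ≡ 0ℤ
    cube-at-0 {f} f₀≡0 = ⊗-at-0-zero f (⊗-at-0-zero f f₀≡0)
  cubes : cube A ⊗ cube B ≈ cube Q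
  cubes = ≈-trans (solve 2 (λ a b → a :* a :* a :* (b :* b :* b) := a :* b :* (a :* b) :* (a :* b)) ≈-refl A B)
    (⊗-cong (⊗-cong AB≈Q AB≈Q) AB≈Q)
  e₀ : cube A ⊗ cube Q ⊗ (cube B ⊗ cube Q) ≈ cube (cube Q)
  e₀ = modulo (solve 3 (λ a b q → a :* q :* (b :* q) := q :* q :* q :+ q :* q :* (a :* b :- q)) ≈-refl (cube A) (cube B) (cube Q)) (_ ∙ vanish cubes)
  e₁ : cube A ⊗ cube Q ⊗ cube Q ⊗ cube B ≈ cube (cube Q)
  e₁ = modulo (solve 3 (λ a b q → a :* q :* q :* b := q :* q :* q :+ q :* q :* (a :* b :- q)) ≈-refl (cube A) (cube B) (cube Q)) (_ ∙ vanish cubes)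
  e₂ : cube B ⊗ cube Q ⊗ cube Q ⊗ cube A ≈ cube (cube Q)
  e₂ = modulo (solve 3 (λ a b q → b :* q :* q :* a := q :* q :* q :+ q :* q :* (a :* b :- q)) ≈-refl (cube A) (cube B) (cube Q)) (_ ∙ vanish cubes)

-- The theta series φ and ψ

θ-cong : ∀ {Q Q′ A A′ B B′} → Q 0 ≡ 0ℤ → Q ≈ Q′ → A ≈ A′ → B ≈ B′ → θ Q A B ≈ θ Q′ A′ B′
θ-cong Q₀≡0 q a b = ⊗-cong (⟨⟩∞-cong Q₀≡0 q q) (⊗-cong (⟨⟩∞-cong Q₀≡0 (neg-cong a) q) (⟨⟩∞-cong Q₀≡0 (neg-cong b) q))

θ-comm : ∀ Q A B → θ Q A B ≈ θ Q B A
θ-comm Q A B = ⊗-cong ≈-refl (⊗-comm′ _ _)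

V-θ : ∀ Q A B → Q 0 ≡ 0ℤ → V (θ Q A B) ≈ θ (V Q) (V A) (V B)
V-θ Q A B Q₀≡0 = ≈-trans (V-⊗ _ _) (⊗-cong (V-⟨⟩∞ Q Q Q₀≡0) (≈-trans (V-⊗ _ _) (⊗-cong (pochhammer A) (pochhammer B))))
  where
  pochhammer : ∀ c → V ⟨ neg c ⨾ Q ⟩∞ ≈ ⟨ neg (V c) ⨾ V Q ⟩∞
  pochhammer c = ≈-trans (V-⟨⟩∞ (neg c) Q Q₀≡0) (⟨⟩∞-cong (trans (V-at-0 Q) Q₀≡0) (V-neg c) ≈-refl)

infixl 7 _V⊗_
_V⊗_ : ∀ {f g f′ g′} → V f ≈ f′ → V g ≈ g′ → V (f ⊗ g) ≈ f′ ⊗ g′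
p V⊗ q = ≈-trans (V-⊗ _ _) (⊗-cong p q)

V-neg′ : ∀ {f f′} → V f ≈ f′ → V (neg f) ≈ neg f′
V-neg′ p = ≈-trans (V-neg _) (neg-cong p)

VV-X : V (V X) ≈ cube (cube X)
VV-X = ≈-trans (V-cong V-X) (V-X V⊗ V-X V⊗ V-X)

-- φ = φ(-q), ψ₂ = 2 ψ(q) in Ramanujan's notation.
φ ψ₂ P Ω s o : Series
φ  = θ (X ⊗ X) (neg X) (neg X)
ψ₂ = θ X 𝟙 X
P  = θ (cube X) X (X ⊗ X)
Ω  = θ (cube (X ⊗ X)) (neg (cube X ⊗ X ⊗ X)) (neg X)
s  = ⟨ neg X ⨾ X ⟩∞
o  = ⟨ X ⨾ X ⊗ X ⟩∞

private
  cube-at-0 : ∀ {f} → f 0 ≡ 0ℤ → cube f 0 ≡ 0ℤ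
  cube-at-0 {f} f₀≡0 = ⊗-at-0-zero f (⊗-at-0-zero f f₀≡0)

  X²₀≡0 : (X ⊗ X) 0 ≡ 0ℤ
  X²₀≡0 = X⊗-at-0 X

-- As A = B, the classes of the indices 1 and -1 agree, whence the factor 2. In Ramanujan's notation
-- `Ω` is f(-q, -q⁵).
φ-dissect : φ ≈ V (V φ) ⊟ ι (+ 2) ⊗ X ⊗ V Ω
φ-dissect = ≈-trans (θ-dissect X²₀≡0 (solve 1 (λ x → (:- x) :* (:- x) := x :* x) ≈-refl X))
  (≈-trans (⊕-cong (⊕-cong (≈-sym VVφ) (⊗-cong ≈-refl (≈-sym VΩ))) (⊗-cong ≈-refl (≈-sym VΩ)))
    (solve 3 (λ x v w → v :+ (:- x) :* w :+ (:- x) :* w := v :- # 2 :* x :* w) ≈-refl X (V (V φ)) (V Ω)))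
  where
  VVφ : V (V φ) ≈ θ (cube (cube (X ⊗ X))) (cube (neg X) ⊗ cube (X ⊗ X)) (cube (neg X) ⊗ cube (X ⊗ X))
  VVφ = ≈-trans (V-cong (V-θ (X ⊗ X) (neg X) (neg X) X²₀≡0)) (≈-trans (V-θ _ _ _ (trans (V-at-0 (X ⊗ X)) X²₀≡0))
    (θ-cong (trans (V-at-0 (V (X ⊗ X))) (trans (V-at-0 (X ⊗ X)) X²₀≡0))
      (≈-trans (V-cong (V-⊗ X X)) (≈-trans (VV-X V⊗ VV-X)
        (solve 1 (λ x → let y = x :* x :* x ; z = y :* y :* y in z :* z := let u = x :* x ; v = u :* u :* u in v :* v :* v) ≈-refl X)))
      VV-neg-X VV-neg-X))
    where
    VV-neg-X : V (V (neg X)) ≈ cube (neg X) ⊗ cube (X ⊗ X)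
    VV-neg-X = ≈-trans (V-cong (V-neg X)) (≈-trans (V-neg′ VV-X)
      (solve 1 (λ x → let y = x :* x :* x in :- (y :* y :* y) := (:- x) :* (:- x) :* (:- x) :* (x :* x :* (x :* x) :* (x :* x))) ≈-refl X))
  VΩ : V Ω ≈ θ (cube (cube (X ⊗ X))) (cube (neg X) ⊗ cube (X ⊗ X) ⊗ cube (X ⊗ X)) (cube (neg X))
  VΩ = ≈-trans (V-θ _ _ _ (cube-at-0 X²₀≡0)) (θ-cong (trans (V-at-0 (cube (X ⊗ X))) (cube-at-0 X²₀≡0))
    (≈-trans (V-X V⊗ V-X V⊗ (V-X V⊗ V-X) V⊗ (V-X V⊗ V-X))
      (solve 1 (λ x → let y = x :* x :* x in y :* y :* (y :* y) :* (y :* y) := let u = x :* x ; v = u :* u :* u in v :* v :* v) ≈-refl X))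
    (≈-trans (V-neg′ (V-X V⊗ V-X V⊗ V-X V⊗ V-X V⊗ V-X))
      (solve 1 (λ x → let y = x :* x :* x ; u = x :* x ; v = u :* u :* u ; w = :- x in :- (y :* y :* y :* y :* y) := w :* w :* w :* v :* v) ≈-refl X))
    (≈-trans (V-neg′ V-X) (solve 1 (λ x → :- (x :* x :* x) := (:- x) :* (:- x) :* (:- x)) ≈-refl X)))

-- As A = 1, the classes of the indices 0 and 1 agree. In Ramanujan's notation `P` is f(q, q²).
ψ₂-dissect : ψ₂ ≈ ι (+ 2) ⊗ V P ⊕ X ⊗ V (V ψ₂)
ψ₂-dissect = ≈-trans (θ-dissect X₀≡0 (CommutativeRing.*-identityˡ series X))
  (≈-trans (⊕-cong (⊕-cong (≈-sym (≈-trans VP (θ-cong (cube-at-0 (cube-at-0 X₀≡0)) ≈-refl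
        (solve 1 (λ x → x := one :* one :* one :* x) ≈-refl (cube X)) ≈-refl)))
      (⊗-cong ≈-refl (≈-sym (≈-trans VP (≈-trans (θ-comm _ _ _) (θ-cong (cube-at-0 (cube-at-0 X₀≡0)) ≈-refl
        (solve 1 (λ x → x :* x := one :* one :* one :* x :* x) ≈-refl (cube X)) ≈-refl))))))
      (⊗-cong ≈-refl (≈-sym VVψ₂)))
    (solve 3 (λ x p v → p :+ one :* p :+ x :* v := # 2 :* p :+ x :* v) ≈-refl X (V P) (V (V ψ₂))))
  where
  VP : V P ≈ θ (cube (cube X)) (cube X) (cube X ⊗ cube X)
  VP = ≈-trans (V-θ _ _ _ (cube-at-0 X₀≡0)) (θ-cong (trans (V-at-0 (cube X)) (cube-at-0 X₀≡0)) (V-X V⊗ V-X V⊗ V-X) V-X (V-X V⊗ V-X))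
  VVψ₂ : V (V ψ₂) ≈ θ (cube (cube X)) (cube X ⊗ cube X ⊗ cube X) (cube 𝟙)
  VVψ₂ = ≈-trans (V-cong (V-θ _ _ _ X₀≡0)) (≈-trans (V-θ _ _ _ (V-at-0 X)) (≈-trans (θ-comm _ _ _)
    (θ-cong (trans (V-at-0 (V X)) (V-at-0 X)) VV-X VV-X
      (≈-trans (V-cong V-𝟙) (≈-trans V-𝟙 (solve 0 (one := one :* one :* one) ≈-refl))))))

private
  of₂≈f₁ : o ⊗ f₂ ≈ f₁
  of₂≈f₁ = ≈-sym (⟨⟩∞-split₂ X X X₀≡0)

  f₁s≈f₂ : f₁ ⊗ s ≈ f₂
  f₁s≈f₂ = ⟨⟩∞-square X X X₀≡0

  neg-neg : ∀ f → neg (neg f) ≈ f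
  neg-neg = solve 1 (λ f → :- (:- f) := f) ≈-refl

  so≈𝟙 : s ⊗ o ≈ 𝟙
  so≈𝟙 = ⊗-cancelˡ f₁ f₁-at-0 (⊗-cancelˡ f₂ f₂-at-0 (modulo
    (solve 4 (λ f₁ f₂ s o → f₂ :* (f₁ :* (s :* o)) := f₂ :* (f₁ :* one) :+ (o :* f₂ :* (f₁ :* s :- f₂) :+ f₂ :* (o :* f₂ :- f₁)))
      ≈-refl f₁ f₂ s o) (_ ∙ vanish f₁s≈f₂ ∔ _ ∙ vanish of₂≈f₁)))

φ-eta : φ ⊗ f₂ ≈ f₁ ⊗ f₁
φ-eta = ≈-trans (⊗-cong (⊗-cong ≈-refl (⊗-cong o′≈o o′≈o)) ≈-refl) (modulo
  (solve 3 (λ f₁ f₂ o → f₂ :* (o :* o) :* f₂ := f₁ :* f₁ :+ (o :* f₂ :+ f₁) :* (o :* f₂ :- f₁)) ≈-refl f₁ f₂ o) (_ ∙ vanish of₂≈f₁))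
  where
  o′≈o : ⟨ neg (neg X) ⨾ X ⊗ X ⟩∞ ≈ o
  o′≈o = ⟨⟩∞-cong X²₀≡0 (neg-neg X) ≈-refl

ψ₂-eta : ψ₂ ⊗ f₁ ≈ ι (+ 2) ⊗ (f₂ ⊗ f₂)
ψ₂-eta = ≈-trans (⊗-cong (⊗-cong ≈-refl (⊗-cong 2s ≈-refl)) ≈-refl) (modulo
  (solve 3 (λ f₁ f₂ s → f₁ :* ((one :- (:- one)) :* s :* s) :* f₁ := # 2 :* (f₂ :* f₂) :+ # 2 :* (f₁ :* s :+ f₂) :* (f₁ :* s :- f₂))
    ≈-refl f₁ f₂ s) (_ ∙ vanish f₁s≈f₂))
  where
  2s : ⟨ neg 𝟙 ⨾ X ⟩∞ ≈ (𝟙 ⊟ neg 𝟙) ⊗ s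
  2s = ≈-trans (⟨⟩∞-shift (neg 𝟙) X X₀≡0) (⊗-cong ≈-refl (⟨⟩∞-cong X₀≡0 (solve 1 (λ x → (:- one) :* x := :- x) ≈-refl X) ≈-refl))

-- Supplying the factors with exponents divisible by 3 gives `P ⊗ V s ≈ V f₁ ⊗ s` and
-- `Ω ⊗ V o ≈ V f₂ ⊗ o`; Euler's identity `s ⊗ o ≈ 𝟙` then removes s and o.
P⊗Ω : P ⊗ Ω ≈ V f₁ ⊗ V f₂
P⊗Ω = modulo
  (solve 8 (λ p w vs vo a b s o → p :* w := a :* b :+
     (w :* p :* (one :- vs :* vo) :+ w :* vo :* (p :* vs :- a :* s) :+ a :* s :* (w :* vo :- b :* o) :+ a :* b :* (s :* o :- one)))
    ≈-refl P Ω (V s) (V o) (V f₁) (V f₂) s o)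
  (_ ∙ vanish (≈-sym VsVo≈𝟙) ∔ _ ∙ vanish P⊗Vs ∔ _ ∙ vanish Ω⊗Vo ∔ _ ∙ vanish so≈𝟙)
  where
  VsVo≈𝟙 : V s ⊗ V o ≈ 𝟙
  VsVo≈𝟙 = ≈-trans (≈-sym (V-⊗ s o)) (≈-trans (V-cong so≈𝟙) V-𝟙)
  P⊗Vs : P ⊗ V s ≈ V f₁ ⊗ s
  P⊗Vs = ≈-trans
    (⊗-cong (⊗-cong (≈-sym (≈-trans (V-⟨⟩∞ X X X₀≡0) (⟨⟩∞-cong (V-at-0 X) V-X V-X))) ≈-refl)
      (≈-trans (V-⟨⟩∞ (neg X) X X₀≡0) (⟨⟩∞-cong (V-at-0 X) (V-neg′ V-X) V-X)))
    (≈-trans (CommutativeRing.*-assoc series (V f₁) _ _) (⊗-cong ≈-refl (≈-sym (≈-trans (⟨⟩∞-split₃ (neg X) X X₀≡0)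
      (⊗-cong (⊗-cong ≈-refl (⟨⟩∞-cong (cube-at-0 X₀≡0) (solve 1 (λ x → (:- x) :* x := :- (x :* x)) ≈-refl X) ≈-refl))
        (⟨⟩∞-cong (cube-at-0 X₀≡0) (solve 1 (λ x → (:- x) :* x :* x := :- (x :* x :* x)) ≈-refl X) ≈-refl))))))
  Ω⊗Vo : Ω ⊗ V o ≈ V f₂ ⊗ o
  Ω⊗Vo = ≈-trans
    (⊗-cong (⊗-cong (≈-sym (≈-trans (V-⟨⟩∞ (X ⊗ X) (X ⊗ X) X²₀≡0) (⟨⟩∞-cong (trans (V-at-0 (X ⊗ X)) X²₀≡0) VX² VX²)))
        (⊗-cong (⟨⟩∞-cong (cube-at-0 X²₀≡0) (≈-trans (neg-neg _) (solve 1 (λ x → x :* x :* x :* x :* x := x :* (x :* x) :* (x :* x)) ≈-refl X)) ≈-refl)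
                (⟨⟩∞-cong (cube-at-0 X²₀≡0) (neg-neg X) ≈-refl)))
      (≈-trans (V-⟨⟩∞ X (X ⊗ X) X²₀≡0) (⟨⟩∞-cong (trans (V-at-0 (X ⊗ X)) X²₀≡0) V-X VX²)))
    (≈-trans (solve 4 (λ v a b c → v :* (a :* b) :* c := v :* (b :* c :* a)) ≈-refl (V f₂) ⟨ X ⊗ (X ⊗ X) ⊗ (X ⊗ X) ⨾ cube (X ⊗ X) ⟩∞ ⟨ X ⨾ cube (X ⊗ X) ⟩∞ ⟨ cube X ⨾ cube (X ⊗ X) ⟩∞)
      (⊗-cong ≈-refl (≈-sym (≈-trans (⟨⟩∞-split₃ X (X ⊗ X) X²₀≡0)
        (⊗-cong (⊗-cong ≈-refl (⟨⟩∞-cong (cube-at-0 X²₀≡0) (solve 1 (λ x → x :* (x :* x) := x :* x :* x) ≈-refl X) ≈-refl)) ≈-refl)))))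
    where
    VX² : V (X ⊗ X) ≈ cube (X ⊗ X)
    VX² = ≈-trans (V-X V⊗ V-X) (solve 1 (λ x → x :* x :* x :* (x :* x :* x) := x :* x :* (x :* x) :* (x :* x)) ≈-refl X)

φ-at-0 : φ 0 ≡ 1ℤ
φ-at-0 = trans (⊗-at-0 f₂ _) (cong₂ ℤ._*_ f₂-at-0 (trans (⊗-at-0 ⟨ neg (neg X) ⨾ X ⊗ X ⟩∞ ⟨ neg (neg X) ⨾ X ⊗ X ⟩∞)
  (cong₂ ℤ._*_ o₀ o₀)))
  where
  o₀ : ⟨ neg (neg X) ⨾ X ⊗ X ⟩∞ 0 ≡ 1ℤ
  o₀ = ⟨⟩∞-at-0 (neg (neg X)) (X ⊗ X) (at (neg-neg X) 0)

d₂-eta : d₂ ⊗ (f₁ ⊗ cube f₁ ⊗ cube f₁) ≈ f₂ ⊗ f₂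
d₂-eta = begin
  d₂ ⊗ (f₁ ⊗ cube f₁ ⊗ cube f₁)       ≈⟨ ⊗-cong (⊗-def (f ↑ 2) (1/ (f₁ ↑ 7))) ≈-refl ⟩
  f ↑ 2 ⊗ 1/ (f₁ ↑ 7) ⊗ (f₁ ⊗ cube f₁ ⊗ cube f₁)
    ≈⟨ ⊗-cong (⊗-cong (≈-trans (power-2 f) (⊗-cong f≈f₂ f≈f₂)) ≈-refl) (≈-sym (power-7 f₁)) ⟩
  f₂ ⊗ f₂ ⊗ 1/ (f₁ ↑ 7) ⊗ f₁ ↑ 7       ≈⟨ modulo (solve 3 (λ a b c → a :* b :* c := a :+ a :* (c :* b :- one)) ≈-refl (f₂ ⊗ f₂) (1/ (f₁ ↑ 7)) (f₁ ↑ 7))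
                                            (_ ∙ vanish (⊗-inverseʳ d₂-denominator₀)) ⟩
  f₂ ⊗ f₂ ∎
  where
  open ≈-Reasoning
  f = ⟨ X ↑ 2 ⨾ X ↑ 2 ⟩∞
  power-2 : ∀ g → g ↑ 2 ≈ g ⊗ g
  power-2 g = ≈-trans (↑-suc g 1) (⊗-cong ≈-refl (≈-trans (↑-suc g 0) (CommutativeRing.*-identityʳ series g)))
  power-7 : ∀ g → g ↑ 7 ≈ g ⊗ cube g ⊗ cube g
  power-7 g = ≈-trans (≈-trans (↑-suc g 6) (⊗-cong ≈-refl (≈-trans (↑-triple g 2) (power-2 (cube g))))) (≈-sym (CommutativeRing.*-assoc series g (cube g) (cube g)))
  f≈f₂ : f ≈ f₂
  f≈f₂ = ⟨⟩∞-cong refl (power-2 X) (power-2 X)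

-- The cubic continued fraction

evalAt : Series → List ℤ → Series
evalAt z []       = ι 0ℤ
evalAt z (c ∷ cs) = ι c ⊕ z ⊗ evalAt z cs

poly : ∀ {n} → Polynomial n → List ℤ → Polynomial n
poly z []       = con 0ℤ
poly z (c ∷ cs) = con c :+ z :* poly z cs

V-evalAt : ∀ z cs → V (evalAt z cs) ≈ evalAt (V z) cs
V-evalAt z []       = V-ι 0ℤ
V-evalAt z (c ∷ cs) = ≈-trans (V-⊕ _ _) (⊕-cong (V-ι c) (≈-trans (V-⊗ _ _) (⊗-cong ≈-refl (V-evalAt z cs))))

evalAt-cong : ∀ {z z′} → z ≈ z′ → ∀ cs → evalAt z cs ≈ evalAt z′ cs
evalAt-cong p []       = ≈-refl
evalAt-cong p (c ∷ cs) = ⊕-cong ≈-refl (⊗-cong p (evalAt-cong p cs))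

-- x is a power series version of the cubic continued fraction, at q³.
w x y m t Z : Series
w = Ω ⊗ 1/ V φ
x = X ⊗ V w
y = X ⊗ cube w
m = 𝟙 ⊟ ι (+ 2) ⊗ x
t = x ⊗ 1/ m
Z = y ⊗ 1/ (𝟙 ⊟ ι (+ 8) ⊗ y)

unit-at-0 : ∀ {z} → z 0 ≡ 0ℤ → ∀ {u} g → u ≈ 𝟙 ⊕ z ⊗ g → u 0 ≡ 1ℤ
unit-at-0 {z} z₀≡0 g u≈ = trans (at u≈ 0) (trans (⊕-at 𝟙 (z ⊗ g) 0) (cong (ℤ._+_ 1ℤ) (⊗-at-0-zero g z₀≡0)))

private
  x₀≡0 : x 0 ≡ 0ℤ
  x₀≡0 = X⊗-at-0 _

  y₀≡0 : y 0 ≡ 0ℤ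
  y₀≡0 = X⊗-at-0 _

  m₀≡1 : m 0 ≡ 1ℤ
  m₀≡1 = unit-at-0 x₀≡0 (neg (ι (+ 2))) (solve 1 (λ x → one :- # 2 :* x := one :+ x :* (:- # 2)) ≈-refl x)

  1-8y₀≡1 : (𝟙 ⊟ ι (+ 8) ⊗ y) 0 ≡ 1ℤ
  1-8y₀≡1 = unit-at-0 y₀≡0 (neg (ι (+ 8))) (solve 1 (λ x → one :- # 8 :* x := one :+ x :* (:- # 8)) ≈-refl y)

  Vy≈x³ : V y ≈ cube x
  Vy≈x³ = ≈-trans (V-X V⊗ V-cube w) (solve 2 (λ x w → x :* x :* x :* (w :* w :* w) := x :* w :* (x :* w) :* (x :* w)) ≈-refl X (V w))

  Vφ₀≡1 : V φ 0 ≡ 1ℤ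
  Vφ₀≡1 = trans (V-at-0 φ) φ-at-0

  Vφ⊗w : V φ ⊗ w ≈ Ω
  Vφ⊗w = modulo (solve 3 (λ p w i → p :* (w :* i) := w :+ w :* (p :* i :- one)) ≈-refl (V φ) Ω (1/ V φ)) (_ ∙ vanish (⊗-inverseʳ Vφ₀≡1))

  VVφ⊗x : V (V φ) ⊗ x ≈ X ⊗ V Ω
  VVφ⊗x = modulo (solve 4 (λ p x w o → p :* (x :* w) := x :* o :+ x :* (p :* w :- o)) ≈-refl (V (V φ)) X (V w) (V Ω))
    (_ ∙ vanish (≈-trans (≈-sym (V-⊗ (V φ) w)) (V-cong Vφ⊗w)))

  φ-x : φ ≈ V (V φ) ⊗ m
  φ-x = ≈-trans φ-dissect (modulo (solve 4 (λ p q o x → p :- # 2 :* q :* o := p :* (one :- # 2 :* x) :+ # 2 :* (p :* x :- q :* o))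
    ≈-refl (V (V φ)) X (V Ω) x) (_ ∙ vanish VVφ⊗x))

  φ⊗ψ₂ : φ ⊗ ψ₂ ≈ ι (+ 2) ⊗ (f₁ ⊗ f₂)
  φ⊗ψ₂ = ⊗-cancelˡ f₁ f₁-at-0 (⊗-cancelˡ f₂ f₂-at-0 (modulo
    (solve 4 (λ a b p r → b :* (a :* (p :* r)) := b :* (a :* (# 2 :* (a :* b))) :+
      (r :* a :* (p :* b :- a :* a) :+ a :* a :* (r :* a :- # 2 :* (b :* b)))) ≈-refl f₁ f₂ φ ψ₂)
    (_ ∙ vanish φ-eta ∔ _ ∙ vanish ψ₂-eta)))

  VVφ₀≡1 : V (V φ) 0 ≡ 1ℤ
  VVφ₀≡1 = trans (V-at-0 (V φ)) Vφ₀≡1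

  -- Since P Ω = f₁(q³) f₂(q³) and 2 f₁ f₂ = φ ψ₂, the component `P` of the dissection can be
  -- expressed by `Ω`, hence by x.
  ψ₂-x : x ⊗ ψ₂ ≈ X ⊗ V (V ψ₂) ⊗ (𝟙 ⊕ x)
  ψ₂-x = ⊗-cancelˡ (V (V φ)) VVφ₀≡1 (modulo
    (solve 7 (λ p x r q s o k → p :* (x :* r) := p :* (q :* s :* (one :+ x)) :+
      (r :* (p :* x :- q :* o) :+ q :* o :* (r :- (# 2 :* k :+ q :* s)) :+ q :* (# 2 :* (k :* o) :- p :* s) :+ q :* s :* (q :* o :- p :* x)))
      ≈-refl (V (V φ)) x ψ₂ X (V (V ψ₂)) (V Ω) (V P))
    (_ ∙ vanish VVφ⊗x ∔ _ ∙ vanish ψ₂-dissect ∔ X ∙ vanish VP⊗VΩ ∔ _ ∙ vanish (≈-sym VVφ⊗x)))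
    where
    VP⊗VΩ : ι (+ 2) ⊗ (V P ⊗ V Ω) ≈ V (V φ) ⊗ V (V ψ₂)
    VP⊗VΩ = begin
      ι (+ 2) ⊗ (V P ⊗ V Ω)        ≈⟨ ⊗-cong ≈-refl (≈-trans (≈-sym (V-⊗ P Ω)) (V-cong (≈-trans P⊗Ω (≈-sym (V-⊗ f₁ f₂))))) ⟩
      ι (+ 2) ⊗ V (V (f₁ ⊗ f₂))    ≈⟨ V-cong (V-ι (+ 2) V⊗ ≈-refl) ⟨≈⟩ (V-ι (+ 2) V⊗ ≈-refl) ⟨
      V (V (ι (+ 2) ⊗ (f₁ ⊗ f₂)))  ≈⟨ V-cong (V-cong φ⊗ψ₂) ⟨
      V (V (φ ⊗ ψ₂))               ≈⟨ V-cong (V-⊗ φ ψ₂) ⟨≈⟩ V-⊗ (V φ) (V ψ₂) ⟩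
      V (V φ) ⊗ V (V ψ₂)           ∎
      where
      open ≈-Reasoning
      _⟨≈⟩_ = ≈-trans

  -- The third component of φ is 0, so the form reduces to a³ + q b³ with a = φ(-q³) and b = - 2Ω =
  -- - 2 a w.
  N-φ : N φ ≈ cube (V φ) ⊗ (𝟙 ⊟ ι (+ 8) ⊗ y)
  N-φ = ≈-trans
    (N-assemble (V φ) (neg (ι (+ 2) ⊗ Ω)) 𝟘 (≈-trans φ-dissect (≈-sym (≈-trans
      (⊕-cong (⊕-cong ≈-refl (⊗-cong ≈-refl (V-neg′ (V-ι (+ 2) V⊗ ≈-refl)))) (_ ∙ V-𝟘))
      (modulo (solve 4 (λ p x o z → p :+ x :* (:- (# 2 :* o)) :+ z := p :- # 2 :* x :* o :+ z) ≈-refl (V (V φ)) X (V Ω) 𝟘) ≈-refl)))))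
    (modulo
      (solve 5 (λ x p o w z → let b = :- (# 2 :* o) ; v = p :* w in
        p :* p :* p :+ x :* (b :* b :* b) :+ x :* x :* (z :* z :* z) :- # 3 :* x :* p :* b :* z :=
        p :* p :* p :* (one :- # 8 :* (x :* (w :* w :* w)))
        :+ (# 8 :* x :* (v :* v :+ v :* o :+ o :* o) :* (v :- o) :+ (x :* x :* z :* z :- # 3 :* x :* p :* b) :* z))
        ≈-refl X (V φ) Ω w 𝟘)
      (_ ∙ vanish Vφ⊗w ∔ _ ∙ ≈-refl))

  -- By φ = f₁²/f₂ the norms of f₁ and f₂ give N φ · φ(-q³) = φ⁴; `N-φ` evaluates the left side a
  -- second time.
  φ⁴ : φ ⊗ cube φ ≈ V φ ⊗ cube (V φ) ⊗ (𝟙 ⊟ ι (+ 8) ⊗ y)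
  φ⁴ = ≈-trans (≈-sym Nφ⊗Vφ) (≈-trans (⊗-cong N-φ ≈-refl)
    (solve 3 (λ a b c → a :* b :* c := c :* a :* b) ≈-refl (cube (V φ)) (𝟙 ⊟ ι (+ 8) ⊗ y) (V φ)))
    where
    F₁ = V f₁
    F₂ = V f₂
    Nφ⊗Nf₂ : N φ ⊗ N f₂ ≈ N f₁ ⊗ N f₁
    Nφ⊗Nf₂ = ≈-trans (≈-sym (N-⊗ φ f₂)) (≈-trans (N-cong φ-eta) (N-⊗ f₁ f₁))
    Vφ⊗F₂ : V φ ⊗ F₂ ≈ F₁ ⊗ F₁
    Vφ⊗F₂ = ≈-trans (≈-sym (V-⊗ φ f₂)) (≈-trans (V-cong φ-eta) (V-⊗ f₁ f₁))
    Nφ⊗Vφ : N φ ⊗ V φ ≈ φ ⊗ cube φ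
    Nφ⊗Vφ = ⊗-cancelˡ f₂ f₂-at-0 (⊗-cancelˡ f₂ f₂-at-0 (⊗-cancelˡ f₂ f₂-at-0 (⊗-cancelˡ f₂ f₂-at-0 (⊗-cancelˡ F₂ (trans (V-at-0 f₂) f₂-at-0) (begin
      F₂ ⊗ (f₂ ⊗ (f₂ ⊗ (f₂ ⊗ (f₂ ⊗ (N φ ⊗ V φ)))))
        ≈⟨ solve 4 (λ F f n v → F :* (f :* (f :* (f :* (f :* (n :* v))))) := n :* (f :* (f :* f :* f)) :* (v :* F)) ≈-refl F₂ f₂ (N φ) (V φ) ⟩
      N φ ⊗ (f₂ ⊗ cube f₂) ⊗ (V φ ⊗ F₂)
        ≈⟨ ⊗-cong (⊗-cong ≈-refl (≈-sym N-f₂)) Vφ⊗F₂ ⟩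
      N φ ⊗ (N f₂ ⊗ F₂) ⊗ (F₁ ⊗ F₁)
        ≈⟨ solve 4 (λ n k F f → n :* (k :* F) :* (f :* f) := n :* k :* F :* f :* f) ≈-refl (N φ) (N f₂) F₂ F₁ ⟩
      N φ ⊗ N f₂ ⊗ F₂ ⊗ F₁ ⊗ F₁
        ≈⟨ ⊗-cong (⊗-cong (⊗-cong Nφ⊗Nf₂ ≈-refl) ≈-refl) ≈-refl ⟩
      N f₁ ⊗ N f₁ ⊗ F₂ ⊗ F₁ ⊗ F₁
        ≈⟨ solve 3 (λ n F f → n :* n :* F :* f :* f := F :* (n :* f) :* (n :* f)) ≈-refl (N f₁) F₂ F₁ ⟩
      F₂ ⊗ (N f₁ ⊗ F₁) ⊗ (N f₁ ⊗ F₁)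
        ≈⟨ ⊗-cong (⊗-cong ≈-refl N-f₁) N-f₁ ⟩
      F₂ ⊗ (f₁ ⊗ cube f₁) ⊗ (f₁ ⊗ cube f₁)
        ≈⟨ solve 2 (λ F f → let g = f :* (f :* f :* f) ; h = f :* f in F :* g :* g := F :* (h :* (h :* h :* h))) ≈-refl F₂ f₁ ⟩
      F₂ ⊗ (f₁ ⊗ f₁ ⊗ cube (f₁ ⊗ f₁))
        ≈⟨ ⊗-cong ≈-refl (⊗-cong (≈-sym φ-eta) (⊗-cong (⊗-cong (≈-sym φ-eta) (≈-sym φ-eta)) (≈-sym φ-eta))) ⟩
      F₂ ⊗ (φ ⊗ f₂ ⊗ cube (φ ⊗ f₂))
        ≈⟨ solve 3 (λ F p f → let h = p :* f in F :* (h :* (h :* h :* h)) := F :* (f :* (f :* (f :* (f :* (p :* (p :* p :* p))))))) ≈-refl F₂ φ f₂ ⟩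
      F₂ ⊗ (f₂ ⊗ (f₂ ⊗ (f₂ ⊗ (f₂ ⊗ (φ ⊗ cube φ))))) ∎)))))
      where open ≈-Reasoning

  1-8x³ 1+2x+4x² : Series
  1-8x³ = 𝟙 ⊟ ι (+ 8) ⊗ cube x
  1+2x+4x² = 𝟙 ⊕ ι (+ 2) ⊗ x ⊕ ι (+ 4) ⊗ x ⊗ x

  -- Using `φ⁴` at q and at q³ gives φ⁴ = φ(-q⁹)⁴ (1 - 8x³) (1 - 8y), while φ = φ(-q⁹) m. Hence m⁴ =
  -- (1 - 8x³) (1 - 8y), and 1 - 8x³ = m (1 + 2x + 4x²) allows one m to be cancelled.
  m³ : cube m ≈ 1+2x+4x² ⊗ (𝟙 ⊟ ι (+ 8) ⊗ y)
  m³ = ⊗-cancelˡ m m₀≡1 (⊗-cancelˡ (V (V φ)) VVφ₀≡1 (⊗-cancelˡ (V (V φ)) VVφ₀≡1 (⊗-cancelˡ (V (V φ)) VVφ₀≡1 (⊗-cancelˡ (V (V φ)) VVφ₀≡1 (begin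
    p ⊗ (p ⊗ (p ⊗ (p ⊗ (m ⊗ cube m))))
      ≈⟨ solve 2 (λ p m → p :* (p :* (p :* (p :* (m :* (m :* m :* m))))) := let f = p :* m in f :* (f :* f :* f)) ≈-refl p m ⟩
    p ⊗ m ⊗ cube (p ⊗ m)
      ≈⟨ ⊗-cong φ-x (⊗-cong (⊗-cong φ-x φ-x) φ-x) ⟨
    φ ⊗ cube φ
      ≈⟨ φ⁴ ⟩
    V φ ⊗ cube (V φ) ⊗ (𝟙 ⊟ ι (+ 8) ⊗ y)
      ≈⟨ ⊗-cong Vφ⁴ ≈-refl ⟩
    p ⊗ cube p ⊗ 1-8x³ ⊗ (𝟙 ⊟ ι (+ 8) ⊗ y)
      ≈⟨ solve 3 (λ p x y → p :* (p :* p :* p) :* (one :- # 8 :* (x :* x :* x)) :* y :=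
           p :* (p :* (p :* (p :* ((one :- # 2 :* x) :* ((one :+ # 2 :* x :+ # 4 :* x :* x) :* y)))))) ≈-refl p x (𝟙 ⊟ ι (+ 8) ⊗ y) ⟩
    p ⊗ (p ⊗ (p ⊗ (p ⊗ (m ⊗ (1+2x+4x² ⊗ (𝟙 ⊟ ι (+ 8) ⊗ y)))))) ∎)))))
    where
    open ≈-Reasoning
    p = V (V φ)
    Vφ⁴ : V φ ⊗ cube (V φ) ≈ p ⊗ cube p ⊗ 1-8x³
    Vφ⁴ = begin
      V φ ⊗ cube (V φ)   ≈⟨ ≈-trans (V-⊗ φ (cube φ)) (⊗-cong ≈-refl (V-cube φ)) ⟨
      V (φ ⊗ cube φ)     ≈⟨ V-cong φ⁴ ⟩
      V (V φ ⊗ cube (V φ) ⊗ (𝟙 ⊟ ι (+ 8) ⊗ y))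
        ≈⟨ ≈-refl V⊗ V-cube (V φ) V⊗ ≈-trans (V-⊕ _ _) (⊕-cong V-𝟙 (V-neg′ (V-ι (+ 8) V⊗ Vy≈x³))) ⟩
      p ⊗ cube p ⊗ 1-8x³ ∎

  modularEquation : y ⊗ 1+2x+4x² ≈ x ⊗ (𝟙 ⊟ x ⊕ x ⊗ x)
  modularEquation = ι-cancel 8 (modulo
    (solve 2 (λ x y → # 8 :* (y :* (one :+ # 2 :* x :+ # 4 :* x :* x)) := # 8 :* (x :* (one :- x :+ x :* x)) :+
      (let m = one :- # 2 :* x in m :* m :* m :- (one :+ # 2 :* x :+ # 4 :* x :* x) :* (one :- # 8 :* y))) ≈-refl x y)
    (vanish m³))

  t⊗m : t ⊗ m ≈ x
  t⊗m = modulo (solve 3 (λ x i m → x :* i :* m := x :+ x :* (m :* i :- one)) ≈-refl x (1/ m) m) (_ ∙ vanish (⊗-inverseʳ m₀≡1))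

  Z-y : Z ⊗ (𝟙 ⊟ ι (+ 8) ⊗ y) ≈ y
  Z-y = modulo (solve 3 (λ x i m → x :* i :* m := x :+ x :* (m :* i :- one)) ≈-refl y (1/ (𝟙 ⊟ ι (+ 8) ⊗ y)) (𝟙 ⊟ ι (+ 8) ⊗ y)) (_ ∙ vanish (⊗-inverseʳ 1-8y₀≡1))

  ζ-x : V Z ⊗ 1-8x³ ≈ cube x
  ζ-x = ≈-trans (≈-sym (≈-refl V⊗ ≈-trans (V-⊕ _ _) (⊕-cong V-𝟙 (V-neg′ (V-ι (+ 8) V⊗ Vy≈x³))))) (≈-trans (V-cong Z-y) Vy≈x³)

  1-8x³₀≡1 : 1-8x³ 0 ≡ 1ℤ
  1-8x³₀≡1 = unit-at-0 x₀≡0 (neg (ι (+ 8)) ⊗ x ⊗ x) (solve 1 (λ x → one :- # 8 :* (x :* x :* x) := one :+ x :* ((:- # 8) :* x :* x)) ≈-refl x)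

-- Polynomial relations between t, Z and ζ

t-at-0 : t 0 ≡ 0ℤ
t-at-0 = ⊗-at-0-zero _ x₀≡0

Z-at-0 : Z 0 ≡ 0ℤ
Z-at-0 = ⊗-at-0-zero _ y₀≡0

-- This explains the choice of t: m³ Z = (1 + 2x + 4x²) y = x (1 - x + x²), which 1 = m + 2x makes
-- homogeneous of degree 3 in x and m, so that division by m³ leaves a polynomial in x/m.
Z-t : Z ≈ evalAt t (+ 0 ∷ + 1 ∷ + 3 ∷ + 3 ∷ [])
Z-t = ⊗-cancelˡ m m₀≡1 (⊗-cancelˡ m m₀≡1 (⊗-cancelˡ m m₀≡1 (begin
  m ⊗ (m ⊗ (m ⊗ Z))                   ≈⟨ solve 2 (λ m z → m :* (m :* (m :* z)) := m :* m :* m :* z) ≈-refl m Z ⟩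
  cube m ⊗ Z                          ≈⟨ ⊗-cong m³ ≈-refl ⟩
  1+2x+4x² ⊗ (𝟙 ⊟ ι (+ 8) ⊗ y) ⊗ Z    ≈⟨ solve 3 (λ a b c → a :* b :* c := a :* (c :* b)) ≈-refl 1+2x+4x² (𝟙 ⊟ ι (+ 8) ⊗ y) Z ⟩
  1+2x+4x² ⊗ (Z ⊗ (𝟙 ⊟ ι (+ 8) ⊗ y))  ≈⟨ ⊗-cong ≈-refl Z-y ⟩
  1+2x+4x² ⊗ y                        ≈⟨ ≈-trans (⊗-comm′ 1+2x+4x² y) modularEquation ⟩
  x ⊗ (𝟙 ⊟ x ⊕ x ⊗ x)                 ≈⟨ solve 1 (λ x → let m = one :- # 2 :* x in x :* (one :- x :+ x :* x) := x :* m :* m :+ # 3 :* x :* x :* m :+ # 3 :* x :* x :* x) ≈-refl x ⟩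
  x ⊗ m ⊗ m ⊕ ι (+ 3) ⊗ x ⊗ x ⊗ m ⊕ ι (+ 3) ⊗ x ⊗ x ⊗ x
    ≈⟨ modulo (solve 3 (λ x m t → let s = t :* m in
         x :* m :* m :+ # 3 :* x :* x :* m :+ # 3 :* x :* x :* x :=
         m :* (m :* (m :* poly t (+ 0 ∷ + 1 ∷ + 3 ∷ + 3 ∷ []))) :+
         (:- m :* m :- # 3 :* m :* (s :+ x) :- # 3 :* (s :* s :+ s :* x :+ x :* x)) :* (s :- x)) ≈-refl x m t) (_ ∙ vanish t⊗m) ⟩
  m ⊗ (m ⊗ (m ⊗ evalAt t (+ 0 ∷ + 1 ∷ + 3 ∷ + 3 ∷ []))) ∎)))
  where open ≈-Reasoning

-- From x = t/(1 + 2t) one gets 1 - 8x³ = (1 + 6t + 12t²)/(1 + 2t)³, and ζ = x³/(1 - 8x³).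
t-cubic : t ⊗ t ⊗ t ≈ V Z ⊗ evalAt t (+ 1 ∷ + 6 ∷ + 12 ∷ [])
t-cubic = ⊗-cancelˡ (cube m ⊗ 1-8x³) m³₀≡1 (modulo
  (solve 3 (λ x t ζ → let m = one :- # 2 :* x ; d = one :- # 8 :* (x :* x :* x) ; s = t :* m in
    m :* m :* m :* d :* (t :* t :* t) := m :* m :* m :* d :* (ζ :* poly t (+ 1 ∷ + 6 ∷ + 12 ∷ [])) :+
    (d :* (s :* s :+ s :* x :+ x :* x) :* (s :- x)
     :+ (:- ζ) :* d :* (# 6 :* m :* m :+ # 12 :* m :* (s :+ x)) :* (s :- x)
     :+ (:- d) :* (ζ :* d :- x :* x :* x))) ≈-refl x t (V Z))
  (_ ∙ vanish t⊗m ∔ _ ∙ vanish t⊗m ∔ _ ∙ vanish ζ-x))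
  where
  m³₀≡1 : (cube m ⊗ 1-8x³) 0 ≡ 1ℤ
  m³₀≡1 = trans (⊗-at-0 _ _) (cong₂ ℤ._*_ (trans (⊗-at-0 _ _) (cong₂ ℤ._*_ (trans (⊗-at-0 _ _) (cong₂ ℤ._*_ m₀≡1 m₀≡1)) m₀≡1)) 1-8x³₀≡1)

-- The characteristic equation of multiplication by Z on the basis 1, t, t² over ℤ[ζ].
Z-cubic : cube Z ≈
  evalAt (V Z) (+ 0 ∷ + 57 ∷ + 1080 ∷ + 5184 ∷ []) ⊗ (Z ⊗ Z)
  ⊕ evalAt (V Z) (+ 0 ∷ + 15 ∷ + 279 ∷ + 1296 ∷ []) ⊗ Z
  ⊕ evalAt (V Z) (+ 0 ∷ + 1 ∷ + 18 ∷ + 81 ∷ [])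
Z-cubic = ≈-trans (⊗-cong (⊗-cong Z-t Z-t) Z-t) (≈-trans (modulo
  (solve 2 (λ t ζ → let z = poly t (+ 0 ∷ + 1 ∷ + 3 ∷ + 3 ∷ []) in
    z :* z :* z := (poly ζ (+ 0 ∷ + 57 ∷ + 1080 ∷ + 5184 ∷ []) :* (z :* z) :+ poly ζ (+ 0 ∷ + 15 ∷ + 279 ∷ + 1296 ∷ []) :* z
      :+ poly ζ (+ 0 ∷ + 1 ∷ + 18 ∷ + 81 ∷ [])) :+
    -- The cofactor is the quotient of the difference by the cubic relation of t, from polynomial
    -- division in t over ℤ[ζ].
    (poly ζ (+ 1 ∷ + 18 ∷ + 81 ∷ []) :+ t :* (poly ζ (+ 9 ∷ + 171 ∷ + 810 ∷ []) :+ t :* (poly ζ (+ 36 ∷ + 675 ∷ + 3240 ∷ []) :+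
     t :* (poly ζ (+ 81 ∷ + 1296 ∷ + 5832 ∷ []) :+ t :* (poly ζ (+ 108 ∷ + 1134 ∷ + 3888 ∷ []) :+ t :* (poly ζ (+ 81 ∷ + 324 ∷ []) :+ t :* # 27))))))
    :* (t :* t :* t :- ζ :* poly t (+ 1 ∷ + 6 ∷ + 12 ∷ []))) ≈-refl t (V Z))
  (_ ∙ vanish t-cubic))
  (⊕-cong (⊕-cong (⊗-cong ≈-refl (⊗-cong (≈-sym Z-t) (≈-sym Z-t))) (⊗-cong ≈-refl (≈-sym Z-t))) ≈-refl))

private
  Z-y′ : (𝟙 ⊕ ι (+ 8) ⊗ Z) ⊗ y ≈ Z
  Z-y′ = modulo (solve 2 (λ z y → (one :+ # 8 :* z) :* y := z :+ (y :- z :* (one :- # 8 :* y))) ≈-refl Z y) (vanish (≈-sym Z-y))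

  ζ-x′ : (𝟙 ⊕ ι (+ 8) ⊗ V Z) ⊗ 1-8x³ ≈ 𝟙
  ζ-x′ = modulo (solve 2 (λ z x → (one :+ # 8 :* z) :* (one :- # 8 :* (x :* x :* x)) := one :+ # 8 :* (z :* (one :- # 8 :* (x :* x :* x)) :- x :* x :* x)) ≈-refl (V Z) x)
    (_ ∙ vanish ζ-x)

  V-1+8Z : V (𝟙 ⊕ ι (+ 8) ⊗ Z) ≈ 𝟙 ⊕ ι (+ 8) ⊗ V Z
  V-1+8Z = ≈-trans (V-⊕ _ _) (⊕-cong V-𝟙 (V-ι (+ 8) V⊗ ≈-refl))

  -- The denominator is made a series in q³: 1/m = (1 + 2x + 4x²)/(1 - 8x³) and 1/(1 - 8x³) = 1 +
  -- 8ζ. The rest is a polynomial in x = q w(q³), and the degree in x sorts its terms by the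
  -- exponent of q modulo 3.
  t-x : t ≈ (𝟙 ⊕ ι (+ 8) ⊗ V Z) ⊗ (x ⊗ 1+2x+4x²)
  t-x = ⊗-cancelˡ m m₀≡1 (modulo
    (solve 3 (λ x t z → let m = one :- # 2 :* x ; e = one :+ # 8 :* z ; d = one :- # 8 :* (x :* x :* x) in
      m :* t := m :* (e :* (x :* (one :+ # 2 :* x :+ # 4 :* x :* x))) :+ ((t :* m :- x) :+ x :* (one :- e :* d))) ≈-refl x t (V Z))
    (vanish t⊗m ∔ x ∙ vanish (≈-sym ζ-x′)))

U₀-t : U₀ t ≈ ι (+ 4) ⊗ Z
U₀-t = begin
  U₀ t                                            ≈⟨ U₀-cong (≈-trans t-x (⊗-cong (≈-sym V-1+8Z) split)) ⟩
  U₀ (V (𝟙 ⊕ ι (+ 8) ⊗ Z) ⊗ assemble (ι (+ 4) ⊗ y) w (ι (+ 2) ⊗ (w ⊗ w))) ≈⟨ U₀-V⊗ _ _ ⟩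
  (𝟙 ⊕ ι (+ 8) ⊗ Z) ⊗ U₀ (assemble (ι (+ 4) ⊗ y) w (ι (+ 2) ⊗ (w ⊗ w)))   ≈⟨ ⊗-cong ≈-refl (assemble-at₀ _ _ _) ⟩
  (𝟙 ⊕ ι (+ 8) ⊗ Z) ⊗ (ι (+ 4) ⊗ y)              ≈⟨ solve 2 (λ e y → e :* (# 4 :* y) := # 4 :* (e :* y)) ≈-refl (𝟙 ⊕ ι (+ 8) ⊗ Z) y ⟩
  ι (+ 4) ⊗ ((𝟙 ⊕ ι (+ 8) ⊗ Z) ⊗ y)              ≈⟨ ⊗-cong ≈-refl Z-y′ ⟩
  ι (+ 4) ⊗ Z ∎
  where
  open ≈-Reasoning
  split : x ⊗ 1+2x+4x² ≈ assemble (ι (+ 4) ⊗ y) w (ι (+ 2) ⊗ (w ⊗ w))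
  split = ≈-trans
    (solve 2 (λ q w → let x = q :* w in x :* (one :+ # 2 :* x :+ # 4 :* x :* x) := # 4 :* (x :* x :* x) :+ q :* w :+ q :* q :* (# 2 :* (w :* w))) ≈-refl X (V w))
    (≈-sym (⊕-cong (⊕-cong (V-ι (+ 4) V⊗ Vy≈x³) ≈-refl) (⊗-cong ≈-refl (V-ι (+ 2) V⊗ V-⊗ w w))))

U₀-t² : U₀ (t ⊗ t) ≈ ι (+ 4) ⊗ Z ⊕ ι (+ 48) ⊗ Z ⊗ Z
U₀-t² = begin
  U₀ (t ⊗ t)              ≈⟨ U₀-cong (≈-trans (⊗-cong t-x t-x) (≈-trans
                               (solve 2 (λ e p → e :* p :* (e :* p) := e :* e :* (p :* p)) ≈-refl (𝟙 ⊕ ι (+ 8) ⊗ V Z) (x ⊗ 1+2x+4x²))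
                               (⊗-cong (≈-sym (V-1+8Z V⊗ V-1+8Z)) split))) ⟩
  U₀ (V (e ⊗ e) ⊗ assemble a b c)        ≈⟨ U₀-V⊗ _ _ ⟩
  e ⊗ e ⊗ U₀ (assemble a b c)            ≈⟨ ⊗-cong ≈-refl (assemble-at₀ _ _ _) ⟩
  e ⊗ e ⊗ a                              ≈⟨ solve 2 (λ e y → e :* e :* (# 4 :* y :+ # 16 :* (y :* y)) := # 4 :* e :* (e :* y) :+ # 16 :* (e :* y) :* (e :* y)) ≈-refl e y ⟩
  ι (+ 4) ⊗ e ⊗ (e ⊗ y) ⊕ ι (+ 16) ⊗ (e ⊗ y) ⊗ (e ⊗ y) ≈⟨ ⊕-cong (⊗-cong ≈-refl Z-y′) (⊗-cong (⊗-cong ≈-refl Z-y′) Z-y′) ⟩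
  ι (+ 4) ⊗ e ⊗ Z ⊕ ι (+ 16) ⊗ Z ⊗ Z     ≈⟨ solve 1 (λ z → # 4 :* (one :+ # 8 :* z) :* z :+ # 16 :* z :* z := # 4 :* z :+ # 48 :* z :* z) ≈-refl Z ⟩
  ι (+ 4) ⊗ Z ⊕ ι (+ 48) ⊗ Z ⊗ Z         ∎
  where
  open ≈-Reasoning
  e = 𝟙 ⊕ ι (+ 8) ⊗ Z
  a = ι (+ 4) ⊗ y ⊕ ι (+ 16) ⊗ (y ⊗ y)
  b = ι (+ 12) ⊗ (w ⊗ y)
  c = w ⊗ w ⊕ ι (+ 16) ⊗ (w ⊗ w ⊗ y)
  split : x ⊗ 1+2x+4x² ⊗ (x ⊗ 1+2x+4x²) ≈ assemble a b c
  split = ≈-trans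
    (solve 2 (λ q w → let x = q :* w ; y = x :* x :* x ; p = x :* (one :+ # 2 :* x :+ # 4 :* x :* x) in
      p :* p := (# 4 :* y :+ # 16 :* (y :* y)) :+ q :* (# 12 :* (w :* y)) :+ q :* q :* (w :* w :+ # 16 :* (w :* w :* y))) ≈-refl X (V w))
    (≈-sym (⊕-cong (⊕-cong
      (≈-trans (V-⊕ _ _) (⊕-cong (V-ι (+ 4) V⊗ Vy≈x³) (V-ι (+ 16) V⊗ (Vy≈x³ V⊗ Vy≈x³))))
      (⊗-cong ≈-refl (V-ι (+ 12) V⊗ (≈-refl V⊗ Vy≈x³))))
      (⊗-cong ≈-refl (≈-trans (V-⊕ _ _) (⊕-cong (V-⊗ w w) (V-ι (+ 16) V⊗ (V-⊗ w w V⊗ Vy≈x³)))))))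

-- The generating function of d₂ in terms of t

private
  d₂-φ-ψ₂ : d₂ ⊗ (φ ⊗ cube φ) ⊗ ψ₂ ≈ ι (+ 2)
  d₂-φ-ψ₂ = ⊗-cancelˡ (f₂ ⊗ f₂ ⊗ (f₂ ⊗ f₂) ⊗ (f₁ ⊗ (f₁ ⊗ cube f₁ ⊗ cube f₁))) unit (begin
    f₂ ⊗ f₂ ⊗ (f₂ ⊗ f₂) ⊗ (f₁ ⊗ f₁⁷) ⊗ (d₂ ⊗ (φ ⊗ cube φ) ⊗ ψ₂)
      ≈⟨ solve 6 (λ f g h d p r → f :* f :* (f :* f) :* (g :* h) :* (d :* (p :* (p :* p :* p)) :* r) := let k = p :* f in d :* h :* (k :* k :* (k :* k)) :* (r :* g)) ≈-refl f₂ f₁ f₁⁷ d₂ φ ψ₂ ⟩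
    d₂ ⊗ f₁⁷ ⊗ (φ ⊗ f₂ ⊗ (φ ⊗ f₂) ⊗ (φ ⊗ f₂ ⊗ (φ ⊗ f₂))) ⊗ (ψ₂ ⊗ f₁)
      ≈⟨ ⊗-cong (⊗-cong d₂-eta (⊗-cong (⊗-cong φ-eta φ-eta) (⊗-cong φ-eta φ-eta))) ψ₂-eta ⟩
    f₂ ⊗ f₂ ⊗ (f₁ ⊗ f₁ ⊗ (f₁ ⊗ f₁) ⊗ (f₁ ⊗ f₁ ⊗ (f₁ ⊗ f₁))) ⊗ (ι (+ 2) ⊗ (f₂ ⊗ f₂))
      ≈⟨ solve 2 (λ f g → let h = g :* g ; k = g :* g :* g in f :* f :* (h :* h :* (h :* h)) :* (# 2 :* (f :* f)) := f :* f :* (f :* f) :* (g :* (g :* k :* k)) :* # 2) ≈-refl f₂ f₁ ⟩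
    f₂ ⊗ f₂ ⊗ (f₂ ⊗ f₂) ⊗ (f₁ ⊗ f₁⁷) ⊗ ι (+ 2) ∎)
    where
    open ≈-Reasoning
    f₁⁷ = f₁ ⊗ cube f₁ ⊗ cube f₁
    _·_ : ∀ {f g} → f 0 ≡ 1ℤ → g 0 ≡ 1ℤ → (f ⊗ g) 0 ≡ 1ℤ
    p · q = trans (⊗-at-0 _ _) (cong₂ ℤ._*_ p q)
    cube₀ : cube f₁ 0 ≡ 1ℤ
    cube₀ = (f₁-at-0 · f₁-at-0) · f₁-at-0
    unit : (f₂ ⊗ f₂ ⊗ (f₂ ⊗ f₂) ⊗ (f₁ ⊗ f₁⁷)) 0 ≡ 1ℤ
    unit = ((f₂-at-0 · f₂-at-0) · (f₂-at-0 · f₂-at-0)) · (f₁-at-0 · ((f₁-at-0 · cube₀) · cube₀))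

  t⊗ψ₂ : t ⊗ ψ₂ ≈ X ⊗ V (V ψ₂) ⊗ (𝟙 ⊕ ι (+ 3) ⊗ t)
  t⊗ψ₂ = ⊗-cancelˡ m m₀≡1 (modulo
    (solve 5 (λ x t q r s → let m = one :- # 2 :* x in
      m :* (t :* r) := m :* (q :* s :* (one :+ # 3 :* t)) :+
      (r :* (t :* m :- x) :+ (x :* r :- q :* s :* (one :+ x)) :+ # 3 :* q :* s :* (x :- t :* m))) ≈-refl x t X ψ₂ (V (V ψ₂)))
    (_ ∙ vanish t⊗m ∔ vanish ψ₂-x ∔ _ ∙ vanish (≈-sym t⊗m)))

  fourth : Series → Series
  fourth f = f ⊗ cube f

  1+2t : Series
  1+2t = 𝟙 ⊕ ι (+ 2) ⊗ t

  -- In q d₂ = 2q/(φ⁴ ψ₂) one substitutes φ = φ(-q⁹) m, 1/m = 1 + 2t and t ψ₂ = q ψ₂(q⁹) (1 + 3t).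
  X⊗d₂-t : (𝟙 ⊕ ι (+ 3) ⊗ t) ⊗ (X ⊗ d₂) ≈ V (V d₂) ⊗ (t ⊗ fourth 1+2t)
  X⊗d₂-t = ι-cancel 2 (begin
    ι (+ 2) ⊗ (e ⊗ (X ⊗ d₂))
      ≈⟨ solve 4 (λ a e x d → a :* (e :* (x :* d)) := d :* (a :* x :* e)) ≈-refl (ι (+ 2)) e X d₂ ⟩
    d₂ ⊗ (ι (+ 2) ⊗ X ⊗ e)
      ≈⟨ ⊗-cong ≈-refl (⊗-cong (⊗-cong (≈-sym VV-d₂-φ-ψ₂) ≈-refl) ≈-refl) ⟩
    d₂ ⊗ (D ⊗ fourth p ⊗ V (V ψ₂) ⊗ X ⊗ e)
      ≈⟨ solve 6 (λ d D p r x e → let f = p :* (p :* p :* p) in d :* (D :* f :* r :* x :* e) := d :* (D :* f :* (x :* r :* e))) ≈-refl d₂ D p (V (V ψ₂)) X e ⟩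
    d₂ ⊗ (D ⊗ fourth p ⊗ (X ⊗ V (V ψ₂) ⊗ e))
      ≈⟨ ⊗-cong ≈-refl (⊗-cong ≈-refl (≈-sym t⊗ψ₂)) ⟩
    d₂ ⊗ (D ⊗ fourth p ⊗ (t ⊗ ψ₂))
      ≈⟨ solve 6 (λ d D p m t r → let f⁴ = λ f → f :* (f :* f :* f) in d :* (D :* f⁴ p :* (t :* r)) := d :* (D :* f⁴ p :* (t :* r) :* f⁴ one)) ≈-refl d₂ D p m t ψ₂ ⟩
    d₂ ⊗ (D ⊗ fourth p ⊗ (t ⊗ ψ₂) ⊗ fourth 𝟙)
      ≈⟨ ⊗-cong ≈-refl (⊗-cong ≈-refl (⊗-cong (≈-sym um) (⊗-cong (⊗-cong (≈-sym um) (≈-sym um)) (≈-sym um)))) ⟩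
    d₂ ⊗ (D ⊗ fourth p ⊗ (t ⊗ ψ₂) ⊗ fourth (1+2t ⊗ m))
      ≈⟨ solve 7 (λ d D p m t r u → let f⁴ = λ f → f :* (f :* f :* f) in
           d :* (D :* f⁴ p :* (t :* r) :* f⁴ (u :* m)) := d :* f⁴ (p :* m) :* r :* (D :* (t :* f⁴ u))) ≈-refl d₂ D p m t ψ₂ 1+2t ⟩
    d₂ ⊗ fourth (p ⊗ m) ⊗ ψ₂ ⊗ (D ⊗ (t ⊗ fourth 1+2t))
      ≈⟨ ⊗-cong (⊗-cong (⊗-cong ≈-refl (⊗-cong φ-x (⊗-cong (⊗-cong φ-x φ-x) φ-x))) ≈-refl) ≈-refl ⟨
    d₂ ⊗ fourth φ ⊗ ψ₂ ⊗ (D ⊗ (t ⊗ fourth 1+2t))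
      ≈⟨ ⊗-cong d₂-φ-ψ₂ ≈-refl ⟩
    ι (+ 2) ⊗ (D ⊗ (t ⊗ fourth 1+2t)) ∎)
    where
    open ≈-Reasoning
    D = V (V d₂)
    p = V (V φ)
    e = 𝟙 ⊕ ι (+ 3) ⊗ t
    um : 1+2t ⊗ m ≈ 𝟙
    um = modulo (solve 2 (λ t x → (one :+ # 2 :* t) :* (one :- # 2 :* x) := one :+ # 2 :* (t :* (one :- # 2 :* x) :- x)) ≈-refl t x) (_ ∙ vanish t⊗m)
    V-d₂-φ-ψ₂ : V d₂ ⊗ fourth (V φ) ⊗ V ψ₂ ≈ ι (+ 2)
    V-d₂-φ-ψ₂ = ≈-trans (≈-sym (≈-refl V⊗ (≈-refl V⊗ V-cube φ) V⊗ ≈-refl)) (≈-trans (V-cong d₂-φ-ψ₂) (V-ι (+ 2)))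
    VV-d₂-φ-ψ₂ : D ⊗ fourth p ⊗ V (V ψ₂) ≈ ι (+ 2)
    VV-d₂-φ-ψ₂ = ≈-trans (≈-sym (≈-refl V⊗ (≈-refl V⊗ V-cube (V φ)) V⊗ ≈-refl))
      (≈-trans (V-cong V-d₂-φ-ψ₂) (V-ι (+ 2)))

-- t (1 + 2t) (1 + 3t + 3t²)
kernel : List ℤ
kernel = + 0 ∷ + 1 ∷ + 5 ∷ + 9 ∷ + 6 ∷ []

-- With c = 1 + 6t + 12t² the relation t³ = ζ c gives c (1 + 8ζ) = (1 + 2t)³ and c (1 + 9ζ) = (1 +
-- 3t) (1 + 3t + 3t²). The denominator 1 + 3t is thus traded for 1 + 9ζ, a series in q³ that passes
-- through `U₀`.
X⊗d₂-kernel : (𝟙 ⊕ ι (+ 9) ⊗ V Z) ⊗ (X ⊗ d₂) ≈ V (V d₂) ⊗ (𝟙 ⊕ ι (+ 8) ⊗ V Z) ⊗ evalAt t kernel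
X⊗d₂-kernel = ⊗-cancelˡ (evalAt t (+ 1 ∷ + 6 ∷ + 12 ∷ []))
  (unit-at-0 t-at-0 _ (⊕-cong ι-1 ≈-refl))
  (modulo
    (solve 4 (λ t ζ Y D → let c = poly t (+ 1 ∷ + 6 ∷ + 12 ∷ []) ; k = poly t (+ 0 ∷ + 1 ∷ + 5 ∷ + 9 ∷ + 6 ∷ []) ; u = one :+ # 2 :* t in
      c :* ((one :+ # 9 :* ζ) :* Y) := c :* (D :* (one :+ # 8 :* ζ) :* k) :+
      ((:- # 9 :* Y :+ # 8 :* D :* k) :* (t :* t :* t :- ζ :* c)
       :+ (one :+ # 3 :* t :+ # 3 :* t :* t) :* ((one :+ # 3 :* t) :* Y :- D :* (t :* (u :* (u :* u :* u))))))
      ≈-refl t (V Z) (X ⊗ d₂) (V (V d₂)))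
    (_ ∙ vanish t-cubic ∔ _ ∙ vanish X⊗d₂-t))

1+8Z 1+9Z : Series
1+8Z = 𝟙 ⊕ ι (+ 8) ⊗ Z
1+9Z = 𝟙 ⊕ ι (+ 9) ⊗ Z

1+9Z-at-0 : 1+9Z 0 ≡ 1ℤ
1+9Z-at-0 = unit-at-0 Z-at-0 (ι (+ 9)) (solve 1 (λ z → one :+ # 9 :* z := one :+ z :* # 9) ≈-refl Z)

-- The step from residues modulo 3^2a to residues modulo 3^(2a+1); the step from
-- there to 3^(2a+2) is U₀ itself.
oddStep : Series → Series
oddStep F = 1+8Z ⊗ (1/ 1+9Z ⊗ U₀ (evalAt t kernel ⊗ F))

U₀-X⊗d₂ : ∀ F → U₀ (X ⊗ (d₂ ⊗ F)) ≈ V d₂ ⊗ oddStep F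
U₀-X⊗d₂ F = ⊗-cancelˡ 1+9Z 1+9Z-at-0 (begin
  1+9Z ⊗ U₀ (X ⊗ (d₂ ⊗ F))       ≈⟨ U₀-V⊗ 1+9Z (X ⊗ (d₂ ⊗ F)) ⟨
  U₀ (V 1+9Z ⊗ (X ⊗ (d₂ ⊗ F)))   ≈⟨ U₀-cong (begin
    V 1+9Z ⊗ (X ⊗ (d₂ ⊗ F))                    ≈⟨ ⊗-cong (≈-trans (V-⊕ _ _) (⊕-cong V-𝟙 (V-ι (+ 9) V⊗ ≈-refl))) ≈-refl ⟩
    (𝟙 ⊕ ι (+ 9) ⊗ V Z) ⊗ (X ⊗ (d₂ ⊗ F))       ≈⟨ solve 4 (λ a x d f → a :* (x :* (d :* f)) := a :* (x :* d) :* f) ≈-refl (𝟙 ⊕ ι (+ 9) ⊗ V Z) X d₂ F ⟩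
    (𝟙 ⊕ ι (+ 9) ⊗ V Z) ⊗ (X ⊗ d₂) ⊗ F         ≈⟨ ⊗-cong X⊗d₂-kernel ≈-refl ⟩
    V (V d₂) ⊗ (𝟙 ⊕ ι (+ 8) ⊗ V Z) ⊗ k ⊗ F     ≈⟨ CommutativeRing.*-assoc series _ k F ⟩
    V (V d₂) ⊗ (𝟙 ⊕ ι (+ 8) ⊗ V Z) ⊗ (k ⊗ F)   ≈⟨ ⊗-cong (≈-refl V⊗ V-1+8Z) ≈-refl ⟨
    V (V d₂ ⊗ 1+8Z) ⊗ (k ⊗ F) ∎) ⟩
  U₀ (V (V d₂ ⊗ 1+8Z) ⊗ (k ⊗ F)) ≈⟨ U₀-V⊗ (V d₂ ⊗ 1+8Z) (k ⊗ F) ⟩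
  V d₂ ⊗ 1+8Z ⊗ U₀ (k ⊗ F)
    ≈⟨ modulo (solve 5 (λ d e n i u → d :* e :* u := n :* (d :* (e :* (i :* u))) :+ d :* e :* u :* (one :- n :* i)) ≈-refl
         (V d₂) 1+8Z 1+9Z (1/ 1+9Z) (U₀ (k ⊗ F))) (_ ∙ vanish (≈-sym (⊗-inverseʳ 1+9Z-at-0))) ⟩
  1+9Z ⊗ (V d₂ ⊗ oddStep F) ∎)
  where
  open ≈-Reasoning
  k = evalAt t kernel

-- Lattices of polynomials in Z

infixl 6 _+ₗ_
infixl 7 _*ₗ_ _·ₗ_

_+ₗ_ : List ℤ → List ℤ → List ℤ
[]       +ₗ bs       = bs
(a ∷ as) +ₗ []       = a ∷ as
(a ∷ as) +ₗ (b ∷ bs) = a ℤ.+ b ∷ (as +ₗ bs)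

_·ₗ_ : ℤ → List ℤ → List ℤ
c ·ₗ as = map (c ℤ.*_) as

_*ₗ_ : List ℤ → List ℤ → List ℤ
[]       *ₗ bs = []
(a ∷ as) *ₗ bs = a ·ₗ bs +ₗ (0ℤ ∷ as *ₗ bs)

_^ₗ_ : List ℤ → ℕ → List ℤ
as ^ₗ zero  = 1ℤ ∷ []
as ^ₗ suc n = as *ₗ (as ^ₗ n)

module _ (z : Series) where

  evalAt-+ : ∀ as bs → evalAt z (as +ₗ bs) ≈ evalAt z as ⊕ evalAt z bs
  evalAt-+ []       bs       = solve 1 (λ b → b := con 0ℤ :+ b) ≈-refl (evalAt z bs)
  evalAt-+ (a ∷ as) []       = solve 1 (λ a → a := a :+ con 0ℤ) ≈-refl (evalAt z (a ∷ as))
  evalAt-+ (a ∷ as) (b ∷ bs) = ≈-trans (⊕-cong (ι-+ a b) (⊗-cong ≈-refl (evalAt-+ as bs)))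
    (solve 5 (λ a b z f g → a :+ b :+ z :* (f :+ g) := a :+ z :* f :+ (b :+ z :* g)) ≈-refl (ι a) (ι b) z (evalAt z as) (evalAt z bs))

  evalAt-· : ∀ c as → evalAt z (c ·ₗ as) ≈ ι c ⊗ evalAt z as
  evalAt-· c []       = solve 1 (λ c → con 0ℤ := c :* con 0ℤ) ≈-refl (ι c)
  evalAt-· c (a ∷ as) = ≈-trans (⊕-cong (ι-* c a) (⊗-cong ≈-refl (evalAt-· c as)))
    (solve 4 (λ c a z f → c :* a :+ z :* (c :* f) := c :* (a :+ z :* f)) ≈-refl (ι c) (ι a) z (evalAt z as))

  evalAt-* : ∀ as bs → evalAt z (as *ₗ bs) ≈ evalAt z as ⊗ evalAt z bs
  evalAt-* []       bs = solve 1 (λ b → con 0ℤ := con 0ℤ :* b) ≈-refl (evalAt z bs)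
  evalAt-* (a ∷ as) bs = ≈-trans (evalAt-+ (a ·ₗ bs) (0ℤ ∷ as *ₗ bs)) (≈-trans
    (⊕-cong (evalAt-· a bs) (⊕-cong ≈-refl (⊗-cong ≈-refl (evalAt-* as bs))))
    (solve 4 (λ a z f b → a :* b :+ (con 0ℤ :+ z :* (f :* b)) := (a :+ z :* f) :* b) ≈-refl (ι a) z (evalAt z as) (evalAt z bs)))

  evalAt-^ : ∀ as n → evalAt z (as ^ₗ n) ≈ evalAt z as ↑ n
  evalAt-^ as zero    = ≈-trans (⊕-cong ι-1 ≈-refl) (solve 1 (λ z → one :+ z :* con 0ℤ := one) ≈-refl z)
  evalAt-^ as (suc n) = ≈-trans (evalAt-* as (as ^ₗ n)) (≈-trans (⊗-cong ≈-refl (evalAt-^ as n)) (≈-sym (↑-suc (evalAt z as) n)))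

-- Extraction from polynomials in t

U₀-ι⊗ : ∀ c f → U₀ (ι c ⊗ f) ≈ ι c ⊗ U₀ f
U₀-ι⊗ c f = ≈-trans (U₀-cong (⊗-cong (≈-sym (V-ι c)) ≈-refl)) (U₀-V⊗ (ι c) f)

-- If a, b, c represent U₀ g, U₀ (t g), U₀ (t² g) as polynomials in Z, then
-- moments p a b c represents U₀ (p(t) g).
moments : List ℤ → List ℤ → List ℤ → List ℤ → List ℤ
moments []       a b c = []
moments (p ∷ ps) a b c = p ·ₗ a +ₗ moments ps b c (0ℤ ∷ a +ₗ + 6 ·ₗ b +ₗ + 12 ·ₗ c)

-- Replacing g by t g shifts the three moments; the new one, that of t³ g, follows from `t-cubic`.
U₀-moments : ∀ ps g a b c → U₀ g ≈ evalAt Z a → U₀ (t ⊗ g) ≈ evalAt Z b → U₀ (t ⊗ t ⊗ g) ≈ evalAt Z c →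
             U₀ (evalAt t ps ⊗ g) ≈ evalAt Z (moments ps a b c)
U₀-moments []       g a b c A B C = ≈-trans (U₀-ι⊗ 0ℤ g) (solve 1 (λ u → con 0ℤ :* u := con 0ℤ) ≈-refl (U₀ g))
U₀-moments (p ∷ ps) g a b c A B C = begin
  U₀ ((ι p ⊕ t ⊗ evalAt t ps) ⊗ g)
    ≈⟨ U₀-cong (solve 4 (λ p t e g → (p :+ t :* e) :* g := p :* g :+ e :* (t :* g)) ≈-refl (ι p) t (evalAt t ps) g) ⟩
  U₀ (ι p ⊗ g ⊕ evalAt t ps ⊗ (t ⊗ g))
    ≈⟨ U₀-⊕ _ _ ⟩
  U₀ (ι p ⊗ g) ⊕ U₀ (evalAt t ps ⊗ (t ⊗ g))
    ≈⟨ ⊕-cong (≈-trans (U₀-ι⊗ p g) (⊗-cong ≈-refl A)) (U₀-moments ps (t ⊗ g) b c d B (≈-trans (U₀-cong (≈-sym (CommutativeRing.*-assoc series t t g))) C) D) ⟩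
  ι p ⊗ evalAt Z a ⊕ evalAt Z (moments ps b c d)
    ≈⟨ ≈-trans (evalAt-+ Z (p ·ₗ a) (moments ps b c d)) (⊕-cong (evalAt-· Z p a) ≈-refl) ⟨
  evalAt Z (moments (p ∷ ps) a b c) ∎
  where
  open ≈-Reasoning
  d = 0ℤ ∷ a +ₗ + 6 ·ₗ b +ₗ + 12 ·ₗ c
  D : U₀ (t ⊗ t ⊗ (t ⊗ g)) ≈ evalAt Z d
  D = begin
    U₀ (t ⊗ t ⊗ (t ⊗ g))
      ≈⟨ U₀-cong (modulo (solve 3 (λ t g ζ → t :* t :* (t :* g) := ζ :* (g :+ # 6 :* (t :* g) :+ # 12 :* (t :* t :* g)) :+
           g :* (t :* t :* t :- ζ :* poly t (+ 1 ∷ + 6 ∷ + 12 ∷ []))) ≈-refl t g (V Z)) (g ∙ vanish t-cubic)) ⟩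
    U₀ (V Z ⊗ (g ⊕ ι (+ 6) ⊗ (t ⊗ g) ⊕ ι (+ 12) ⊗ (t ⊗ t ⊗ g)))
      ≈⟨ U₀-V⊗ Z _ ⟩
    Z ⊗ U₀ (g ⊕ ι (+ 6) ⊗ (t ⊗ g) ⊕ ι (+ 12) ⊗ (t ⊗ t ⊗ g))
      ≈⟨ ⊗-cong ≈-refl (≈-trans (U₀-⊕ _ _) (⊕-cong (≈-trans (U₀-⊕ _ _)
           (⊕-cong A (≈-trans (U₀-ι⊗ _ _) (⊗-cong ≈-refl B)))) (≈-trans (U₀-ι⊗ _ _) (⊗-cong ≈-refl C)))) ⟩
    Z ⊗ (evalAt Z a ⊕ ι (+ 6) ⊗ evalAt Z b ⊕ ι (+ 12) ⊗ evalAt Z c)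
      ≈⟨ ⊗-cong ≈-refl (≈-trans (evalAt-+ Z (a +ₗ + 6 ·ₗ b) (+ 12 ·ₗ c)) (⊕-cong (≈-trans (evalAt-+ Z a (+ 6 ·ₗ b))
           (⊕-cong ≈-refl (evalAt-· Z (+ 6) b))) (evalAt-· Z (+ 12) c))) ⟨
    Z ⊗ evalAt Z (a +ₗ + 6 ·ₗ b +ₗ + 12 ·ₗ c)
      ≈⟨ solve 1 (λ e → e := con 0ℤ :+ e) ≈-refl _ ⟩
    evalAt Z d ∎

U₀-polynomial : ∀ ps → U₀ (evalAt t ps) ≈ evalAt Z (moments ps (+ 1 ∷ []) (+ 0 ∷ + 4 ∷ []) (+ 0 ∷ + 4 ∷ + 48 ∷ []))
U₀-polynomial ps = ≈-trans (U₀-cong (≈-sym (CommutativeRing.*-identityʳ series (evalAt t ps))))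
  (U₀-moments ps 𝟙 _ _ _
    (≈-trans (U₀-cong (≈-sym V-𝟙)) (≈-trans (U₀-V 𝟙) (≈-trans (≈-sym ι-1) (solve 1 (λ z → # 1 := # 1 :+ z :* con 0ℤ) ≈-refl Z))))
    (≈-trans (U₀-cong (CommutativeRing.*-identityʳ series t)) (≈-trans U₀-t (solve 1 (λ z → # 4 :* z := poly z (+ 0 ∷ + 4 ∷ [])) ≈-refl Z)))
    (≈-trans (U₀-cong (CommutativeRing.*-identityʳ series (t ⊗ t))) (≈-trans U₀-t²
      (solve 1 (λ z → # 4 :* z :+ # 48 :* z :* z := poly z (+ 0 ∷ + 4 ∷ + 48 ∷ [])) ≈-refl Z))))

-- Weighted spans of powers of Z

3^_ : ℕ → ℤ
3^ n = (+ 3) ℤ.^ n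

3^-mono-∣ : ∀ {m n} → m ≤ n → 3^ m ∣ 3^ n
3^-mono-∣ {m} {n} m≤n = divides (3^ (n ℕ.∸ m))
  (trans (cong 3^_ (sym (ℕ.m∸n+n≡m m≤n))) (ℤ.^-distribˡ-+-* (+ 3) (n ℕ.∸ m) m))

infixl 6 _⊞_

-- The series that agree modulo q^M with a combination of the 3^(w n) Z^(n+1).
data Span (M : ℕ) (w : ℕ → ℕ) : Series → Set where
  gen   : ∀ n → Span M w (ι (3^ w n) ⊗ Z ↑ suc n)
  zero  : Span M w 𝟘
  _⊞_   : ∀ {f g} → Span M w f → Span M w g → Span M w (f ⊕ g)
  scale : ∀ c {f} → Span M w f → Span M w (ι c ⊗ f)
  respects : ∀ {f g} → f ≈[ M ] g → Span M w f → Span M w g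

resp-≈ : ∀ {M w f g} → f ≈ g → Span M w f → Span M w g
resp-≈ p = respects (≈⇒≈[] p)

Span-map : ∀ {M M′ w w′} (L : Series → Series) → (∀ {f g} → f ≈[ M ] g → L f ≈[ M′ ] L g) →
  (∀ f g → L (f ⊕ g) ≈ L f ⊕ L g) → (∀ c f → L (ι c ⊗ f) ≈ ι c ⊗ L f) →
  (∀ n → Span M′ w′ (ι (3^ w n) ⊗ L (Z ↑ suc n))) → ∀ {f} → Span M w f → Span M′ w′ (L f)
Span-map {M} {M′} {w} {w′} L L-cong L-⊕ L-ι L-gen = go
  where
  L-𝟘 : L 𝟘 ≈[ M′ ] 𝟘
  L-𝟘 = ≈[]-trans (L-cong (≈⇒≈[] (≈-trans (≈-sym ι-0) (solve 0 (# 0 := # 0 :* # 0) ≈-refl))))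
    (≈[]-trans (≈⇒≈[] (L-ι 0ℤ (ι 0ℤ))) (≈⇒≈[] (≈-trans (solve 1 (λ l → con 0ℤ :* l := con 0ℤ) ≈-refl (L (ι 0ℤ))) ι-0)))
  go : ∀ {f} → Span M w f → Span M′ w′ (L f)
  go (gen n)     = resp-≈ (≈-sym (L-ι (3^ w n) (Z ↑ suc n))) (L-gen n)
  go zero        = respects (≈[]-sym L-𝟘) zero
  go (p ⊞ q)     = resp-≈ (≈-sym (L-⊕ _ _)) (go p ⊞ go q)
  go (scale c p) = resp-≈ (≈-sym (L-ι c _)) (scale c (go p))
  go (respects e p)  = respects (L-cong e) (go p)

Span-divisible : ∀ {M} (w w′ : ℕ → ℕ) n → 3^ w′ n ∣ 3^ w n → Span M w′ (ι (3^ w n) ⊗ Z ↑ suc n)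
Span-divisible w w′ n (divides q eq) = resp-≈
  (≈-trans (≈-sym (CommutativeRing.*-assoc series _ _ _)) (⊗-cong (≈-trans (≈-sym (ι-* q (3^ w′ n))) (≈-reflexive (cong ι (sym eq)))) ≈-refl))
  (scale q (gen n))

Span-weaken : ∀ {M w w′} → (∀ n → w′ n ≤ w n) → ∀ {f} → Span M w f → Span M w′ f
Span-weaken {w = w} {w′} le = Span-map (λ f → f) (λ p → p) (λ _ _ → ≈-refl) (λ _ _ → ≈-refl)
  (λ n → Span-divisible w w′ n (3^-mono-∣ (le n)))

Span-scale : ∀ e {M w f} → Span M w f → Span M (λ n → e ℕ.+ w n) (ι (3^ e) ⊗ f)
Span-scale e {w = w} = Span-map (ι (3^ e) ⊗_) (⊗-cong[] ≈[]-refl) (CommutativeRing.distribˡ series (ι (3^ e)))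
  (λ c f → solve 3 (λ a c f → a :* (c :* f) := c :* (a :* f)) ≈-refl (ι (3^ e)) (ι c) f)
  (λ n → resp-≈ (≈-trans (⊗-cong (≈-trans (≈-reflexive (cong ι (ℤ.^-distribˡ-+-* (+ 3) e (w n)))) (ι-* (3^ e) (3^ w n))) ≈-refl)
      (solve 3 (λ a c f → a :* c :* f := c :* (a :* f)) ≈-refl (ι (3^ e)) (ι (3^ w n)) (Z ↑ suc n))) (gen n))

Divisible : (ℕ → ℕ) → ℕ → List ℤ → Set
Divisible w k []       = ⊤
Divisible w k (c ∷ cs) = 3^ w k ∣ c × Divisible w (suc k) cs

divisible? : ∀ w k cs → Dec (Divisible w k cs)
divisible? w k []       = yes tt
divisible? w k (c ∷ cs) = 3^ w k ∣? c ×-dec divisible? w (suc k) cs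

Span-evalAt : ∀ {M w} k cs → Divisible w k cs → Span M w (Z ↑ suc k ⊗ evalAt Z cs)
Span-evalAt {w = w} k [] tt = resp-≈ (≈-trans (≈-sym ι-0) (solve 1 (λ z → con 0ℤ := z :* con 0ℤ) ≈-refl (Z ↑ suc k))) zero
Span-evalAt {w = w} k (c ∷ cs) (divides q eq , ds) = resp-≈
  (begin
    ι q ⊗ (ι (3^ w k) ⊗ Z ↑ suc k) ⊕ Z ↑ suc (suc k) ⊗ evalAt Z cs
      ≈⟨ ⊕-cong (≈-sym (CommutativeRing.*-assoc series _ _ _)) (⊗-cong (↑-suc Z (suc k)) ≈-refl) ⟩
    ι q ⊗ ι (3^ w k) ⊗ Z ↑ suc k ⊕ Z ⊗ Z ↑ suc k ⊗ evalAt Z cs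
      ≈⟨ ⊕-cong (⊗-cong (≈-trans (≈-sym (ι-* q (3^ w k))) (≈-reflexive (cong ι (sym eq)))) ≈-refl) ≈-refl ⟩
    ι c ⊗ Z ↑ suc k ⊕ Z ⊗ Z ↑ suc k ⊗ evalAt Z cs
      ≈⟨ solve 4 (λ c z p e → c :* p :+ z :* p :* e := p :* (c :+ z :* e)) ≈-refl (ι c) Z (Z ↑ suc k) (evalAt Z cs) ⟩
    Z ↑ suc k ⊗ evalAt Z (c ∷ cs) ∎)
  (scale q (gen k) ⊞ Span-evalAt (suc k) cs ds)
  where open ≈-Reasoning

Member : (ℕ → ℕ) → List ℤ → Set
Member w []       = ⊤
Member w (c ∷ cs) = c ≡ 0ℤ × Divisible w 0 cs

member? : ∀ w cs → Dec (Member w cs)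
member? w []       = yes tt
member? w (c ∷ cs) = c ℤ.≟ 0ℤ ×-dec divisible? w 0 cs

Span-member : ∀ {M w} cs → Member w cs → Span M w (evalAt Z cs)
Span-member []       tt          = resp-≈ (≈-sym ι-0) zero
Span-member (c ∷ cs) (refl , ds) = resp-≈
  (≈-trans (⊗-cong (≈-trans (↑-suc Z 0) (CommutativeRing.*-identityʳ series Z)) ≈-refl)
    (solve 2 (λ z e → z :* e := con 0ℤ :+ z :* e) ≈-refl Z (evalAt Z cs)))
  (Span-evalAt 0 cs ds)

-- Multiplication by a polynomial whose m-th coefficient is divisible by
-- 3^(m+1) preserves spans with such weights.
Slow : (ℕ → ℕ) → Set
Slow w = ∀ j n → w (j ℕ.+ n) ≤ suc j ℕ.+ w n

module _ {M : ℕ} {w : ℕ → ℕ} (slow : Slow w) where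

  private
    divisible-·ₗ : ∀ n j cs → Divisible suc j cs → Divisible w (j ℕ.+ n) (3^ w n ·ₗ cs)
    divisible-·ₗ n j []       tt       = tt
    divisible-·ₗ n j (c ∷ cs) (d , ds) = ∣-trans (3^-mono-∣ (slow j n))
        (subst (_∣ 3^ w n ℤ.* c) (trans (sym (ℤ.^-distribˡ-+-* (+ 3) (w n) (suc j))) (cong 3^_ (ℕ.+-comm (w n) (suc j)))) (*-monoʳ-∣ (3^ w n) d))
      , divisible-·ₗ n (suc j) cs ds

  Span-multiply : ∀ cs → Divisible suc 0 cs → ∀ {f} → Span M w f → Span M w (evalAt Z cs ⊗ f)
  Span-multiply cs ds = Span-map (evalAt Z cs ⊗_) (⊗-cong[] ≈[]-refl) (CommutativeRing.distribˡ series (evalAt Z cs))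
    (λ c f → solve 3 (λ a c f → a :* (c :* f) := c :* (a :* f)) ≈-refl (evalAt Z cs) (ι c) f)
    (λ n → resp-≈ (≈-trans (⊗-cong ≈-refl (evalAt-· Z (3^ w n) cs))
       (solve 3 (λ z a e → z :* (a :* e) := a :* (e :* z)) ≈-refl (Z ↑ suc n) (ι (3^ w n)) (evalAt Z cs)))
       (Span-evalAt n (3^ w n ·ₗ cs) (divisible-·ₗ n 0 cs ds)))

  -- The geometric series: f is split off and the inverse is applied to - 9Z f, which stays in the
  -- span because 3² divides 9, and whose order in q is one higher. After M steps the remainder
  -- vanishes modulo q^M.
  Span-1/1+9Z : ∀ {f} → Span M w f → Span M w (1/ 1+9Z ⊗ f)
  Span-1/1+9Z {f} = go 0 M refl (mk λ _ ())
    where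
    go : ∀ j k → j ℕ.+ k ≡ M → ∀ {f} → f ≈[ j ] 𝟘 → Span M w f → Span M w (1/ 1+9Z ⊗ f)
    go j zero j≡M {f} f≈𝟘 p = respects (≈[]-sym (⊗-zeroʳ[] (1/ 1+9Z) (subst (λ j → f ≈[ j ] 𝟘) (trans (sym (ℕ.+-identityʳ j)) j≡M) f≈𝟘))) zero
    go j (suc k) j+k≡M {f} f≈𝟘 p = resp-≈
      (modulo (solve 3 (λ i z f → f :+ i :* (poly z (+ 0 ∷ - + 9 ∷ []) :* f) := i :* f :+ f :* (one :- (one :+ # 9 :* z) :* i)) ≈-refl (1/ 1+9Z) Z f)
        (_ ∙ vanish (≈-sym (⊗-inverseʳ 1+9Z-at-0))))
      (p ⊞ go (suc j) k (trans (sym (ℕ.+-suc j k)) j+k≡M)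
        (≈[]-trans (≈⇒≈[] (solve 2 (λ z f → poly z (+ 0 ∷ - + 9 ∷ []) :* f := z :* (:- # 9 :* f)) ≈-refl Z f))
          (⊗-vanish-suc Z-at-0 (⊗-zeroʳ[] _ f≈𝟘)))
        (Span-multiply (+ 0 ∷ - + 9 ∷ []) (toWitness {a? = divisible? suc 0 (+ 0 ∷ - + 9 ∷ [])} tt) p))

-- Spans of extracted powers of Z

Z-in-t : List ℤ
Z-in-t = + 0 ∷ + 1 ∷ + 3 ∷ + 3 ∷ []

U₀-list : List ℤ → ℕ → List ℤ
U₀-list κ i = moments (κ *ₗ (Z-in-t ^ₗ i)) (+ 1 ∷ []) (+ 0 ∷ + 4 ∷ []) (+ 0 ∷ + 4 ∷ + 48 ∷ [])

Z↑-t : ∀ κ i → evalAt t κ ⊗ Z ↑ i ≈ evalAt t (κ *ₗ (Z-in-t ^ₗ i))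
Z↑-t κ i = ≈-trans (⊗-cong ≈-refl (≈-trans (↑-cong Z-t i) (≈-sym (evalAt-^ t Z-in-t i)))) (≈-sym (evalAt-* t κ (Z-in-t ^ₗ i)))

-- The finite verifications: the coefficients are computed and their divisibility is decided by
-- evaluation during type checking.
Span-U₀ : ∀ {M} w κ c i → {True (member? w (c ·ₗ U₀-list κ i))} → Span M w (ι c ⊗ U₀ (evalAt t κ ⊗ Z ↑ i))
Span-U₀ w κ c i {member} = resp-≈
  (≈-trans (evalAt-· Z c (U₀-list κ i)) (⊗-cong ≈-refl (≈-sym (≈-trans (U₀-cong (Z↑-t κ i)) (U₀-polynomial (κ *ₗ (Z-in-t ^ₗ i)))))))
  (Span-member (c ·ₗ U₀-list κ i) (toWitness member))

-- The coefficients of `Z-cubic` as polynomials in ζ, which becomes Z after extraction.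
e₁ e₂ e₃ : List ℤ
e₁ = + 0 ∷ + 57 ∷ + 1080 ∷ + 5184 ∷ []
e₂ = + 0 ∷ + 15 ∷ + 279 ∷ + 1296 ∷ []
e₃ = + 0 ∷ + 1 ∷ + 18 ∷ + 81 ∷ []

module _ (K : Series) where

  private
    u : ℕ → Series
    u i = U₀ (K ⊗ Z ↑ i)

  U₀-recurrence : ∀ i → u (3 ℕ.+ i) ≈ evalAt Z e₁ ⊗ u (2 ℕ.+ i) ⊕ evalAt Z e₂ ⊗ u (1 ℕ.+ i) ⊕ evalAt Z e₃ ⊗ u i
  U₀-recurrence i = begin
    U₀ (K ⊗ Z ↑ (3 ℕ.+ i))
      ≈⟨ U₀-cong (⊗-cong ≈-refl (≈-trans (↑-suc Z (2 ℕ.+ i)) (⊗-cong ≈-refl z²))) ⟩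
    U₀ (K ⊗ (Z ⊗ (Z ⊗ (Z ⊗ p))))
      ≈⟨ U₀-cong (modulo (solve 6 (λ K z p a b c → K :* (z :* (z :* (z :* p))) :=
           a :* (K :* (z :* (z :* p))) :+ b :* (K :* (z :* p)) :+ c :* (K :* p) :+ K :* p :* (z :* z :* z :- (a :* (z :* z) :+ b :* z :+ c)))
           ≈-refl K Z p (E e₁) (E e₂) (E e₃)) (_ ∙ vanish Z-cubic)) ⟩
    U₀ (E e₁ ⊗ (K ⊗ (Z ⊗ (Z ⊗ p))) ⊕ E e₂ ⊗ (K ⊗ (Z ⊗ p)) ⊕ E e₃ ⊗ (K ⊗ p))
      ≈⟨ U₀-cong (⊕-cong (⊕-cong (⊗-cong (≈-sym (V-evalAt Z e₁)) (⊗-cong ≈-refl (≈-sym z²)))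
           (⊗-cong (≈-sym (V-evalAt Z e₂)) (⊗-cong ≈-refl (≈-sym z¹)))) (⊗-cong (≈-sym (V-evalAt Z e₃)) ≈-refl)) ⟩
    U₀ (V (evalAt Z e₁) ⊗ (K ⊗ Z ↑ (2 ℕ.+ i)) ⊕ V (evalAt Z e₂) ⊗ (K ⊗ Z ↑ (1 ℕ.+ i)) ⊕ V (evalAt Z e₃) ⊗ (K ⊗ p))
      ≈⟨ ≈-trans (U₀-⊕ _ _) (⊕-cong (≈-trans (U₀-⊕ _ _) (⊕-cong (U₀-V⊗ _ _) (U₀-V⊗ _ _))) (U₀-V⊗ _ _)) ⟩
    evalAt Z e₁ ⊗ u (2 ℕ.+ i) ⊕ evalAt Z e₂ ⊗ u (1 ℕ.+ i) ⊕ evalAt Z e₃ ⊗ u i ∎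
    where
    open ≈-Reasoning
    E = evalAt (V Z)
    p = Z ↑ i
    z¹ : Z ↑ (1 ℕ.+ i) ≈ Z ⊗ p
    z¹ = ↑-suc Z i
    z² : Z ↑ (2 ℕ.+ i) ≈ Z ⊗ (Z ⊗ p)
    z² = ≈-trans (↑-suc Z (suc i)) (⊗-cong ≈-refl z¹)

  -- Multiplied by 3^(n+3), the recurrence acquires the coefficients 3 e₁, 9 e₂ and 27 e₃, whose
  -- m-th entries are divisible by 3^(m+1). `Span-multiply` applies to them, so three initial values
  -- suffice.
  Span-recurrence : ∀ {M w} → Slow w → ∀ i →
    Span M w (ι (3^ 0) ⊗ u i) → Span M w (ι (3^ 1) ⊗ u (1 ℕ.+ i)) → Span M w (ι (3^ 2) ⊗ u (2 ℕ.+ i)) →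
    ∀ n → Span M w (ι (3^ n) ⊗ u (n ℕ.+ i))
  Span-recurrence {M} {w} slow i b₀ b₁ b₂ n = proj₁ (go n)
    where
    scaled : ℕ → Series
    scaled n = ι (3^ n) ⊗ u (n ℕ.+ i)
    l₁ = + 3 ·ₗ e₁
    l₂ = + 9 ·ₗ e₂
    l₃ = + 27 ·ₗ e₃
    step : ∀ n → Span M w (scaled n) → Span M w (scaled (1 ℕ.+ n)) → Span M w (scaled (2 ℕ.+ n)) → Span M w (scaled (3 ℕ.+ n))
    step n s₀ s₁ s₂ = resp-≈ (begin
      evalAt Z l₁ ⊗ scaled (2 ℕ.+ n) ⊕ evalAt Z l₂ ⊗ scaled (1 ℕ.+ n) ⊕ evalAt Z l₃ ⊗ scaled n
        ≈⟨ ⊕-cong (⊕-cong (⊗-cong (evalAt-· Z (+ 3) e₁) (⊗-cong (≈-trans (p-suc (suc n)) (⊗-cong ≈-refl (p-suc n))) ≈-refl))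
             (⊗-cong (evalAt-· Z (+ 9) e₂) (⊗-cong (ι-* (+ 3) (3^ n)) ≈-refl))) (⊗-cong (evalAt-· Z (+ 27) e₃) ≈-refl) ⟩
      ι (+ 3) ⊗ E₁ ⊗ (ι (+ 3) ⊗ (ι (+ 3) ⊗ p) ⊗ v₂) ⊕ ι (+ 9) ⊗ E₂ ⊗ (ι (+ 3) ⊗ p ⊗ v₁) ⊕ ι (+ 27) ⊗ E₃ ⊗ (p ⊗ v₀)
        ≈⟨ solve 7 (λ p a b c x y z → # 3 :* a :* (# 3 :* (# 3 :* p) :* x) :+ # 9 :* b :* (# 3 :* p :* y) :+ # 27 :* c :* (p :* z) :=
             # 3 :* (# 3 :* (# 3 :* p)) :* (a :* x :+ b :* y :+ c :* z)) ≈-refl p E₁ E₂ E₃ v₂ v₁ v₀ ⟩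
      ι (+ 3) ⊗ (ι (+ 3) ⊗ (ι (+ 3) ⊗ p)) ⊗ (E₁ ⊗ v₂ ⊕ E₂ ⊗ v₁ ⊕ E₃ ⊗ v₀)
        ≈⟨ ⊗-cong (≈-trans (ι-* (+ 3) (3^ (2 ℕ.+ n))) (⊗-cong ≈-refl (≈-trans (p-suc (suc n)) (⊗-cong ≈-refl (p-suc n))))) (U₀-recurrence (n ℕ.+ i)) ⟨
      scaled (3 ℕ.+ n) ∎)
      (Span-multiply slow l₁ (toWitness {a? = divisible? suc 0 l₁} tt) s₂
       ⊞ Span-multiply slow l₂ (toWitness {a? = divisible? suc 0 l₂} tt) s₁
       ⊞ Span-multiply slow l₃ (toWitness {a? = divisible? suc 0 l₃} tt) s₀)
      where
      open ≈-Reasoning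
      p = ι (3^ n)
      E₁ = evalAt Z e₁
      E₂ = evalAt Z e₂
      E₃ = evalAt Z e₃
      v₀ = u (n ℕ.+ i)
      v₁ = u (1 ℕ.+ n ℕ.+ i)
      v₂ = u (2 ℕ.+ n ℕ.+ i)
      p-suc : ∀ k → ι (3^ (suc k)) ≈ ι (+ 3) ⊗ ι (3^ k)
      p-suc k = ι-* (+ 3) (3^ k)
    go : ∀ n → Span M w (scaled n) × Span M w (scaled (1 ℕ.+ n)) × Span M w (scaled (2 ℕ.+ n))
    go zero    = b₀ , b₁ , b₂
    go (suc n) = let s₀ , s₁ , s₂ = go n in s₁ , s₂ , step n s₀ s₁ s₂

-- The generating functions modulo powers of 3

-- Exponents of 3 in the coefficients of Z^(n+1): P for the residues modulo odd
-- powers of 3 and R for those modulo even powers.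
P-weight R-weight : ℕ → ℕ
P-weight 0 = 0
P-weight 1 = 0
P-weight n = n
R-weight n = n ℕ.∸ 2

-- The weight is always n or n - 1; its jump from 0 at n = 1 to 2 at n = 2 exhausts the bound.
P-slow : ∀ e → Slow (λ n → e ℕ.+ P-weight n)
P-slow e j n = ℕ.≤-trans (ℕ.+-monoʳ-≤ e (ℕ.≤-trans (upper (j ℕ.+ n)) (ℕ.≤-trans (ℕ.+-monoʳ-≤ j (lower n)) (ℕ.≤-reflexive (ℕ.+-suc j (P-weight n))))))
  (ℕ.≤-reflexive (begin
    e ℕ.+ (suc j ℕ.+ P-weight n) ≡⟨ ℕ.+-assoc e (suc j) _ ⟨
    e ℕ.+ suc j ℕ.+ P-weight n   ≡⟨ cong (ℕ._+ P-weight n) (ℕ.+-comm e (suc j)) ⟩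
    suc j ℕ.+ e ℕ.+ P-weight n   ≡⟨ ℕ.+-assoc (suc j) e _ ⟩
    suc j ℕ.+ (e ℕ.+ P-weight n) ∎))
  where
  open ≡-Reasoning
  upper : ∀ n → P-weight n ≤ n
  upper 0 = z≤n
  upper 1 = z≤n
  upper (suc (suc n)) = ℕ.≤-refl
  lower : ∀ n → n ≤ suc (P-weight n)
  lower 0 = z≤n
  lower 1 = s≤s z≤n
  lower (suc (suc n)) = ℕ.n≤1+n _

R-slow : ∀ e → Slow (λ n → e ℕ.+ R-weight n)
R-slow e j n = ℕ.≤-trans (ℕ.+-monoʳ-≤ e (ℕ.≤-trans (bound j n) (ℕ.n≤1+n _)))
  (ℕ.≤-reflexive (begin
    e ℕ.+ (suc j ℕ.+ R-weight n) ≡⟨ ℕ.+-assoc e (suc j) _ ⟨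
    e ℕ.+ suc j ℕ.+ R-weight n   ≡⟨ cong (ℕ._+ R-weight n) (ℕ.+-comm e (suc j)) ⟩
    suc j ℕ.+ e ℕ.+ R-weight n   ≡⟨ ℕ.+-assoc (suc j) e _ ⟩
    suc j ℕ.+ (e ℕ.+ R-weight n) ∎))
  where
  open ≡-Reasoning
  bound : ∀ j n → (j ℕ.+ n) ℕ.∸ 2 ≤ j ℕ.+ (n ℕ.∸ 2)
  bound j n = ℕ.m≤n+o⇒m∸n≤o (j ℕ.+ n) 2 (ℕ.≤-trans (ℕ.+-monoʳ-≤ j (ℕ.m≤n+m∸n n 2))
    (ℕ.≤-reflexive (trans (sym (ℕ.+-assoc j 2 _)) (cong (ℕ._+ (n ℕ.∸ 2)) (ℕ.+-comm j 2)))))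

1+8Z-in-t : List ℤ
1+8Z-in-t = + 1 ∷ + 8 ∷ + 24 ∷ + 24 ∷ []

1+8Z-t : 1+8Z ≈ evalAt t 1+8Z-in-t
1+8Z-t = modulo (solve 2 (λ t z → one :+ # 8 :* z := poly t (+ 1 ∷ + 8 ∷ + 24 ∷ + 24 ∷ []) :+ # 8 :* (z :- poly t (+ 0 ∷ + 1 ∷ + 3 ∷ + 3 ∷ []))) ≈-refl t Z)
  (_ ∙ vanish Z-t)

module _ {M : ℕ} where

  -- The coefficients are 33, 1128, 12096 and 41472. Their common factor 3 is the summand 1 in the
  -- exponent 2⌊α/2⌋ + 1.
  Span-kernel : Span M (λ n → 1 ℕ.+ P-weight n) (U₀ (evalAt t kernel ⊗ 𝟙))
  Span-kernel = resp-≈ (solve 1 (λ u → # 1 :* u := u) ≈-refl _) (Span-U₀ (λ n → 1 ℕ.+ P-weight n) kernel (+ 1) 0)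

  Span-kernel-Z : ∀ n → Span M P-weight (ι (3^ R-weight n) ⊗ U₀ (evalAt t kernel ⊗ Z ↑ suc n))
  Span-kernel-Z 0 = Span-U₀ P-weight kernel (+ 1) 1
  Span-kernel-Z 1 = Span-U₀ P-weight kernel (+ 1) 2
  Span-kernel-Z (suc (suc n)) = subst (λ k → Span M P-weight (ι (3^ n) ⊗ U₀ (evalAt t kernel ⊗ Z ↑ k))) (ℕ.+-comm n 3)
    (Span-recurrence (evalAt t kernel) (P-slow 0) 3
      (Span-U₀ P-weight kernel (+ 1) 3) (Span-U₀ P-weight kernel (+ 3) 4) (Span-U₀ P-weight kernel (+ 9) 5) n)

  -- This step gains the factor 9, recorded by the 2 in the target weight.
  Span-1+8Z-Z : ∀ n → Span M (λ n → 2 ℕ.+ R-weight n) (ι (3^ P-weight n) ⊗ U₀ (1+8Z ⊗ Z ↑ suc n))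
  Span-1+8Z-Z n = resp-≈ (⊗-cong ≈-refl (U₀-cong (⊗-cong (≈-sym 1+8Z-t) ≈-refl))) (go n)
    where
    wₑ : ℕ → ℕ
    wₑ n = 2 ℕ.+ R-weight n
    -- The P-weight of n + 2 exceeds the exponent n of the recurrence by 2; the surplus 9 is moved
    -- into the polynomial in t.
    9κ : List ℤ
    9κ = + 9 ·ₗ 1+8Z-in-t
    go : ∀ n → Span M wₑ (ι (3^ P-weight n) ⊗ U₀ (evalAt t 1+8Z-in-t ⊗ Z ↑ suc n))
    go 0 = Span-U₀ wₑ 1+8Z-in-t (+ 1) 1
    go 1 = Span-U₀ wₑ 1+8Z-in-t (+ 1) 2
    go (suc (suc n)) = resp-≈ (begin
      ι (3^ n) ⊗ U₀ (evalAt t 9κ ⊗ Z ↑ (n ℕ.+ 3))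
        ≡⟨ cong (λ k → ι (3^ n) ⊗ U₀ (evalAt t 9κ ⊗ Z ↑ k)) (ℕ.+-comm n 3) ⟩
      ι (3^ n) ⊗ U₀ (evalAt t 9κ ⊗ Z ↑ (3 ℕ.+ n))
        ≈⟨ ⊗-cong ≈-refl (≈-trans (U₀-cong (≈-trans (⊗-cong (evalAt-· t (+ 9) 1+8Z-in-t) ≈-refl)
             (CommutativeRing.*-assoc series _ _ _))) (U₀-ι⊗ (+ 9) _)) ⟩
      ι (3^ n) ⊗ (ι (+ 9) ⊗ U₀ (evalAt t 1+8Z-in-t ⊗ Z ↑ (3 ℕ.+ n)))
        ≈⟨ solve 2 (λ p u → p :* (# 9 :* u) := # 3 :* (# 3 :* p) :* u) ≈-refl (ι (3^ n)) _ ⟩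
      ι (+ 3) ⊗ (ι (+ 3) ⊗ ι (3^ n)) ⊗ U₀ (evalAt t 1+8Z-in-t ⊗ Z ↑ (3 ℕ.+ n))
        ≈⟨ ⊗-cong (≈-trans (ι-* (+ 3) (3^ (1 ℕ.+ n))) (⊗-cong ≈-refl (ι-* (+ 3) (3^ n)))) ≈-refl ⟨
      ι (3^ (2 ℕ.+ n)) ⊗ U₀ (evalAt t 1+8Z-in-t ⊗ Z ↑ (3 ℕ.+ n)) ∎)
      (Span-recurrence (evalAt t 9κ) (R-slow 2) 3
        (Span-U₀ wₑ 9κ (+ 1) 3) (Span-U₀ wₑ 9κ (+ 3) 4) (Span-U₀ wₑ 9κ (+ 9) 5) n)
      where open ≈-Reasoning

Span-U₀-⊗ : ∀ K {M} {w w′ : ℕ → ℕ} e c → (∀ n → Span M (λ n → c ℕ.+ w′ n) (ι (3^ w n) ⊗ U₀ (K ⊗ Z ↑ suc n))) →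
  ∀ {f} → Span (M ℕ.* 3) (λ n → e ℕ.+ w n) f → Span M (λ n → e ℕ.+ (c ℕ.+ w′ n)) (U₀ (K ⊗ f))
Span-U₀-⊗ K {w = w} e c h = Span-map (λ f → U₀ (K ⊗ f)) (λ p → U₀-cong[] (⊗-cong[] ≈[]-refl p))
  (λ f g → ≈-trans (U₀-cong (CommutativeRing.distribˡ series K f g)) (U₀-⊕ _ _))
  (λ c f → ≈-trans (U₀-cong (solve 3 (λ a c f → a :* (c :* f) := c :* (a :* f)) ≈-refl K (ι c) f)) (U₀-ι⊗ c _))
  (λ n → resp-≈ (≈-trans (≈-sym (CommutativeRing.*-assoc series _ _ _))
      (⊗-cong (≈-sym (≈-trans (≈-reflexive (cong ι (ℤ.^-distribˡ-+-* (+ 3) e (w n)))) (ι-* (3^ e) (3^ w n)))) ≈-refl))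
    (Span-scale e (h n)))

evenStep : Series → Series
evenStep F = U₀ (oddStep F)

evenStep-Span : ∀ e F → (∀ M → Span M (λ n → e ℕ.+ P-weight n) (U₀ (evalAt t kernel ⊗ F))) →
  ∀ M → Span M (λ n → e ℕ.+ (2 ℕ.+ R-weight n)) (evenStep F)
evenStep-Span e F h M = Span-U₀-⊗ 1+8Z e 2 Span-1+8Z-Z (Span-1/1+9Z (P-slow e) (h (M ℕ.* 3)))

-- In positive degrees m, `d₂ ⊗ F a` generates the values of d₂ at 9^(a+1) m - `offset a`; see
-- `d₂-F`.
F : ℕ → Series
F zero    = evenStep 𝟙
F (suc a) = evenStep (F a)

-- The exponent 2a + 3 is 1 from `Span-kernel` plus 2 for each of the a + 1 even steps.
F-Span : ∀ a M → Span M (λ n → (a ℕ.* 2 ℕ.+ 3) ℕ.+ R-weight n) (F a)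
F-Span zero      = evenStep-Span 1 𝟙 (λ _ → Span-kernel)
F-Span (suc a) M = Span-weaken (λ n → ℕ.≤-reflexive (begin
    (2 ℕ.+ (a ℕ.* 2 ℕ.+ 3)) ℕ.+ R-weight n ≡⟨ cong (ℕ._+ R-weight n) (ℕ.+-comm 2 (a ℕ.* 2 ℕ.+ 3)) ⟩
    (a ℕ.* 2 ℕ.+ 3) ℕ.+ 2 ℕ.+ R-weight n   ≡⟨ ℕ.+-assoc (a ℕ.* 2 ℕ.+ 3) 2 _ ⟩
    (a ℕ.* 2 ℕ.+ 3) ℕ.+ (2 ℕ.+ R-weight n) ∎))
  (evenStep-Span (a ℕ.* 2 ℕ.+ 3) (F a) (λ M → Span-U₀-⊗ (evalAt t kernel) (a ℕ.* 2 ℕ.+ 3) 0 Span-kernel-Z (F-Span a (M ℕ.* 3))) M)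
  where open ≡-Reasoning

-- From spans to the values of d₂

⊗-divisible : ∀ k f {g} n → (∀ i → i ≤ n → k ∣ g i) → k ∣ (f ⊗ g) n
⊗-divisible k f {g} zero    h = subst (k ∣_) (sym (⊗-at-0 f g)) (∣n⇒∣m*n (f 0) (h 0 z≤n))
⊗-divisible k f {g} (suc n) h = subst (k ∣_) (sym (⊗-at-suc f g n))
  (∣m∣n⇒∣m+n (∣n⇒∣m*n (f 0) (h (suc n) ℕ.≤-refl)) (⊗-divisible k (tail f) n λ i i≤n → h i (ℕ.m≤n⇒m≤1+n i≤n)))

Span-∣ : ∀ {M w} e → (∀ n → e ≤ w n) → ∀ {f} → Span M w f → ∀ i → i < M → 3^ e ∣ f i
Span-∣ {w = w} e e≤w (gen n) i _ = subst (3^ e ∣_) (sym (ι⊗-at (3^ w n) (Z ↑ suc n) i)) (∣m⇒∣m*n _ (3^-mono-∣ (e≤w n)))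
Span-∣ e e≤w zero i _ = subst (3^ e ∣_) (sym (𝟘-at i)) (divides 0ℤ refl)
Span-∣ e e≤w (_⊞_ {f} {g} p q) i i<M = subst (3^ e ∣_) (sym (⊕-at f g i)) (∣m∣n⇒∣m+n (Span-∣ e e≤w p i i<M) (Span-∣ e e≤w q i i<M))
Span-∣ e e≤w (scale c {f} p) i i<M = subst (3^ e ∣_) (sym (ι⊗-at c f i)) (∣n⇒∣m*n c (Span-∣ e e≤w p i i<M))
Span-∣ e e≤w (respects q p) i i<M = subst (3^ e ∣_) (below q i i<M) (Span-∣ e e≤w p i i<M)

⊗-Span-∣ : ∀ {w} e f {g} → (∀ n → e ≤ w n) → (∀ M → Span M w g) → ∀ n → 3^ e ∣ (f ⊗ g) n
⊗-Span-∣ e f e≤w h n = ⊗-divisible (3^ e) f n λ i i≤n → Span-∣ e e≤w (h (suc n)) i (s≤s i≤n)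

-- The factor q in `U₀-X⊗d₂` moves the exponents 3n + 2, the class inverse to 8 modulo 3, to
-- multiples of 3.
d₂-oddStep : ∀ G n → (V d₂ ⊗ oddStep G) (suc n) ≡ (d₂ ⊗ G) (2 ℕ.+ n ℕ.* 3)
d₂-oddStep G n = trans (sym (at (U₀-X⊗d₂ G) (suc n))) (X⊗-at-suc (d₂ ⊗ G) (2 ℕ.+ n ℕ.* 3))

d₂-evenStep : ∀ G n → (d₂ ⊗ evenStep G) (suc n) ≡ (d₂ ⊗ G) (8 ℕ.+ n ℕ.* 9)
d₂-evenStep G n = begin
  (d₂ ⊗ evenStep G) (suc n)                   ≡⟨ at (U₀-V⊗ d₂ (oddStep G)) (suc n) ⟨
  (V d₂ ⊗ oddStep G) (suc (2 ℕ.+ n ℕ.* 3))    ≡⟨ d₂-oddStep G (2 ℕ.+ n ℕ.* 3) ⟩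
  (d₂ ⊗ G) (8 ℕ.+ n ℕ.* 3 ℕ.* 3)              ≡⟨ cong (λ k → (d₂ ⊗ G) (8 ℕ.+ k)) (ℕ.*-assoc n 3 3) ⟩
  (d₂ ⊗ G) (8 ℕ.+ n ℕ.* 9)                    ∎
  where open ≡-Reasoning

⊗𝟙-at : ∀ f {i j} → i ≡ j → (f ⊗ 𝟙) i ≡ f j
⊗𝟙-at f {i} refl = at (CommutativeRing.*-identityʳ series f) i

-- offset a = (9^(a+1) - 1) / 8
offset : ℕ → ℕ
offset zero    = 1
offset (suc a) = 9 ℕ.^ suc a ℕ.+ offset a

d₂-F : ∀ a m n → n ℕ.+ offset a ≡ 9 ℕ.^ suc a ℕ.* suc m → (d₂ ⊗ F a) (suc m) ≡ d₂ n
d₂-F zero m n h = trans (d₂-evenStep 𝟙 m) (⊗𝟙-at d₂ (ℕ.suc-injective (begin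
  9 ℕ.+ m ℕ.* 9     ≡⟨ ℕ.*-comm (suc m) 9 ⟩
  9 ℕ.* suc m       ≡⟨ h ⟨
  n ℕ.+ 1           ≡⟨ ℕ.+-comm n 1 ⟩
  suc n             ∎)))
  where open ≡-Reasoning
-- An even step sends the index m + 1 to 9 (m + 1) - 1, here `suc (7 + m * 9)`. The -1, multiplied
-- by 9^(a+1), is the difference between consecutive offsets.
d₂-F (suc a) m n h = trans (d₂-evenStep (F a) m) (d₂-F a (7 ℕ.+ m ℕ.* 9) n (ℕ.+-cancelˡ-≡ p (n ℕ.+ offset a) (p ℕ.* (8 ℕ.+ m ℕ.* 9)) (begin
  p ℕ.+ (n ℕ.+ offset a)        ≡⟨ ℕ.+-assoc p n (offset a) ⟨
  p ℕ.+ n ℕ.+ offset a          ≡⟨ cong (ℕ._+ offset a) (ℕ.+-comm p n) ⟩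
  n ℕ.+ p ℕ.+ offset a          ≡⟨ ℕ.+-assoc n p (offset a) ⟩
  n ℕ.+ offset (suc a)          ≡⟨ h ⟩
  9 ℕ.* p ℕ.* suc m             ≡⟨ cong (ℕ._* suc m) (ℕ.*-comm 9 p) ⟩
  p ℕ.* 9 ℕ.* suc m             ≡⟨ ℕ.*-assoc p 9 (suc m) ⟩
  p ℕ.* (9 ℕ.* suc m)           ≡⟨ cong (p ℕ.*_) (ℕ.*-comm 9 (suc m)) ⟩
  p ℕ.* suc (8 ℕ.+ m ℕ.* 9)     ≡⟨ ℕ.*-suc p (8 ℕ.+ m ℕ.* 9) ⟩
  p ℕ.+ p ℕ.* (8 ℕ.+ m ℕ.* 9)   ∎)))
  where
  open ≡-Reasoning
  p = 9 ℕ.^ suc a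

∣⇒≡0 : ∀ {k z} → k ∣ z → z ≡ 0ℤ [mod k ]
∣⇒≡0 {k} {z} = subst (k ∣_) (sym (ℤ.+-identityʳ z))

pos-^ : ∀ m n → (+ m) ℤ.^ n ≡ + (m ℕ.^ n)
pos-^ m zero    = refl
pos-^ m (suc n) = trans (cong (+ m ℤ.*_) (pos-^ m n)) (sym (ℤ.pos-* m (m ℕ.^ n)))

9^-offset : ∀ a → 9 ℕ.^ suc a ≡ 8 ℕ.* offset a ℕ.+ 1
9^-offset zero    = refl
9^-offset (suc a) = begin
  p ℕ.+ 8 ℕ.* p                      ≡⟨ ℕ.+-comm p (8 ℕ.* p) ⟩
  8 ℕ.* p ℕ.+ p                      ≡⟨ cong (8 ℕ.* p ℕ.+_) (9^-offset a) ⟩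
  8 ℕ.* p ℕ.+ (8 ℕ.* offset a ℕ.+ 1) ≡⟨ ℕ.+-assoc (8 ℕ.* p) (8 ℕ.* offset a) 1 ⟨
  8 ℕ.* p ℕ.+ 8 ℕ.* offset a ℕ.+ 1   ≡⟨ cong (ℕ._+ 1) (ℕ.*-distribˡ-+ 8 p (offset a)) ⟨
  8 ℕ.* (p ℕ.+ offset a) ℕ.+ 1       ∎
  where
  open ≡-Reasoning
  p = 9 ℕ.^ suc a

-- Positivity excludes the quotient 0, in accordance with `d₂-oddStep` and `d₂-F`, which describe
-- coefficients of positive index.
quotient : ∀ {p n} → 1 ≤ n → + p ∣ + n → ∃ λ m → n ≡ p ℕ.* suc m
quotient {p} {n} 1≤n d with ∣⇒∣ᵤ d
... | ℕ.divides zero    eq = case subst (1 ≤_) eq 1≤n of λ ()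
... | ℕ.divides (suc m) eq = m , trans eq (ℕ.*-comm (suc m) p)

d₂-mod-3 : ∀ n → + 3 ∣ + 8 ℤ.* + n ℤ.- 1ℤ → 3^ 1 ∣ d₂ n
d₂-mod-3 n d = subst (3^ 1 ∣_) value (⊗-divisible (3^ 1) (V d₂) (suc k) λ i i≤k → ⊗-Span-∣ 1 1+8Z (λ _ → s≤s z≤n)
  (λ M → Span-1/1+9Z (P-slow 1) (Span-kernel {M})) i)
  where
  n+1 : + 3 ∣ + (n ℕ.+ 1)
  n+1 = 3∣8n-1⇒3∣n+1 n d
  k : ℕ
  k = proj₁ (quotient (ℕ.m≤n+m 1 n) n+1)
  value : (V d₂ ⊗ oddStep 𝟙) (suc k) ≡ d₂ n
  value = trans (d₂-oddStep 𝟙 k) (⊗𝟙-at d₂ (ℕ.suc-injective (begin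
    3 ℕ.+ k ℕ.* 3  ≡⟨ ℕ.*-comm (suc k) 3 ⟩
    3 ℕ.* suc k    ≡⟨ proj₂ (quotient (ℕ.m≤n+m 1 n) n+1) ⟨
    n ℕ.+ 1        ≡⟨ ℕ.+-comm n 1 ⟩
    suc n          ∎)))
    where open ≡-Reasoning

d₂-mod-9^ : ∀ a n → 1 ≤ n → + (9 ℕ.^ suc a) ∣ + 8 ℤ.* + n ℤ.- 1ℤ → 3^ (a ℕ.* 2 ℕ.+ 3) ∣ d₂ n
d₂-mod-9^ a n 1≤n d = subst (3^ (a ℕ.* 2 ℕ.+ 3) ∣_) (d₂-F a k n (proj₂ q))
  (⊗-Span-∣ (a ℕ.* 2 ℕ.+ 3) d₂ (λ n → ℕ.m≤m+n _ (R-weight n)) (F-Span a) (suc k))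
  where
  q : ∃ λ k → n ℕ.+ offset a ≡ 9 ℕ.^ suc a ℕ.* suc k
  q = quotient (ℕ.≤-trans 1≤n (ℕ.m≤m+n n (offset a)))
    (subst (λ p → + p ∣ + (n ℕ.+ offset a)) (sym (9^-offset a))
      (∣8n-1⇒∣n+c n (offset a) (subst (λ p → + p ∣ + 8 ℤ.* + n ℤ.- 1ℤ) (9^-offset a) d)))
  k : ℕ
  k = proj₁ q

theorem1p2 : (n α : ℕ) → 1 ≤ n → 1 ≤ α →
    + 8 * + n ≡ 1ℤ [mod (+ 3) ^ α ] →
    d₂ n ≡ 0ℤ [mod (+ 3) ^ (2 ℕ.* ⌊ α /2⌋ ℕ.+ 1) ]
theorem1p2 n 1             1≤n _ d = ∣⇒≡0 (d₂-mod-3 n d)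
-- Both parities of α = β + 2 are reduced to the modulus 3^(2(a+1)) = 9^(a+1) with a = ⌊β/2⌋; for
-- odd α the congruence is weakened by one power of 3.
theorem1p2 n (suc (suc β)) 1≤n _ d = ∣⇒≡0 (subst (λ e → 3^ e ∣ d₂ n) exponent
  (d₂-mod-9^ a n 1≤n (∣-trans (subst (_∣ 3^ (2 ℕ.+ β)) power (3^-mono-∣ even≤)) d)))
  where
  open ≡-Reasoning
  a : ℕ
  a = ⌊ β /2⌋
  power : 3^ (2 ℕ.* suc a) ≡ + (9 ℕ.^ suc a)
  power = trans (sym (ℤ.^-*-assoc (+ 3) 2 (suc a))) (pos-^ 9 (suc a))
  exponent : a ℕ.* 2 ℕ.+ 3 ≡ 2 ℕ.* suc a ℕ.+ 1
  exponent = begin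
    a ℕ.* 2 ℕ.+ 3       ≡⟨ ℕ.+-comm (a ℕ.* 2) 3 ⟩
    3 ℕ.+ a ℕ.* 2       ≡⟨ ℕ.+-comm 1 (suc a ℕ.* 2) ⟩
    suc a ℕ.* 2 ℕ.+ 1   ≡⟨ cong (ℕ._+ 1) (ℕ.*-comm (suc a) 2) ⟩
    2 ℕ.* suc a ℕ.+ 1   ∎
  even≤ : 2 ℕ.* suc a ≤ 2 ℕ.+ β
  even≤ = ℕ.≤-trans (ℕ.+-monoʳ-≤ (suc a) (ℕ.≤-trans (ℕ.≤-reflexive (ℕ.+-identityʳ (suc a))) (ℕ.⌊n/2⌋≤⌈n/2⌉ (2 ℕ.+ β))))
    (ℕ.≤-reflexive (ℕ.⌊n/2⌋+⌈n/2⌉≡n (2 ℕ.+ β)))
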